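{- The peak functions $\theta_{S,u}$ indexed by admissible pairs $(S,u)$ form a basis of $\mathcal O^{\boldsymbol\infty}$. Moreover, if $\mathbf I$ is a vector composition all of whose columns have odd weight and $u=\mathrm{cw}(\mathbf I)$, then \[\eta_{\mathbf I}=\sum_{S\subseteq\mathrm{Pk}(\widetilde{\mathbf I})}(-1)^{|S|}\theta_{S,u},\] and for every admissible pair $(S,u)$, \[\theta_{S,u}=\sum_{T\subseteq S}(-1)^{|T|}\eta_{\mathrm{odd}(\mathbf I_{T,u})}.\]
   Context: Fix $\ell\ge1$; $|\mathbf n|=\sum n_i$; $\mathbf e_c$ coordinate vectors. Vector composition: sequence $\mathbf I=(\mathbf i_1,\dots,\mathbf i_m)$ of nonzero elements of $\mathbb N^\ell$; $\mathrm{len}(\mathbf I)=m$; $\Sigma\mathbf I=\sum\mathbf i_r$. $\mathbf J\trianglelefteq\mathbf I$: $\mathbf J$ obtained from $\mathbf I$ by adding together groups of consecutive columns. $D(\mathbf I)=\{|\mathbf i_1|,\dots,|\mathbf i_1|+\dots+|\mathbf i_{m-1}|\}$, $D+1=\{s+1:s\in D\}$, $\mathrm{Pk}(\mathbf I)=\{|\mathbf i_1|+\dots+|\mathbf i_r|:1\le r\le m-1,\ |\mathbf i_r|\ge2\}$. Coloring word $\mathrm{cw}(\mathbf I)$: read columns left to right, writing in column $\mathbf i_r$ the color $c$ repeated ($c$-th entry) times for $c=0,\dots,\ell-1$. For $u=u_1\cdots u_n\in\{0,\dots,\ell-1\}^n$, $\mathbf E_u=(\mathbf e_{u_1},\dots,\mathbf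 e_{u_n})$. If the last column of $\mathbf I$ has odd weight, $\mathbf I=\mathbf I_1\cdots\mathbf I_p$ uniquely with each $\mathbf I_j$ having odd-weight last column and even-weight other columns, and $\mathrm{odd}(\mathbf I)=(\Sigma\mathbf I_1,\dots,\Sigma\mathbf I_p)$. For $\mathbf I$ with all columns of odd weight, $\widetilde{\mathbf I}$ is the vector composition with the same coloring word obtained by replacing each column by a vector composition of it whose columns have weight $2$ except the last, of weight $1$. A peak subset of $[n]$ is $S\subseteq\{2,\dots,n-1\}$ with $i\in S\Rightarrow i-1\notin S$. For such $S$ and $u$ of length $n$, $\mathbf I_{S,u}$ is the unique vector composition with all columns of weight $1$ or $2$, coloring word $u$ and $\mathrm{Pk}(\mathbf I_{S,u})=S$; $(S,u)$ is admissible if $\mathrm{cw}(\mathrm{odd}(\mathbf I_{S,u}))=u$. $\mathrm{QSym}^{(\ell)}$: $\mathbb Q$-span of $M_{\mathbf I}=\sum_{j_1<\dots<j_m}\mathbf x_{j_1}^{\mathbf i_1}\cdots\mathbf x_{j_m}^{\mathbf i_m}$ in commuting variables $x_j^{(i)}$ ($\mathbf x_j^{\mathbf n}=\prod_i(x_j^{(i)})^{n_i}$), graded Hopf algebra with deconcatenation coproduct; $\eta_{\mathbf I}=\sum_{\mathbf J\trianglelefteq\mathbf I}2^{\mathrm{len}(\mathbf J)}M_{\mathbf J}$; $\theta_{S,u}=\sum_{\mathbf J\trianglelefteq\mathbf E_u,\ S\subseteq D(\mathbf J)\cup(D(\mathbf J)+1)}2^{\mathrm{len}(\mathbf J)}M_{\mathbf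 J}$. $\zeta_{\mathcal Q}(M_{\mathbf I})=1$ if $\mathrm{len}(\mathbf I)\le1$, else $0$; $\bar\zeta_{\mathcal Q}(h)=(-1)^{|\mathbf n|}\zeta_{\mathcal Q}(h)$ on degree $\mathbf n$; $\mathcal O^{\boldsymbol\infty}$ is the largest graded subcoalgebra $C$ of $\mathrm{QSym}^{(\ell)}$ with $\bar\zeta_{\mathcal Q}(h)=\zeta_{\mathcal Q}^{ -1}(h)$ for all $h\in C$ ($\zeta_{\mathcal Q}^{ -1}$ the convolution inverse). -}

module Defs where

open import Data.Nat as ℕ using (ℕ; zero; suc; _≤_; _≤ᵇ_; _≡ᵇ_; _%_)
open import Data.Bool using (Bool; true; false; if_then_else_; _∧_; _∨_; T)
open import Data.Fin using (Fin)
import Data.Fin as Fin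
open import Data.Vec as Vec using (Vec)
open import Data.List as List using (List; []; _∷_; _++_; map; filter; length; concatMap; allFin; replicate; foldr)
open import Data.List.Relation.Unary.All using (All)
open import Data.List.Relation.Unary.Linked using (Linked)
open import Data.List.Membership.Propositional using (_∈_)
open import Data.List.Properties as LP using ()
open import Data.Vec.Properties as VP using ()
open import Data.Product using (Σ; Σ-syntax; _×_; _,_; proj₁; proj₂; map₁)
open import Data.Integer using (+_)
open import Data.Rational using (ℚ; 0ℚ; 1ℚ; _/_; _+_; _*_; -_)
open import Relation.Binary.PropositionalEquality using (_≡_)
open import Relation.Nullary using (¬_; does)
open import Level using (Level) renaming (suc to lsuc; zero to lzero)

Col : ℕ → Set
Col ℓ = Vec ℕ ℓ

VC : ℕ → Set
VC ℓ = List (Col ℓ)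

wt : ∀ {ℓ} → Col ℓ → ℕ
wt = Vec.sum

ValidVC : ∀ {ℓ} → VC ℓ → Set
ValidVC = All (λ v → 1 ≤ wt v)

zeroCol : ∀ {ℓ} → Col ℓ
zeroCol = Vec.replicate _ 0

_+c_ : ∀ {ℓ} → Col ℓ → Col ℓ → Col ℓ
_+c_ = Vec.zipWith ℕ._+_

ΣI : ∀ {ℓ} → VC ℓ → Col ℓ
ΣI = foldr _+c_ zeroCol

e : ∀ {ℓ} → Fin ℓ → Col ℓ
e c = Vec.tabulate (λ j → if does (j Fin.≟ c) then 1 else 0)

E : ∀ {ℓ} → List (Fin ℓ) → VC ℓ
E = map e

cwCol : ∀ {ℓ} → Col ℓ → List (Fin ℓ)
cwCol {ℓ} v = concatMap (λ c → replicate (Vec.lookup v c) c) (allFin ℓ)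

cw : ∀ {ℓ} → VC ℓ → List (Fin ℓ)
cw = concatMap cwCol

-- all J with J ⊴ I (coarsenings: sum groups of consecutive columns);
-- each coarsening listed exactly once
mergeHead : ∀ {ℓ} → Col ℓ → VC ℓ → VC ℓ
mergeHead v [] = v ∷ []
mergeHead v (w ∷ J) = (v +c w) ∷ J

coarsenings : ∀ {ℓ} → VC ℓ → List (VC ℓ)
coarsenings [] = [] ∷ []
coarsenings (v ∷ []) = (v ∷ []) ∷ []
coarsenings (v ∷ w ∷ I) =
  map (v ∷_) (coarsenings (w ∷ I)) ++ map (mergeHead v) (coarsenings (w ∷ I))

-- D(I) and Pk(I) (as increasing lists of naturals)
Dacc : ∀ {ℓ} → ℕ → VC ℓ → List ℕ
Dacc a [] = []
Dacc a (v ∷ []) = []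
Dacc a (v ∷ w ∷ I) = (a ℕ.+ wt v) ∷ Dacc (a ℕ.+ wt v) (w ∷ I)

D : ∀ {ℓ} → VC ℓ → List ℕ
D = Dacc 0

Pkacc : ∀ {ℓ} → ℕ → VC ℓ → List ℕ
Pkacc a [] = []
Pkacc a (v ∷ []) = []
Pkacc a (v ∷ w ∷ I) =
  (if 2 ≤ᵇ wt v then (a ℕ.+ wt v) ∷ [] else []) ++ Pkacc (a ℕ.+ wt v) (w ∷ I)

Pk : ∀ {ℓ} → VC ℓ → List ℕ
Pk = Pkacc 0

memᵇ : ℕ → List ℕ → Bool
memᵇ x [] = false
memᵇ x (y ∷ ys) = (x ≡ᵇ y) ∨ memᵇ x ys

coveredᵇ : List ℕ → List ℕ → Bool
coveredᵇ [] Dset = true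
coveredᵇ (s ∷ S) Dset =
  (memᵇ s Dset ∨ ((1 ≤ᵇ s) ∧ memᵇ (ℕ.pred s) Dset)) ∧ coveredᵇ S Dset

isOddᵇ : ℕ → Bool
isOddᵇ n = (n % 2) ≡ᵇ 1

-- odd(I): blocks of even-weight columns closed by an odd-weight column
-- (only used for I whose last column has odd weight)
oddAcc : ∀ {ℓ} → Col ℓ → VC ℓ → VC ℓ
oddAcc acc [] = []
oddAcc acc (v ∷ I) =
  if isOddᵇ (wt v) then (acc +c v) ∷ oddAcc zeroCol I else oddAcc (acc +c v) I

oddV : ∀ {ℓ} → VC ℓ → VC ℓ
oddV = oddAcc zeroCol

-- Ĩ for I with all columns of odd weight
pairUp : ∀ {ℓ} → List (Fin ℓ) → VC ℓ
pairUp [] = []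
pairUp (a ∷ []) = e a ∷ []
pairUp (a ∷ b ∷ w) = (e a +c e b) ∷ pairUp w

tilde : ∀ {ℓ} → VC ℓ → VC ℓ
tilde = concatMap (λ v → pairUp (cwCol v))

-- I_{S,u}: columns of weight 1 or 2, coloring word u, Pk = S,
-- last column of weight 1 (positions are 1-based)
IpkAcc : ∀ {ℓ} → ℕ → List ℕ → List (Fin ℓ) → VC ℓ
IpkAcc i S [] = []
IpkAcc i S (a ∷ []) = e a ∷ []
IpkAcc i S (a ∷ b ∷ w) =
  if memᵇ (suc i) S then (e a +c e b) ∷ IpkAcc (suc (suc i)) S w
  else e a ∷ IpkAcc (suc i) S (b ∷ w)

Ipk : ∀ {ℓ} → List ℕ → List (Fin ℓ) → VC ℓ
Ipk = IpkAcc 1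

IsPeakSet : ℕ → List ℕ → Set
IsPeakSet n S =
  Linked ℕ._<_ S
  × All (λ i → 2 ≤ i × suc i ≤ n) S
  × (∀ i → i ∈ S → ¬ (ℕ.pred i ∈ S))

Admissible : ∀ {ℓ} → List ℕ → List (Fin ℓ) → Set
Admissible S u = IsPeakSet (length u) S × cw (oddV (Ipk S u)) ≡ u

-- all sublists (= all subsets of a set given as an increasing list)
sublists : {A : Set} → List A → List (List A)
sublists [] = [] ∷ []
sublists (x ∷ xs) = sublists xs ++ map (x ∷_) (sublists xs)

-- QSym^(ℓ): finite formal ℚ-linear combinations of the M_I

QS : ℕ → Set
QS ℓ = List (ℚ × VC ℓ)

sumℚ : List ℚ → ℚ
sumℚ = foldr _+_ 0ℚ

coeff : ∀ {ℓ} → QS ℓ → VC ℓ → ℚ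
coeff h I = sumℚ (map proj₁ (filter (λ t → LP.≡-dec (VP.≡-dec ℕ._≟_) (proj₂ t) I) h))

_≈_ : ∀ {ℓ} → QS ℓ → QS ℓ → Set
h ≈ g = ∀ I → coeff h I ≡ coeff g I

InQSym : ∀ {ℓ} → QS ℓ → Set
InQSym h = ∀ I → ¬ ValidVC I → coeff h I ≡ 0ℚ

zeroQ : ∀ {ℓ} → QS ℓ
zeroQ = []

_⊕_ : ∀ {ℓ} → QS ℓ → QS ℓ → QS ℓ
_⊕_ = _++_

_·_ : ∀ {ℓ} → ℚ → QS ℓ → QS ℓ
q · h = map (λ t → (q * proj₁ t , proj₂ t)) h

lin : ∀ {ℓ} → List (ℚ × QS ℓ) → QS ℓ
lin cs = concatMap (λ c → proj₁ c · proj₂ c) cs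

component : ∀ {ℓ} → Col ℓ → QS ℓ → QS ℓ
component n h = filter (λ t → VP.≡-dec ℕ._≟_ (ΣI (proj₂ t)) n) h

-- QSym^(ℓ) ⊗ QSym^(ℓ), basis M_I ⊗ M_J
QS2 : ℕ → Set
QS2 ℓ = List (ℚ × VC ℓ × VC ℓ)

coeff2 : ∀ {ℓ} → QS2 ℓ → VC ℓ → VC ℓ → ℚ
coeff2 t I J = sumℚ (map proj₁ (filter
  (λ x → LP.≡-dec (VP.≡-dec ℕ._≟_) (proj₁ (proj₂ x)) I
         Relation.Nullary.×-dec
         LP.≡-dec (VP.≡-dec ℕ._≟_) (proj₂ (proj₂ x)) J) t))
  where import Relation.Nullary

splits : {A : Set} → List A → List (List A × List A)
splits [] = ([] , []) ∷ []
splits (x ∷ xs) = ([] , x ∷ xs) ∷ map (map₁ (x ∷_)) (splits xs)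

Δ : ∀ {ℓ} → QS ℓ → QS2 ℓ
Δ h = concatMap (λ t → map (λ jk → (proj₁ t , proj₁ jk , proj₂ jk)) (splits (proj₂ t))) h

InTensor : ∀ {ℓ} → (QS ℓ → Set) → QS2 ℓ → Set
InTensor {ℓ} C t =
  Σ[ ps ∈ List (QS ℓ × QS ℓ) ]
    All (λ p → C (proj₁ p) × C (proj₂ p)) ps
    × (∀ I J → coeff2 t I J ≡ sumℚ (map (λ p → coeff (proj₁ p) I * coeff (proj₂ p) J) ps))

record IsGradedSubcoalgebra {ℓ} (C : QS ℓ → Set) : Set where
  field
    respects  : ∀ h g → h ≈ g → C h → C g
    inQSym    : ∀ h → C h → InQSym h
    has-zero  : C zeroQ
    closed-⊕  : ∀ h g → C h → C g → C (h ⊕ g)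
    closed-·  : ∀ q h → C h → C (q · h)
    graded    : ∀ h → C h → ∀ n → C (component n h)
    coalgebra : ∀ h → C h → InTensor C (Δ h)

ζM : ∀ {ℓ} → VC ℓ → ℚ
ζM I = if length I ≤ᵇ 1 then 1ℚ else 0ℚ

sgn : ℕ → ℚ
sgn k = if isOddᵇ k then - 1ℚ else 1ℚ

-- right convolution inverse ψ of ζ_Q on the basis:
-- Σ_{I = JK} ζ(M_J) ψ(M_K) = ε(M_I), solved recursively (ζ(M_∅) = 1)
mutual
  ζinvM : ∀ {ℓ} → VC ℓ → ℚ
  ζinvM [] = 1ℚ
  ζinvM (x ∷ xs) = - splitSum (x ∷ []) xs

  splitSum : ∀ {ℓ} → VC ℓ → VC ℓ → ℚ
  splitSum {ℓ} J [] = ζM J * ζinvM {ℓ = ℓ} []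
  splitSum J (y ∷ ys) = ζM J * ζinvM (y ∷ ys) + splitSum (J ++ y ∷ []) ys

ζQ : ∀ {ℓ} → QS ℓ → ℚ
ζQ h = sumℚ (map (λ t → proj₁ t * ζM (proj₂ t)) h)

ζbarQ : ∀ {ℓ} → QS ℓ → ℚ
ζbarQ h = sumℚ (map (λ t → proj₁ t * (sgn (Vec.sum (ΣI (proj₂ t))) * ζM (proj₂ t))) h)

ζinvQ : ∀ {ℓ} → QS ℓ → ℚ
ζinvQ h = sumℚ (map (λ t → proj₁ t * ζinvM (proj₂ t)) h)

-- h ∈ O^∞: h lies in some graded subcoalgebra on which ζ̄_Q = ζ_Q^{-1}
-- (the union of all of these is the largest one)
InO : ∀ {ℓ} → QS ℓ → Set₁
InO {ℓ} h =
  Σ[ C ∈ (QS ℓ → Set) ]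
    IsGradedSubcoalgebra C × (∀ g → C g → ζbarQ g ≡ ζinvQ g) × C h

pow2 : ℕ → ℚ
pow2 k = (+ (2 ℕ.^ k)) / 1

η : ∀ {ℓ} → VC ℓ → QS ℓ
η I = map (λ J → (pow2 (length J) , J)) (coarsenings I)

θ : ∀ {ℓ} → List ℕ → List (Fin ℓ) → QS ℓ
θ S u = map (λ J → (pow2 (length J) , J))
          (filter (λ J → T? (coveredᵇ S (D J))) (coarsenings (E u)))
  where
  open import Relation.Nullary.Decidable using () renaming (T? to T?)

{-# OPTIONS --safe #-}

-- A pair (S, u) amounts to a tiling of u by single letters and by pairs ending at the elements of S, each pair followed
-- by a letter; it is admissible iff the colours weakly increase along every pair and up to the letter after it. Hence
-- admissibility passes to subsets of S, and (S, u) ↦ odd(I_{S,u}) is a bijection from admissible pairs to vector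
-- compositions with odd columns, inverse to I ↦ (Pk(Ĩ), cw(I)). As J ⊴ I iff D(J) contains neither s nor s - 1 for
-- s ∈ Pk(Ĩ), inclusion-exclusion expresses η_I through the θ_{S,u}, and Möbius inversion gives the converse.
--
-- The η_I with I odd span a graded subcoalgebra on which ζ̄ = ζ⁻¹. Conversely, let h lie in such a subcoalgebra C.
-- Slicing the coproduct shows that for all I, K and n the element Σ_{ΣJ = n} h_{IJK} M_J is again in C; if |n| is
-- even, comparing ζ̄ and ζ⁻¹ on it determines h_{InK} from the h_{IJK} with J longer. So h is determined by its
-- coefficients at odd vector compositions, and these can be matched by a combination of the η_I, since the
-- coefficient of M_J in η_I vanishes unless J ⊴ I. Independence follows from functionals dual to the θ_{S,u}.
module Submission where

open import Defs
open import Algebra.Bundles using (CommutativeRing)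
open import Data.Bool using (Bool; true; false; if_then_else_; _∧_; _∨_; not; _xor_; T; T?)
open import Data.Bool.Properties using (∧-zeroʳ; ∨-zeroʳ)
open import Data.Empty using (⊥-elim)
open import Data.Fin as Fin using (Fin)
import Data.Integer as ℤ
import Data.Integer.Properties as ℤP
open import Data.List as List using (List; []; _∷_; _++_; map; length; filter; concatMap; deduplicate; replicate; allFin)
import Data.List.Properties as LP
open import Data.List.Membership.Propositional using (_∈_)
import Data.List.Membership.Propositional.Properties as ∈P
open import Data.List.Relation.Unary.All as All using (All; []; _∷_)
import Data.List.Relation.Unary.All.Properties as AllP
open import Data.List.Relation.Unary.AllPairs as AllPairs using (AllPairs; []; _∷_)
import Data.List.Relation.Unary.AllPairs.Properties as AllPairsP
open import Data.List.Relation.Unary.Any using (here; there)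
open import Data.List.Relation.Unary.Linked using (Linked; []; [-]; _∷_)
import Data.List.Relation.Unary.Linked.Properties as LinkedP
open import Data.List.Relation.Unary.Unique.Propositional using (Unique)
import Data.List.Relation.Unary.Unique.DecPropositional.Properties as UniqueP
open import Data.Nat as ℕ using (ℕ; zero; suc; _≤_; _<_; _%_; z≤n; s≤s; _≤ᵇ_; _≡ᵇ_)
import Data.Nat.Properties as ℕP
open import Data.Product using (Σ-syntax; ∃; _×_; _,_; proj₁; proj₂; map₁)
open import Data.Rational using (ℚ; 0ℚ; 1ℚ; ½; _+_; _*_; -_; toℚᵘ; fromℚᵘ)
import Data.Rational.Properties as ℚP
open import Data.Rational.Solver using (module +-*-Solver)
import Data.Rational.Unnormalised as ℚᵘ
import Data.Rational.Unnormalised.Properties as ℚᵘP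
open import Data.Sum using (inj₁; inj₂; [_,_]′)
open import Data.Unit using (⊤; tt)
open import Data.Vec as Vec using ()
import Data.Vec.Properties as VP
open import Function using (_∘_)
open import Relation.Binary using (DecidableEquality)
open import Relation.Binary.PropositionalEquality using (_≡_; _≢_; refl; sym; trans; cong; cong₂; subst; module ≡-Reasoning)
open import Relation.Nullary using (¬_; Dec; yes; no; does; _×-dec_)
open import Relation.Nullary.Decidable using (dec-true; dec-false; toSum)
open import Relation.Unary using (Decidable)
open import Algebra.Properties.CommutativeSemigroup (CommutativeRing.+-commutativeSemigroup ℚP.+-*-commutativeRing) using (interchange)
import Algebra.Properties.CommutativeSemigroup ℕP.+-commutativeSemigroup as ℕInterchange

-- Finite sums

-- Elements of the algebra are lists that may repeat an index. Most identities are therefore tested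
-- against an arbitrary linear functional `f`: evaluation is additive in the list, and on η and θ it
-- becomes a sum over `coarsenings`, so that only rearrangements of finite sums remain. Sortedness
-- enters because odd(I_{S,u}) fuses a run of adjacent pairs with the single letter closing it into
-- one column, and a column remembers only how often each letter occurs. The equation
-- cw(odd(I_{S,u})) = u says that nothing is lost, that is, every such block is weakly increasing;
-- the relation carried by a tiling is this condition cut into local pieces. A member of O^∞ brings
-- its own subcoalgebra, with no known relation to the span of the η_I. The two are compared through
-- slices, each taken inside its own subcoalgebra, and the difference of two slices is handled by
-- the linearity of ζ̄ and ζ⁻¹ alone.

*-swap : ∀ a b c → a * (b * c) ≡ b * (a * c)
*-swap = solve 3 (λ a b c → a :* (b :* c) := b :* (a :* c)) refl
  where open +-*-Solver

∑ : {A : Set} → List A → (A → ℚ) → ℚ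
∑ xs f = sumℚ (map f xs)

∑-cong : {A : Set} (xs : List A) {f g : A → ℚ} → (∀ x → f x ≡ g x) → ∑ xs f ≡ ∑ xs g
∑-cong [] eq = refl
∑-cong (x ∷ xs) eq = cong₂ _+_ (eq x) (∑-cong xs eq)

∑-congᴬ : {A : Set} {P : A → Set} {xs : List A} {f g : A → ℚ} →
  All P xs → (∀ x → P x → f x ≡ g x) → ∑ xs f ≡ ∑ xs g
∑-congᴬ [] eq = refl
∑-congᴬ (p ∷ ps) eq = cong₂ _+_ (eq _ p) (∑-congᴬ ps eq)

∑-zero : {A : Set} (xs : List A) → ∑ xs (λ _ → 0ℚ) ≡ 0ℚ
∑-zero [] = refl
∑-zero (x ∷ xs) = trans (ℚP.+-identityˡ (∑ xs (λ _ → 0ℚ))) (∑-zero xs)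

∑-++ : {A : Set} (xs ys : List A) (f : A → ℚ) → ∑ (xs ++ ys) f ≡ ∑ xs f + ∑ ys f
∑-++ [] ys f = sym (ℚP.+-identityˡ (∑ ys f))
∑-++ (x ∷ xs) ys f = trans (cong (f x +_) (∑-++ xs ys f)) (sym (ℚP.+-assoc (f x) (∑ xs f) (∑ ys f)))

∑-map : {A B : Set} (g : A → B) (xs : List A) (f : B → ℚ) → ∑ (map g xs) f ≡ ∑ xs (f ∘ g)
∑-map g [] f = refl
∑-map g (x ∷ xs) f = cong (f (g x) +_) (∑-map g xs f)

∑-concatMap : {A B : Set} (g : A → List B) (xs : List A) (f : B → ℚ) →
  ∑ (concatMap g xs) f ≡ ∑ xs (λ x → ∑ (g x) f)
∑-concatMap g [] f = refl
∑-concatMap g (x ∷ xs) f = trans (∑-++ (g x) (concatMap g xs) f) (cong (∑ (g x) f +_) (∑-concatMap g xs f))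

∑-+ : {A : Set} (xs : List A) (f g : A → ℚ) → ∑ xs (λ x → f x + g x) ≡ ∑ xs f + ∑ xs g
∑-+ [] f g = refl
∑-+ (x ∷ xs) f g = trans (cong (f x + g x +_) (∑-+ xs f g)) (interchange (f x) (g x) (∑ xs f) (∑ xs g))

∑-*ˡ : {A : Set} (q : ℚ) (xs : List A) (f : A → ℚ) → ∑ xs (λ x → q * f x) ≡ q * ∑ xs f
∑-*ˡ q [] f = sym (ℚP.*-zeroʳ q)
∑-*ˡ q (x ∷ xs) f = trans (cong (q * f x +_) (∑-*ˡ q xs f)) (sym (ℚP.*-distribˡ-+ q (f x) (∑ xs f)))

∑-*ʳ : {A : Set} (xs : List A) (f : A → ℚ) (q : ℚ) → ∑ xs (λ x → f x * q) ≡ ∑ xs f * q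
∑-*ʳ xs f q = trans (∑-cong xs (λ x → ℚP.*-comm (f x) q)) (trans (∑-*ˡ q xs f) (ℚP.*-comm q (∑ xs f)))

∑-neg : {A : Set} (xs : List A) (f : A → ℚ) → ∑ xs (λ x → - f x) ≡ - ∑ xs f
∑-neg [] f = refl
∑-neg (x ∷ xs) f = trans (cong (- f x +_) (∑-neg xs f)) (sym (ℚP.neg-distrib-+ (f x) (∑ xs f)))

∑-swap : {A B : Set} (xs : List A) (ys : List B) (f : A → B → ℚ) →
  ∑ xs (λ x → ∑ ys (f x)) ≡ ∑ ys (λ y → ∑ xs (λ x → f x y))
∑-swap [] ys f = sym (∑-zero ys)
∑-swap (x ∷ xs) ys f =
  trans (cong (∑ ys (f x) +_) (∑-swap xs ys f)) (sym (∑-+ ys (f x) (λ y → ∑ xs (λ x → f x y))))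

𝟙 : Bool → ℚ
𝟙 b = if b then 1ℚ else 0ℚ

𝟙-∧ : ∀ b c → 𝟙 (b ∧ c) ≡ 𝟙 b * 𝟙 c
𝟙-∧ true c = sym (ℚP.*-identityˡ (𝟙 c))
𝟙-∧ false c = sym (ℚP.*-zeroˡ (𝟙 c))

0*+ : ∀ a b → 0ℚ * a + b ≡ b
0*+ a b = trans (cong (_+ b) (ℚP.*-zeroˡ a)) (ℚP.+-identityˡ b)

∑-filter : {A : Set} {P : A → Set} (P? : Decidable P) (xs : List A) (f : A → ℚ) →
  ∑ (filter P? xs) f ≡ ∑ xs (λ x → 𝟙 (does (P? x)) * f x)
∑-filter P? [] f = refl
∑-filter P? (x ∷ xs) f with does (P? x)
... | true = cong₂ _+_ (sym (ℚP.*-identityˡ (f x))) (∑-filter P? xs f)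
... | false = trans (∑-filter P? xs f) (sym (0*+ (f x) (∑ xs (λ x → 𝟙 (does (P? x)) * f x))))

module Kronecker {A : Set} (_≟_ : DecidableEquality A) where

  δ : A → A → ℚ
  δ x y = 𝟙 (does (x ≟ y))

  δ-≡ : ∀ {x y} → x ≡ y → δ x y ≡ 1ℚ
  δ-≡ {x} {y} eq = cong 𝟙 (dec-true (x ≟ y) eq)

  δ-≢ : ∀ {x y} → x ≢ y → δ x y ≡ 0ℚ
  δ-≢ {x} {y} ne = cong 𝟙 (dec-false (x ≟ y) ne)

  δ-subst : ∀ (f : A → ℚ) x y → δ x y * f x ≡ δ x y * f y
  δ-subst f x y with x ≟ y
  ... | yes refl = refl
  ... | no _ = trans (ℚP.*-zeroˡ (f x)) (sym (ℚP.*-zeroˡ (f y)))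

  ∑-δ-∉ : ∀ {x xs} (f : A → ℚ) → All (x ≢_) xs → ∑ xs (λ y → δ x y * f y) ≡ 0ℚ
  ∑-δ-∉ {x} {xs} f ne =
    trans (∑-congᴬ ne (λ y x≢y → trans (cong (_* f y) (δ-≢ x≢y)) (ℚP.*-zeroˡ (f y)))) (∑-zero xs)

  ∑-δ : ∀ {x xs} (f : A → ℚ) → Unique xs → x ∈ xs → ∑ xs (λ y → δ x y * f y) ≡ f x
  ∑-δ {x} f (ne ∷ un) (here refl) =
    trans (cong₂ _+_ (trans (cong (_* f x) (δ-≡ refl)) (ℚP.*-identityˡ (f x))) (∑-δ-∉ f ne))
      (ℚP.+-identityʳ (f x))
  ∑-δ {x} {y ∷ ys} f (ne ∷ un) (there x∈) =
    trans (cong₂ _+_ (trans (cong (_* f y) (δ-≢ (λ { refl → All.lookup ne x∈ refl }))) (ℚP.*-zeroˡ (f y)))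
                     (∑-δ f un x∈))
      (ℚP.+-identityˡ (f x))

-- Signs and powers of two

-- Powers of one half replace division by `pow2 k`, so no side conditions about nonzero denominators
-- arise.
½^ : ℕ → ℚ
½^ zero = 1ℚ
½^ (suc k) = ½ * ½^ k

2ℚ : ℚ
2ℚ = 1ℚ + 1ℚ

-- `pow2` passes through normalisation by a gcd, which is stuck for variable `k`. Among unnormalised
-- rationals the claim is an equation between integer numerators.
pow2-suc : ∀ k → pow2 (suc k) ≡ 2ℚ * pow2 k
pow2-suc k = begin
  pow2 (suc k)                                     ≡⟨ ℚP.fromℚᵘ-cong {pw′} {two ℚᵘ.* pw} (ℚᵘ.*≡* eq) ⟩
  fromℚᵘ (two ℚᵘ.* pw)                           ≡⟨ ℚP.fromℚᵘ-cong (ℚᵘP.*-cong (ℚᵘP.≃-refl {two}) (ℚᵘP.≃-sym (ℚP.toℚᵘ-fromℚᵘ pw))) ⟩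
  fromℚᵘ (two ℚᵘ.* toℚᵘ (pow2 k))              ≡⟨ ℚP.fromℚᵘ-cong (ℚᵘP.≃-sym (ℚP.toℚᵘ-homo-* 2ℚ (pow2 k))) ⟩
  fromℚᵘ (toℚᵘ (2ℚ * pow2 k))                  ≡⟨ ℚP.fromℚᵘ-toℚᵘ _ ⟩
  2ℚ * pow2 k ∎
  where
  open ≡-Reasoning
  two pw pw′ : ℚᵘ.ℚᵘ
  two = ℚᵘ.mkℚᵘ (ℤ.+ 2) 0
  pw′ = ℚᵘ.mkℚᵘ (ℤ.+ (2 ℕ.^ suc k)) 0
  pw = ℚᵘ.mkℚᵘ (ℤ.+ (2 ℕ.^ k)) 0
  eq : (ℤ.+ (2 ℕ.^ suc k)) ℤ.* (ℤ.+ 1) ≡ ((ℤ.+ 2) ℤ.* (ℤ.+ (2 ℕ.^ k))) ℤ.* (ℤ.+ 1)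
  eq = cong (ℤ._* (ℤ.+ 1)) (ℤP.pos-* 2 (2 ℕ.^ k))

pow2-+ : ∀ j k → pow2 (j ℕ.+ k) ≡ pow2 j * pow2 k
pow2-+ zero k = sym (ℚP.*-identityˡ (pow2 k))
pow2-+ (suc j) k = begin
  pow2 (suc (j ℕ.+ k))        ≡⟨ pow2-suc (j ℕ.+ k) ⟩
  2ℚ * pow2 (j ℕ.+ k)         ≡⟨ cong (2ℚ *_) (pow2-+ j k) ⟩
  2ℚ * (pow2 j * pow2 k)      ≡⟨ sym (ℚP.*-assoc 2ℚ (pow2 j) (pow2 k)) ⟩
  2ℚ * pow2 j * pow2 k        ≡⟨ cong (_* pow2 k) (sym (pow2-suc j)) ⟩
  pow2 (suc j) * pow2 k       ∎
  where open ≡-Reasoning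

pow2-½^ : ∀ k → pow2 k * ½^ k ≡ 1ℚ
pow2-½^ zero = refl
pow2-½^ (suc k) = begin
  pow2 (suc k) * (½ * ½^ k)        ≡⟨ cong (_* (½ * ½^ k)) (pow2-suc k) ⟩
  2ℚ * pow2 k * (½ * ½^ k)         ≡⟨ lem (pow2 k) (½^ k) ⟩
  pow2 k * ½^ k                    ≡⟨ pow2-½^ k ⟩
  1ℚ                               ∎
  where
  open ≡-Reasoning
  open +-*-Solver
  lem : ∀ p h → 2ℚ * p * (½ * h) ≡ p * h
  lem = solve 2 (λ p h → con 2ℚ :* p :* (con ½ :* h) := p :* h) refl

isOddᵇ-suc : ∀ n → isOddᵇ (suc n) ≡ not (isOddᵇ n)
isOddᵇ-suc zero = refl
isOddᵇ-suc (suc zero) = refl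
isOddᵇ-suc (suc (suc n)) = isOddᵇ-suc n

isOddᵇ-+ : ∀ m n → isOddᵇ (m ℕ.+ n) ≡ isOddᵇ m xor isOddᵇ n
isOddᵇ-+ zero n = refl
isOddᵇ-+ (suc zero) n = isOddᵇ-suc n
isOddᵇ-+ (suc (suc m)) n = isOddᵇ-+ m n

sgn-suc : ∀ n → sgn (suc n) ≡ - sgn n
sgn-suc n rewrite isOddᵇ-suc n with isOddᵇ n
... | true = refl
... | false = refl

sgn² : ∀ n → sgn n * sgn n ≡ 1ℚ
sgn² n with isOddᵇ n
... | true = refl
... | false = refl

-- Linear functionals

-- The value at `h` of the linear functional sending M_I to `f I`. By definition `ζbarQ` and `ζinvQ`
-- are of this form, so every general fact about the pairing applies to them.
⟪_,_⟫ : ∀ {ℓ} → QS ℓ → (VC ℓ → ℚ) → ℚ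
⟪ h , f ⟫ = ∑ h (λ t → proj₁ t * f (proj₂ t))

_≟C_ : ∀ {ℓ} → DecidableEquality (Col ℓ)
_≟C_ = VP.≡-dec ℕ._≟_

_≟V_ : ∀ {ℓ} → DecidableEquality (VC ℓ)
_≟V_ = LP.≡-dec _≟C_

module δV {ℓ} = Kronecker (_≟V_ {ℓ})
open δV using (δ; δ-≡; δ-≢; δ-subst)

∑-filter₁ : {B : Set} {P : ℚ × B → Set} (P? : Decidable P) (xs : List (ℚ × B)) →
  sumℚ (map proj₁ (filter P? xs)) ≡ ∑ xs (λ t → proj₁ t * 𝟙 (does (P? t)))
∑-filter₁ P? xs = trans (∑-filter P? xs proj₁) (∑-cong xs (λ t → ℚP.*-comm (𝟙 (does (P? t))) (proj₁ t)))

coeff≡⟪⟫ : ∀ {ℓ} (h : QS ℓ) I → coeff h I ≡ ⟪ h , (λ J → δ J I) ⟫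
coeff≡⟪⟫ h I = ∑-filter₁ (λ t → proj₂ t ≟V I) h

-- Terms with equal index must be collected before coefficients can appear; a duplicate-free list
-- containing all indices does this, each term of `h` meeting its index exactly once.
⟪⟫-support : ∀ {ℓ} (h : QS ℓ) (f : VC ℓ → ℚ) {Us} → Unique Us → All (λ t → proj₂ t ∈ Us) h →
  ⟪ h , f ⟫ ≡ ∑ Us (λ I → coeff h I * f I)
⟪⟫-support [] f {Us} un [] =
  sym (trans (∑-cong Us (λ I → ℚP.*-zeroˡ (f I))) (∑-zero Us))
⟪⟫-support ((q , J) ∷ h) f {Us} un (J∈ ∷ h⊆) = sym (begin
  ∑ Us (λ I → coeff ((q , J) ∷ h) I * f I)
    ≡⟨ ∑-cong Us step ⟩
  ∑ Us (λ I → q * (δ J I * f I) + coeff h I * f I)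
    ≡⟨ ∑-+ Us (λ I → q * (δ J I * f I)) (λ I → coeff h I * f I) ⟩
  ∑ Us (λ I → q * (δ J I * f I)) + ∑ Us (λ I → coeff h I * f I)
    ≡⟨ cong₂ _+_ (trans (∑-*ˡ q Us (λ I → δ J I * f I)) (cong (q *_) (δV.∑-δ f un J∈)))
                 (sym (⟪⟫-support h f un h⊆)) ⟩
  q * f J + ⟪ h , f ⟫ ∎)
  where
  open ≡-Reasoning
  step : ∀ I → coeff ((q , J) ∷ h) I * f I ≡ q * (δ J I * f I) + coeff h I * f I
  step I = begin
    coeff ((q , J) ∷ h) I * f I                          ≡⟨ cong (_* f I) (coeff≡⟪⟫ ((q , J) ∷ h) I) ⟩
    (q * δ J I + ⟪ h , (λ J → δ J I) ⟫) * f I            ≡⟨ cong (λ z → (q * δ J I + z) * f I) (sym (coeff≡⟪⟫ h I)) ⟩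
    (q * δ J I + coeff h I) * f I                        ≡⟨ ℚP.*-distribʳ-+ (f I) (q * δ J I) (coeff h I) ⟩
    q * δ J I * f I + coeff h I * f I                    ≡⟨ cong (_+ coeff h I * f I) (ℚP.*-assoc q (δ J I) (f I)) ⟩
    q * (δ J I * f I) + coeff h I * f I                  ∎

≈⇒⟪⟫ : ∀ {ℓ} (h g : QS ℓ) → h ≈ g → ∀ f → ⟪ h , f ⟫ ≡ ⟪ g , f ⟫
≈⇒⟪⟫ h g h≈g f = begin
  ⟪ h , f ⟫                      ≡⟨ ⟪⟫-support h f un (All.tabulate (λ t∈ → inU (∈P.∈-++⁺ˡ t∈))) ⟩
  ∑ Us (λ I → coeff h I * f I)   ≡⟨ ∑-cong Us (λ I → cong (_* f I) (h≈g I)) ⟩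
  ∑ Us (λ I → coeff g I * f I)   ≡⟨ sym (⟪⟫-support g f un (All.tabulate (λ t∈ → inU (∈P.∈-++⁺ʳ h t∈)))) ⟩
  ⟪ g , f ⟫                      ∎
  where
  open ≡-Reasoning
  -- A common index list for both sides lets their coefficients be compared term by term.
  Us = deduplicate _≟V_ (map proj₂ (h ++ g))
  un : Unique Us
  un = UniqueP.deduplicate-! _≟V_ (map proj₂ (h ++ g))
  inU : ∀ {t} → t ∈ h ++ g → proj₂ t ∈ Us
  inU t∈ = ∈P.∈-deduplicate⁺ _≟V_ (∈P.∈-map⁺ proj₂ t∈)

⟪⟫⇒≈ : ∀ {ℓ} (h g : QS ℓ) → (∀ f → ⟪ h , f ⟫ ≡ ⟪ g , f ⟫) → h ≈ g
⟪⟫⇒≈ h g eq I = trans (coeff≡⟪⟫ h I) (trans (eq _) (sym (coeff≡⟪⟫ g I)))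

⟪⟫-⊕ : ∀ {ℓ} (h g : QS ℓ) f → ⟪ h ⊕ g , f ⟫ ≡ ⟪ h , f ⟫ + ⟪ g , f ⟫
⟪⟫-⊕ h g f = ∑-++ h g _

⟪⟫-· : ∀ {ℓ} q (h : QS ℓ) f → ⟪ q · h , f ⟫ ≡ q * ⟪ h , f ⟫
⟪⟫-· q h f = trans (∑-map _ h _)
  (trans (∑-cong h (λ t → ℚP.*-assoc q (proj₁ t) (f (proj₂ t)))) (∑-*ˡ q h _))

⟪⟫-lin : ∀ {ℓ} (cs : List (ℚ × QS ℓ)) f → ⟪ lin cs , f ⟫ ≡ ∑ cs (λ c → proj₁ c * ⟪ proj₂ c , f ⟫)
⟪⟫-lin cs f = trans (∑-concatMap (λ c → proj₁ c · proj₂ c) cs _)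
  (∑-cong cs (λ c → ⟪⟫-· (proj₁ c) (proj₂ c) f))

⟪⟫-lin-map : ∀ {ℓ} {A : Set} (q : A → ℚ) (b : A → QS ℓ) (xs : List A) f →
  ⟪ lin (map (λ x → q x , b x) xs) , f ⟫ ≡ ∑ xs (λ x → q x * ⟪ b x , f ⟫)
⟪⟫-lin-map q b xs f = trans (⟪⟫-lin (map (λ x → q x , b x) xs) f) (∑-map (λ x → q x , b x) xs _)

coeff-⊕ : ∀ {ℓ} (h g : QS ℓ) I → coeff (h ⊕ g) I ≡ coeff h I + coeff g I
coeff-⊕ h g I = trans (coeff≡⟪⟫ (h ⊕ g) I)
  (trans (⟪⟫-⊕ h g _) (sym (cong₂ _+_ (coeff≡⟪⟫ h I) (coeff≡⟪⟫ g I))))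

coeff-· : ∀ {ℓ} q (h : QS ℓ) I → coeff (q · h) I ≡ q * coeff h I
coeff-· q h I = trans (coeff≡⟪⟫ (q · h) I) (trans (⟪⟫-· q h _) (cong (q *_) (sym (coeff≡⟪⟫ h I))))

coeff-lin-map : ∀ {ℓ} {A : Set} (q : A → ℚ) (b : A → QS ℓ) (xs : List A) I →
  coeff (lin (map (λ x → q x , b x) xs)) I ≡ ∑ xs (λ x → q x * coeff (b x) I)
coeff-lin-map q b xs I = trans (coeff≡⟪⟫ (lin (map (λ x → q x , b x) xs)) I)
  (trans (⟪⟫-lin-map q b xs _) (∑-cong xs (λ x → cong (q x *_) (sym (coeff≡⟪⟫ (b x) I)))))

-- Columns and colouring words

+c-assoc : ∀ {ℓ} (u v w : Col ℓ) → (u +c v) +c w ≡ u +c (v +c w)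
+c-assoc = VP.zipWith-assoc ℕP.+-assoc

+c-identityˡ : ∀ {ℓ} (v : Col ℓ) → zeroCol +c v ≡ v
+c-identityˡ = VP.zipWith-identityˡ ℕP.+-identityˡ

+c-identityʳ : ∀ {ℓ} (v : Col ℓ) → v +c zeroCol ≡ v
+c-identityʳ = VP.zipWith-identityʳ ℕP.+-identityʳ

wt-+c : ∀ {ℓ} (v w : Col ℓ) → wt (v +c w) ≡ wt v ℕ.+ wt w
wt-+c Vec.[] Vec.[] = refl
wt-+c (x Vec.∷ v) (y Vec.∷ w) = trans (cong (x ℕ.+ y ℕ.+_) (wt-+c v w)) (ℕInterchange.interchange x y (wt v) (wt w))

wt-zeroCol : ∀ ℓ → wt (zeroCol {ℓ}) ≡ 0
wt-zeroCol zero = refl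
wt-zeroCol (suc ℓ) = wt-zeroCol ℓ

tabulate-0 : ∀ ℓ → Vec.tabulate {n = ℓ} (λ _ → 0) ≡ zeroCol
tabulate-0 zero = refl
tabulate-0 (suc ℓ) = cong (0 Vec.∷_) (tabulate-0 ℓ)

e-zero : ∀ {ℓ} → e {suc ℓ} Fin.zero ≡ 1 Vec.∷ zeroCol
e-zero {ℓ} = cong (1 Vec.∷_) (tabulate-0 ℓ)

wt-e : ∀ {ℓ} (a : Fin ℓ) → wt (e a) ≡ 1
wt-e {suc ℓ} Fin.zero = trans (cong wt (e-zero {ℓ})) (cong suc (wt-zeroCol ℓ))
wt-e (Fin.suc a) = wt-e a

wt-e+e : ∀ {ℓ} (a b : Fin ℓ) → wt (e a +c e b) ≡ 2
wt-e+e a b = trans (wt-+c (e a) (e b)) (cong₂ ℕ._+_ (wt-e a) (wt-e b))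

ΣI-++ : ∀ {ℓ} (I J : VC ℓ) → ΣI (I ++ J) ≡ ΣI I +c ΣI J
ΣI-++ [] J = sym (+c-identityˡ (ΣI J))
ΣI-++ (v ∷ I) J = trans (cong (v +c_) (ΣI-++ I J)) (sym (+c-assoc v (ΣI I) (ΣI J)))

content : ∀ {ℓ} → List (Fin ℓ) → Col ℓ
content b = ΣI (E b)

content-++ : ∀ {ℓ} (b c : List (Fin ℓ)) → content (b ++ c) ≡ content b +c content c
content-++ b c = trans (cong ΣI (LP.map-++ e b c)) (ΣI-++ (E b) (E c))

wt-content : ∀ {ℓ} (b : List (Fin ℓ)) → wt (content b) ≡ length b
wt-content {ℓ} [] = wt-zeroCol ℓ
wt-content (a ∷ b) = trans (wt-+c (e a) (content b)) (cong₂ ℕ._+_ (wt-e a) (wt-content b))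

-- `cwCol` runs over all colours at once and does not recurse on the column; this unfolding supplies
-- the recursion, one colour at a time.
cwCol-∷ : ∀ {ℓ} x (v : Col ℓ) → cwCol (x Vec.∷ v) ≡ replicate x Fin.zero ++ map Fin.suc (cwCol v)
cwCol-∷ {ℓ} x v = cong (replicate x Fin.zero ++_) (begin
  concatMap f (List.tabulate Fin.suc)
    ≡⟨ cong (concatMap f) (sym (LP.map-tabulate (λ c → c) Fin.suc)) ⟩
  concatMap f (map Fin.suc (allFin ℓ))
    ≡⟨ LP.concatMap-map f Fin.suc (allFin ℓ) ⟩
  concatMap (λ c → replicate (Vec.lookup v c) (Fin.suc c)) (allFin ℓ)
    ≡⟨ LP.concatMap-cong (λ c → sym (LP.map-replicate Fin.suc (Vec.lookup v c) c)) (allFin ℓ) ⟩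
  concatMap (map Fin.suc ∘ (λ c → replicate (Vec.lookup v c) c)) (allFin ℓ)
    ≡⟨ sym (LP.map-concatMap Fin.suc (λ c → replicate (Vec.lookup v c) c) (allFin ℓ)) ⟩
  map Fin.suc (cwCol v) ∎)
  where
  open ≡-Reasoning
  f : Fin (suc ℓ) → List (Fin (suc ℓ))
  f c = replicate (Vec.lookup (x Vec.∷ v) c) c

length-cwCol : ∀ {ℓ} (v : Col ℓ) → length (cwCol v) ≡ wt v
length-cwCol Vec.[] = refl
length-cwCol (x Vec.∷ v) = begin
  length (cwCol (x Vec.∷ v))                                 ≡⟨ cong length (cwCol-∷ x v) ⟩
  length (replicate x Fin.zero ++ map Fin.suc (cwCol v))     ≡⟨ LP.length-++ (replicate x Fin.zero) ⟩
  length (replicate x Fin.zero) ℕ.+ length (map Fin.suc (cwCol v))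
    ≡⟨ cong₂ ℕ._+_ (LP.length-replicate x) (trans (LP.length-map Fin.suc (cwCol v)) (length-cwCol v)) ⟩
  x ℕ.+ wt v ∎
  where open ≡-Reasoning

content-replicate : ∀ {ℓ} x → content (replicate x (Fin.zero {ℓ})) ≡ x Vec.∷ zeroCol
content-replicate zero = refl
content-replicate {ℓ} (suc x) = trans
  (cong₂ _+c_ (e-zero {ℓ}) (content-replicate x)) (cong (suc x Vec.∷_) (+c-identityˡ zeroCol))

content-map-suc : ∀ {ℓ} (b : List (Fin ℓ)) → content (map Fin.suc b) ≡ 0 Vec.∷ content b
content-map-suc [] = refl
content-map-suc (a ∷ b) = cong (e (Fin.suc a) +c_) (content-map-suc b)

content-cwCol : ∀ {ℓ} (v : Col ℓ) → content (cwCol v) ≡ v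
content-cwCol Vec.[] = refl
content-cwCol (x Vec.∷ v) = begin
  content (cwCol (x Vec.∷ v))
    ≡⟨ cong content (cwCol-∷ x v) ⟩
  content (replicate x Fin.zero ++ map Fin.suc (cwCol v))
    ≡⟨ content-++ (replicate x Fin.zero) (map Fin.suc (cwCol v)) ⟩
  content (replicate x Fin.zero) +c content (map Fin.suc (cwCol v))
    ≡⟨ cong₂ _+c_ (content-replicate x) (trans (content-map-suc (cwCol v)) (cong (0 Vec.∷_) (content-cwCol v))) ⟩
  (x ℕ.+ 0) Vec.∷ (zeroCol +c v)
    ≡⟨ cong₂ Vec._∷_ (ℕP.+-identityʳ x) (+c-identityˡ v) ⟩
  x Vec.∷ v ∎
  where open ≡-Reasoning

Sorted : ∀ {ℓ} → List (Fin ℓ) → Set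
Sorted = Linked Fin._≤_

cwCol-allPairs : ∀ {ℓ} (v : Col ℓ) → AllPairs Fin._≤_ (cwCol v)
cwCol-allPairs Vec.[] = []
cwCol-allPairs (x Vec.∷ v) = subst (AllPairs Fin._≤_) (sym (cwCol-∷ x v)) (go x)
  where
  go : ∀ x → AllPairs Fin._≤_ (replicate x Fin.zero ++ map Fin.suc (cwCol v))
  go zero = AllPairsP.map⁺ (AllPairs.map s≤s (cwCol-allPairs v))
  go (suc x) = All.universal (λ _ → z≤n) _ ∷ go x

cwCol-sorted : ∀ {ℓ} (v : Col ℓ) → Sorted (cwCol v)
cwCol-sorted v = LinkedP.AllPairs⇒Linked (cwCol-allPairs v)

cwCol-zeroCol : ∀ ℓ → cwCol (zeroCol {ℓ}) ≡ []
cwCol-zeroCol zero = refl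
cwCol-zeroCol (suc ℓ) = trans (cwCol-∷ 0 (zeroCol {ℓ})) (cong (map Fin.suc) (cwCol-zeroCol ℓ))

-- A column forgets the order of its letters and `cwCol` lists them increasingly, so a minimal new
-- letter is listed first.
cwCol-e+c : ∀ {ℓ} (a : Fin ℓ) (v : Col ℓ) → All (a Fin.≤_) (cwCol v) → cwCol (e a +c v) ≡ a ∷ cwCol v
cwCol-e+c {suc ℓ} Fin.zero (x Vec.∷ v) _ = begin
  cwCol (e Fin.zero +c (x Vec.∷ v))   ≡⟨ cong (λ z → cwCol (z +c (x Vec.∷ v))) (e-zero {ℓ}) ⟩
  cwCol (suc x Vec.∷ (zeroCol +c v))  ≡⟨ cong (λ z → cwCol (suc x Vec.∷ z)) (+c-identityˡ v) ⟩
  cwCol (suc x Vec.∷ v)               ≡⟨ cwCol-∷ (suc x) v ⟩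
  Fin.zero ∷ replicate x Fin.zero ++ map Fin.suc (cwCol v)
                                      ≡⟨ cong (Fin.zero ∷_) (sym (cwCol-∷ x v)) ⟩
  Fin.zero ∷ cwCol (x Vec.∷ v)        ∎
  where open ≡-Reasoning
-- Here the colouring word starts with colour `zero`, which is below `Fin.suc a`.
cwCol-e+c (Fin.suc a) (suc x Vec.∷ v) a≤ with subst (All _) (cwCol-∷ (suc x) v) a≤
... | () ∷ _
cwCol-e+c (Fin.suc a) (zero Vec.∷ v) a≤ = begin
  cwCol (0 Vec.∷ (e a +c v))       ≡⟨ cwCol-∷ 0 (e a +c v) ⟩
  map Fin.suc (cwCol (e a +c v))   ≡⟨ cong (map Fin.suc) (cwCol-e+c a v a≤v) ⟩
  Fin.suc a ∷ map Fin.suc (cwCol v) ≡⟨ cong (Fin.suc a ∷_) (sym (cwCol-∷ 0 v)) ⟩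
  Fin.suc a ∷ cwCol (0 Vec.∷ v)    ∎
  where
  open ≡-Reasoning
  a≤v : All (a Fin.≤_) (cwCol v)
  a≤v = All.map ℕP.≤-pred (AllP.map⁻ (subst (All (Fin.suc a Fin.≤_)) (cwCol-∷ 0 v) a≤))

-- Together with `content-cwCol` this identifies columns with sorted words, which is what translates
-- the equation in `Admissible` into sortedness of blocks.
cwCol-content : ∀ {ℓ} {b : List (Fin ℓ)} → Sorted b → cwCol (content b) ≡ b
cwCol-content sb = go (LinkedP.Linked⇒AllPairs ℕP.≤-trans sb)
  where
  go : ∀ {ℓ} {b : List (Fin ℓ)} → AllPairs Fin._≤_ b → cwCol (content b) ≡ b
  go {ℓ} [] = cwCol-zeroCol ℓ
  go {b = a ∷ b} (a≤ ∷ ap) = trans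
    (cwCol-e+c a (content b) (subst (All (a Fin.≤_)) (sym (go ap)) a≤)) (cong (a ∷_) (go ap))

-- Coarsenings

-- `coarsenings` treats the last column separately. This view exposes a first column, so that
-- recursion rules can be stated for a general nonempty tail.
data NonEmpty {A : Set} : List A → Set where
  cons : ∀ x xs → NonEmpty (x ∷ xs)

mergeHead-ne : ∀ {ℓ} v (J : VC ℓ) → NonEmpty (mergeHead v J)
mergeHead-ne v [] = cons v []
mergeHead-ne v (w ∷ J) = cons (v +c w) J

mergeHead-mergeHead : ∀ {ℓ} u v (J : VC ℓ) → mergeHead u (mergeHead v J) ≡ mergeHead (u +c v) J
mergeHead-mergeHead u v [] = refl
mergeHead-mergeHead u v (w ∷ J) = cong (_∷ J) (sym (+c-assoc u v w))

mergeHead-zeroCol : ∀ {ℓ} {J : VC ℓ} → NonEmpty J → mergeHead zeroCol J ≡ J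
mergeHead-zeroCol (cons v J) = cong (_∷ J) (+c-identityˡ v)

length-mergeHead : ∀ {ℓ} v {J : VC ℓ} → NonEmpty J → length (mergeHead v J) ≡ length J
length-mergeHead v (cons w J) = refl

ΣI-mergeHead : ∀ {ℓ} v (J : VC ℓ) → ΣI (mergeHead v J) ≡ v +c ΣI J
ΣI-mergeHead v [] = refl
ΣI-mergeHead v (w ∷ J) = +c-assoc v w (ΣI J)

coarsenings-ne : ∀ {ℓ} {I : VC ℓ} → NonEmpty I → All NonEmpty (coarsenings I)
coarsenings-ne (cons v []) = cons v [] ∷ []
coarsenings-ne (cons v (w ∷ I)) = AllP.++⁺
  (AllP.map⁺ (All.universal (λ K → cons v K) (coarsenings (w ∷ I))))
  (AllP.map⁺ (All.universal (mergeHead-ne v) (coarsenings (w ∷ I))))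

∑-coarsenings-∷ : ∀ {ℓ} v {I : VC ℓ} → NonEmpty I → (F : VC ℓ → ℚ) →
  ∑ (coarsenings (v ∷ I)) F ≡ ∑ (coarsenings I) (λ K → F (v ∷ K)) + ∑ (coarsenings I) (λ K → F (mergeHead v K))
∑-coarsenings-∷ v (cons w I) F = trans (∑-++ (map (v ∷_) cs) (map (mergeHead v) cs) F)
  (cong₂ _+_ (∑-map (v ∷_) cs F) (∑-map (mergeHead v) cs F))
  where cs = coarsenings (w ∷ I)

-- Once `v` is glued to the first column no cut can separate them, so gluing before or after
-- coarsening makes no difference.
coarsenings-mergeHead : ∀ {ℓ} v {I : VC ℓ} → NonEmpty I →
  coarsenings (mergeHead v I) ≡ map (mergeHead v) (coarsenings I)
coarsenings-mergeHead v (cons w []) = refl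
coarsenings-mergeHead v (cons w (x ∷ I)) = sym (begin
  map (mergeHead v) (map (w ∷_) cs ++ map (mergeHead w) cs)
    ≡⟨ LP.map-++ (mergeHead v) (map (w ∷_) cs) (map (mergeHead w) cs) ⟩
  map (mergeHead v) (map (w ∷_) cs) ++ map (mergeHead v) (map (mergeHead w) cs)
    ≡⟨ cong₂ _++_ (sym (LP.map-∘ cs))
         (trans (sym (LP.map-∘ cs)) (LP.map-cong (mergeHead-mergeHead v w) cs)) ⟩
  map ((v +c w) ∷_) cs ++ map (mergeHead (v +c w)) cs ∎)
  where
  open ≡-Reasoning
  cs = coarsenings (x ∷ I)

All-coarsenings : ∀ {ℓ} (P : VC ℓ → Set) {v} {I : VC ℓ} → NonEmpty I →
  All (λ K → P (v ∷ K) × P (mergeHead v K)) (coarsenings I) → All P (coarsenings (v ∷ I))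
All-coarsenings P (cons w I) ps = AllP.++⁺ (AllP.map⁺ (All.map proj₁ ps)) (AllP.map⁺ (All.map proj₂ ps))

coarsenings-ΣI : ∀ {ℓ} (I : VC ℓ) → All (λ J → ΣI J ≡ ΣI I) (coarsenings I)
coarsenings-ΣI [] = refl ∷ []
coarsenings-ΣI (v ∷ []) = refl ∷ []
coarsenings-ΣI (v ∷ w ∷ I) = All-coarsenings (λ J → ΣI J ≡ ΣI (v ∷ w ∷ I)) (cons w I)
  (All.map (λ {K} eq → cong (v +c_) eq , trans (ΣI-mergeHead v K) (cong (v +c_) eq)) (coarsenings-ΣI (w ∷ I)))

mergeHead-valid : ∀ {ℓ} {v} {J : VC ℓ} → 1 ≤ wt v → ValidVC J → ValidVC (mergeHead v J)
mergeHead-valid v≥1 [] = v≥1 ∷ []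
mergeHead-valid {v = v} {w ∷ J} v≥1 (w≥1 ∷ vJ) =
  subst (1 ≤_) (sym (wt-+c v w)) (ℕP.≤-trans v≥1 (ℕP.m≤m+n (wt v) (wt w))) ∷ vJ

coarsenings-valid : ∀ {ℓ} {I : VC ℓ} → ValidVC I → All ValidVC (coarsenings I)
coarsenings-valid [] = [] ∷ []
coarsenings-valid (pv ∷ []) = (pv ∷ []) ∷ []
coarsenings-valid {I = v ∷ w ∷ I} (pv ∷ pw ∷ pI) = All-coarsenings ValidVC (cons w I)
  (All.map (λ vK → pv ∷ vK , mergeHead-valid pv vK) (coarsenings-valid (pw ∷ pI)))

-- Triangularity of η with respect to the M_J, ordered by length: it will allow M_I to be solved for
-- in terms of η_I and shorter compositions.
coarsenings-head : ∀ {ℓ} (I : VC ℓ) →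
  ∃ λ rest → coarsenings I ≡ I ∷ rest × All (λ J → length J < length I) rest
coarsenings-head [] = [] , refl , []
coarsenings-head (v ∷ []) = [] , refl , []
coarsenings-head (v ∷ w ∷ I) with coarsenings-head (w ∷ I) | coarsenings-ne (cons w I)
... | rest , eq , lt | ne rewrite eq =
  map (v ∷_) rest ++ map (mergeHead v) ((w ∷ I) ∷ rest) , refl ,
  AllP.++⁺ (AllP.map⁺ (All.map s≤s lt))
    (AllP.map⁺ {xs = (w ∷ I) ∷ rest} (ℕP.≤-refl ∷
      All.zipWith (λ { {J} (neJ , p) → subst (_< suc (suc (length I))) (sym (length-mergeHead v neJ)) (ℕP.m≤n⇒m≤1+n p) })
        (All.tail ne , lt)))

-- For each coarsening `K` of the tail, the choices `v ∷ K` and `mergeHead v K` have lengths of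
-- opposite parity. The further coarsenings that merge `v` occur for both and cancel; those keeping
-- `v` separate survive, and induction applies to them.
∑-coarsenings-möbius : ∀ {ℓ} (J : VC ℓ) (g : VC ℓ → ℚ) →
  ∑ (coarsenings J) (λ K → sgn (length K) * ∑ (coarsenings K) g) ≡ sgn (length J) * g J
∑-coarsenings-möbius [] g = trans (ℚP.+-identityʳ _) (cong (1ℚ *_) (ℚP.+-identityʳ (g [])))
∑-coarsenings-möbius (v ∷ []) g =
  trans (ℚP.+-identityʳ _) (cong (- 1ℚ *_) (ℚP.+-identityʳ (g (v ∷ []))))
∑-coarsenings-möbius (v ∷ J@(w ∷ J′)) g = begin
  ∑ (coarsenings (v ∷ J)) G
    ≡⟨ ∑-coarsenings-∷ v (cons w J′) G ⟩
  ∑ cs (λ K → G (v ∷ K)) + ∑ cs (λ K → G (mergeHead v K))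
    ≡⟨ sym (∑-+ cs (λ K → G (v ∷ K)) (λ K → G (mergeHead v K))) ⟩
  ∑ cs (λ K → G (v ∷ K) + G (mergeHead v K))
    ≡⟨ ∑-congᴬ (coarsenings-ne (cons w J′)) step ⟩
  ∑ cs (λ K → - (sgn (length K) * ∑ (coarsenings K) gv))
    ≡⟨ ∑-neg cs (λ K → sgn (length K) * ∑ (coarsenings K) gv) ⟩
  - ∑ cs (λ K → sgn (length K) * ∑ (coarsenings K) gv)
    ≡⟨ cong -_ (∑-coarsenings-möbius J gv) ⟩
  - (sgn (length J) * g (v ∷ J))
    ≡⟨ ℚP.neg-distribˡ-* (sgn (length J)) (g (v ∷ J)) ⟩
  - sgn (length J) * g (v ∷ J)
    ≡⟨ cong (_* g (v ∷ J)) (sym (sgn-suc (length J))) ⟩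
  sgn (length (v ∷ J)) * g (v ∷ J) ∎
  where
  open ≡-Reasoning
  cs = coarsenings J
  G : VC _ → ℚ
  G K = sgn (length K) * ∑ (coarsenings K) g
  gv gm : VC _ → ℚ
  gv K = g (v ∷ K)
  gm K = g (mergeHead v K)
  cancel : ∀ s a b → - s * (a + b) + s * b ≡ - (s * a)
  cancel = solve 3 (λ s a b → (:- s) :* (a :+ b) :+ s :* b := :- (s :* a)) refl
    where open +-*-Solver
  step : ∀ K → NonEmpty K → G (v ∷ K) + G (mergeHead v K) ≡ - (sgn (length K) * ∑ (coarsenings K) gv)
  step K ne = begin
    G (v ∷ K) + G (mergeHead v K)
      ≡⟨ cong₂ _+_ (cong₂ _*_ (sgn-suc (length K)) (∑-coarsenings-∷ v ne g))
           (cong₂ _*_ (cong sgn (length-mergeHead v ne))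
             (trans (cong (λ z → ∑ z g) (coarsenings-mergeHead v ne)) (∑-map (mergeHead v) (coarsenings K) g))) ⟩
    - sgn (length K) * (∑ (coarsenings K) gv + ∑ (coarsenings K) gm) + sgn (length K) * ∑ (coarsenings K) gm
      ≡⟨ cancel (sgn (length K)) (∑ (coarsenings K) gv) (∑ (coarsenings K) gm) ⟩
    - (sgn (length K) * ∑ (coarsenings K) gv) ∎

⟪η⟫ : ∀ {ℓ} (I : VC ℓ) f → ⟪ η I , f ⟫ ≡ ∑ (coarsenings I) (λ J → pow2 (length J) * f J)
⟪η⟫ I f = ∑-map (λ J → pow2 (length J) , J) (coarsenings I) _

-- Möbius inversion in the Boolean lattice of coarsenings: this functional sends η_I to ± g(I).
dual : ∀ {ℓ} → (VC ℓ → ℚ) → VC ℓ → ℚ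
dual g K = ½^ (length K) * (sgn (length K) * ∑ (coarsenings K) g)

⟪η,dual⟫ : ∀ {ℓ} (I : VC ℓ) g → ⟪ η I , dual g ⟫ ≡ sgn (length I) * g I
⟪η,dual⟫ I g = trans (⟪η⟫ I (dual g)) (trans (∑-cong (coarsenings I) step) (∑-coarsenings-möbius I g))
  where
  step : ∀ J → pow2 (length J) * dual g J ≡ sgn (length J) * ∑ (coarsenings J) g
  step J = begin
    pow2 k * (½^ k * x)   ≡⟨ sym (ℚP.*-assoc (pow2 k) (½^ k) x) ⟩
    pow2 k * ½^ k * x     ≡⟨ cong (_* x) (pow2-½^ k) ⟩
    1ℚ * x                ≡⟨ ℚP.*-identityˡ x ⟩
    x                     ∎
    where
    open ≡-Reasoning
    k = length J
    x = sgn (length J) * ∑ (coarsenings J) g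

-- Tilings

-- `Tiling R i X u S`: the columns of X have weight 1 or 2, the last one weight 1, u is the colouring word and S the
-- peak set when positions are counted from i + 1; R relates consecutive letters from each pair up to the letter after it.
data Tiling {ℓ} (R : Fin ℓ → Fin ℓ → Set) : ℕ → VC ℓ → List (Fin ℓ) → List ℕ → Set where
  [] : ∀ {i} → Tiling R i [] [] []
  one : ∀ {i X u S} a → Tiling R (suc i) X u S → Tiling R i (e a ∷ X) (a ∷ u) S
  two : ∀ {i X u S} a b c → R a b → R b c → Tiling R (suc (suc i)) X (c ∷ u) S →
    Tiling R i ((e a +c e b) ∷ X) (a ∷ b ∷ c ∷ u) (suc (suc i) ∷ S)

tiling-ne : ∀ {ℓ R i X S} {c : Fin ℓ} {u} → Tiling R i X (c ∷ u) S → NonEmpty X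
tiling-ne (one a _) = cons _ _
tiling-ne (two _ _ _ _ _ _) = cons _ _

Pkacc-e : ∀ {ℓ} i (a : Fin ℓ) X → Pkacc i (e a ∷ X) ≡ Pkacc (suc i) X
Pkacc-e i a [] = refl
Pkacc-e i a (v ∷ X) rewrite wt-e a | ℕP.+-comm i 1 = refl

Pkacc-e+e : ∀ {ℓ} i (a b : Fin ℓ) {X} → NonEmpty X →
  Pkacc i ((e a +c e b) ∷ X) ≡ suc (suc i) ∷ Pkacc (suc (suc i)) X
Pkacc-e+e i a b (cons v X) rewrite wt-e+e a b | ℕP.+-comm i 2 = refl

tiling-Pk : ∀ {ℓ R i X S} {u : List (Fin ℓ)} → Tiling R i X u S → Pkacc i X ≡ S
tiling-Pk [] = refl
tiling-Pk {i = i} (one {X = X} a t) = trans (Pkacc-e i a X) (tiling-Pk t)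
tiling-Pk {i = i} (two a b c _ _ t) =
  trans (Pkacc-e+e i a b (tiling-ne t)) (cong (suc (suc i) ∷_) (tiling-Pk t))

tiling-lower : ∀ {ℓ R i X S} {u : List (Fin ℓ)} → Tiling R i X u S → All (2 ℕ.+ i ≤_) S
tiling-lower [] = []
tiling-lower (one a t) = All.map (ℕP.≤-trans (ℕP.n≤1+n _)) (tiling-lower t)
tiling-lower (two a b c _ _ t) =
  ℕP.≤-refl ∷ All.map (ℕP.≤-trans (ℕP.m≤n+m _ 2)) (tiling-lower t)

tiling-upper : ∀ {ℓ R i X S} {u : List (Fin ℓ)} → Tiling R i X u S → All (λ s → suc s ≤ i ℕ.+ length u) S
tiling-upper [] = []
tiling-upper {i = i} (one {u = u} a t) =
  All.map (λ {s} → subst (suc s ≤_) (sym (ℕP.+-suc i (length u)))) (tiling-upper t)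
tiling-upper {i = i} (two {u = u} a b c _ _ t) =
  subst (3 ℕ.+ i ≤_) eq (s≤s (s≤s (subst (suc i ≤_) (sym (ℕP.+-suc i (length u))) (s≤s (ℕP.m≤m+n i (length u)))))) ∷
  All.map (λ {s} → subst (suc s ≤_) eq) (tiling-upper t)
  where
  eq : suc (suc i) ℕ.+ suc (length u) ≡ i ℕ.+ (3 ℕ.+ length u)
  eq = sym (trans (ℕP.+-suc i _) (cong suc (ℕP.+-suc i _)))

tiling-linked : ∀ {ℓ R i X S} {u : List (Fin ℓ)} → Tiling R i X u S → Linked _<_ S
tiling-linked [] = []
tiling-linked (one a t) = tiling-linked t
tiling-linked {i = i} (two a b c _ _ t) with tiling-linked t | tiling-lower t
... | [] | [] = [-]
... | [-] | s≥ ∷ _ = ℕP.≤-trans (ℕP.n≤1+n _) s≥ ∷ [-]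
... | s<t ∷ l | s≥ ∷ _ = ℕP.≤-trans (ℕP.n≤1+n _) s≥ ∷ s<t ∷ l

tiling-nonadjacent : ∀ {ℓ R i X S} {u : List (Fin ℓ)} → Tiling R i X u S → ∀ s → s ∈ S → ¬ (ℕ.pred s ∈ S)
tiling-nonadjacent (one a t) s s∈ p∈ = tiling-nonadjacent t s s∈ p∈
tiling-nonadjacent {i = i} (two a b c _ _ t) s (here refl) (here eq) = ℕP.1+n≢n (sym eq)
tiling-nonadjacent {i = i} (two a b c _ _ t) s (here refl) (there p∈) =
  ℕP.<⇒≱ (s≤s (ℕP.≤-trans (ℕP.n≤1+n _) (ℕP.n≤1+n _))) (All.lookup (tiling-lower t) p∈)
tiling-nonadjacent {i = i} (two a b c _ _ t) s (there s∈) (here eq) =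
  ℕP.<⇒≱ (ℕP.pred-mono-≤ (All.lookup (tiling-lower t) s∈)) (ℕP.≤-reflexive eq)
tiling-nonadjacent (two a b c _ _ t) s (there s∈) (there p∈) = tiling-nonadjacent t s s∈ p∈

tiling-isPeakSet : ∀ {ℓ R X S} {u : List (Fin ℓ)} → Tiling R 0 X u S → IsPeakSet (length u) S
tiling-isPeakSet t =
  tiling-linked t , All.zipWith (λ p → p) (tiling-lower t , tiling-upper t) , tiling-nonadjacent t

-- Recovering a tiling from its peak set

≡ᵇ-refl : ∀ n → (n ≡ᵇ n) ≡ true
≡ᵇ-refl zero = refl
≡ᵇ-refl (suc n) = ≡ᵇ-refl n

≡ᵇ-< : ∀ {m n} → m < n → (m ≡ᵇ n) ≡ false
≡ᵇ-< {zero} (s≤s _) = refl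
≡ᵇ-< {suc m} (s≤s p) = ≡ᵇ-< p

≡ᵇ-> : ∀ {m n} → n < m → (m ≡ᵇ n) ≡ false
≡ᵇ-> {n = zero} (s≤s _) = refl
≡ᵇ-> {n = suc m} (s≤s p) = ≡ᵇ-> p

memᵇ-< : ∀ {s S} → All (s <_) S → memᵇ s S ≡ false
memᵇ-< [] = refl
memᵇ-< (p ∷ ps) = cong₂ _∨_ (≡ᵇ-< p) (memᵇ-< ps)

IpkAcc-∈ : ∀ {ℓ} i P (a b : Fin ℓ) w → memᵇ (suc i) P ≡ true →
  IpkAcc i P (a ∷ b ∷ w) ≡ (e a +c e b) ∷ IpkAcc (suc (suc i)) P w
IpkAcc-∈ i P a b w eq rewrite eq = refl

IpkAcc-∉ : ∀ {ℓ} i P (a b : Fin ℓ) w → memᵇ (suc i) P ≡ false →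
  IpkAcc i P (a ∷ b ∷ w) ≡ e a ∷ IpkAcc (suc i) P (b ∷ w)
IpkAcc-∉ i P a b w eq rewrite eq = refl

-- `IpkAcc` consults the whole set `P` throughout, while the tiling stores only the peaks still
-- ahead. Agreement beyond the current position is what the recursion preserves.
tiling-Ipk : ∀ {ℓ R i X S P} {u : List (Fin ℓ)} → Tiling R i X u S →
  (∀ s → suc i < s → memᵇ s P ≡ memᵇ s S) → IpkAcc (suc i) P u ≡ X
tiling-Ipk [] agree = refl
tiling-Ipk {u = _ ∷ []} (one a []) agree = refl
tiling-Ipk {i = i} {P = P} {u = _ ∷ b ∷ w} (one a t) agree =
  trans (IpkAcc-∉ (suc i) P a b w (trans (agree (suc (suc i)) ℕP.≤-refl) (memᵇ-< (tiling-lower t))))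
    (cong (e a ∷_) (tiling-Ipk t (λ s p → agree s (ℕP.≤-trans (ℕP.n≤1+n _) p))))
tiling-Ipk {i = i} {P = P} (two {u = u} {S} a b c _ _ t) agree =
  trans (IpkAcc-∈ (suc i) P a b (c ∷ u) (trans (agree (suc (suc i)) ℕP.≤-refl) (cong (_∨ memᵇ (suc (suc i)) S) (≡ᵇ-refl i))))
    (cong ((e a +c e b) ∷_) (tiling-Ipk t (λ s p → trans
      (agree s (ℕP.≤-trans (ℕP.n≤1+n _) (ℕP.≤-trans (ℕP.n≤1+n _) p)))
      (cong (_∨ memᵇ s S) (≡ᵇ-> (ℕP.≤-trans (ℕP.n≤1+n _) p))))))

tiling-Ipk₀ : ∀ {ℓ R X S} {u : List (Fin ℓ)} → Tiling R 0 X u S → Ipk S u ≡ X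
tiling-Ipk₀ t = tiling-Ipk t (λ _ _ → refl)

tiling-sublists : ∀ {ℓ R i X S T} {u : List (Fin ℓ)} → Tiling R i X u S → T ∈ sublists S →
  ∃ λ X′ → Tiling R i X′ u T
tiling-sublists [] (here refl) = [] , []
tiling-sublists (one a t) T∈ = let X′ , t′ = tiling-sublists t T∈ in _ , one a t′
tiling-sublists (two {S = S} a b c Rab Rbc t) T∈ with ∈P.∈-++⁻ (sublists S) T∈
-- A dropped peak splits its pair into two single letters, which carry no condition.
... | inj₁ T∈′ = let X′ , t′ = tiling-sublists t T∈′ in _ , one a (one b t′)
... | inj₂ T∈′ with ∈P.∈-map⁻ _ T∈′
... | T′ , T′∈ , refl = let X′ , t′ = tiling-sublists t T′∈ in _ , two a b c Rab Rbc t′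

-- With this relation a tiling records only positions, which is all that a peak set provides; the
-- order of the letters is extracted later from the equation in `Admissible`.
Any₂ : ∀ {ℓ} → Fin ℓ → Fin ℓ → Set
Any₂ _ _ = ⊤

-- The next letter starts a pair exactly if the smallest remaining peak is `2 + i`; otherwise that
-- peak lies further on and a single letter is placed. The bounds on peaks are relative to `i`, so
-- they must be restored after each tile.
peakSet-tiling : ∀ {ℓ} (u : List (Fin ℓ)) i S → Linked _<_ S →
  All (λ s → 2 ℕ.+ i ≤ s × suc s ≤ i ℕ.+ length u) S → (∀ s → s ∈ S → ¬ (ℕ.pred s ∈ S)) →
  ∃ λ X → Tiling Any₂ i X u S
peakSet-tiling [] i [] _ _ _ = [] , []
peakSet-tiling [] i (s ∷ S) _ ((lo , hi) ∷ _) _ = ⊥-elim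
  (ℕP.<⇒≱ hi (ℕP.≤-trans (ℕP.≤-reflexive (ℕP.+-identityʳ i)) (ℕP.≤-trans (ℕP.m≤n+m i 2) lo)))
peakSet-tiling (a ∷ u) i [] _ _ _ =
  let X , t = peakSet-tiling u (suc i) [] [] [] (λ _ ()) in _ , one a t
peakSet-tiling (a ∷ u) i (s ∷ S) ln ((lo , hi) ∷ bs) na with 2 ℕ.+ i ℕ.≟ s
-- A peak stays strictly below the total length, so its pair must be followed by a letter; words of
-- one or two letters have no room.
peakSet-tiling (a ∷ []) i (s ∷ S) ln ((lo , hi) ∷ bs) na | yes refl =
  ⊥-elim (ℕP.<⇒≱ hi (ℕP.≤-trans (ℕP.≤-reflexive (ℕP.+-comm i 1)) (ℕP.n≤1+n _)))
peakSet-tiling (a ∷ b ∷ []) i (s ∷ S) ln ((lo , hi) ∷ bs) na | yes refl =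
  ⊥-elim (ℕP.<⇒≱ hi (ℕP.≤-reflexive (ℕP.+-comm i 2)))
peakSet-tiling (a ∷ b ∷ c ∷ w) i (s ∷ S) ln ((lo , hi) ∷ bs) na | yes refl =
  let X , t = peakSet-tiling (c ∷ w) (2 ℕ.+ i) S (linked-tail ln) (All.tabulate bounds)
                (λ t t∈ p∈ → na t (there t∈) (there p∈))
  in _ , two a b c tt tt t
  where
  linked-tail : ∀ {x xs} → Linked _<_ (x ∷ xs) → Linked _<_ xs
  linked-tail [-] = []
  linked-tail (_ ∷ l) = l
  above : All (2 ℕ.+ i <_) S
  above with LinkedP.Linked⇒AllPairs ℕP.<-trans ln
  ... | p ∷ _ = p
  bounds : ∀ {t} → t ∈ S → 4 ℕ.+ i ≤ t × suc t ≤ 2 ℕ.+ i ℕ.+ suc (length w)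
  bounds {t} t∈ =
    -- The remaining peaks exceed `2 + i`, and `3 + i` would be adjacent to it.
    ℕP.≤∧≢⇒< (All.lookup above t∈) (λ eq → na t (there t∈) (here (cong ℕ.pred (sym eq)))) ,
    subst (suc t ≤_) (trans (ℕP.+-suc i _) (cong suc (ℕP.+-suc i _))) (proj₂ (All.lookup bs t∈))
peakSet-tiling (a ∷ u) i (s ∷ S) ln ((lo , hi) ∷ bs) na | no 2+i≢s =
  let X , t = peakSet-tiling u (suc i) (s ∷ S) ln (bound (lt , hi) ∷ All.zipWith bound′ (above , bs)) na
  in _ , one a t
  where
  lt : 3 ℕ.+ i ≤ s
  lt = ℕP.≤∧≢⇒< lo 2+i≢s
  above : All (s <_) S
  above with LinkedP.Linked⇒AllPairs ℕP.<-trans ln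
  ... | p ∷ _ = p
  bound : ∀ {t} → 3 ℕ.+ i ≤ t × suc t ≤ i ℕ.+ suc (length u) → 3 ℕ.+ i ≤ t × suc t ≤ suc i ℕ.+ length u
  bound {t} (p , q) = p , subst (suc t ≤_) (ℕP.+-suc i _) q
  bound′ : ∀ {t} → s < t × (2 ℕ.+ i ≤ t × suc t ≤ i ℕ.+ suc (length u)) → 3 ℕ.+ i ≤ t × suc t ≤ suc i ℕ.+ length u
  bound′ (s<t , _ , q) = bound (ℕP.≤-trans lt (ℕP.<⇒≤ s<t) , q)

-- The map odd on tilings

oddAcc-e : ∀ {ℓ} acc (a : Fin ℓ) X → oddAcc acc (e a ∷ X) ≡ (acc +c e a) ∷ oddV X
oddAcc-e acc a X rewrite wt-e a = refl

oddAcc-e+e : ∀ {ℓ} acc (a b : Fin ℓ) X → oddAcc acc ((e a +c e b) ∷ X) ≡ oddAcc (acc +c (e a +c e b)) X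
oddAcc-e+e acc a b X rewrite wt-e+e a b = refl

content-snoc : ∀ {ℓ} (b : List (Fin ℓ)) a → content b +c e a ≡ content (b ++ a ∷ [])
content-snoc b a = sym (trans (content-++ b (a ∷ [])) (cong (content b +c_) (+c-identityʳ (e a))))

content-snoc₂ : ∀ {ℓ} (b : List (Fin ℓ)) a c → content b +c (e a +c e c) ≡ content (b ++ a ∷ c ∷ [])
content-snoc₂ b a c = sym (trans (content-++ b (a ∷ c ∷ []))
  (cong (λ z → content b +c (e a +c z)) (+c-identityʳ (e c))))

++-split : ∀ {A : Set} (xs ys : List A) {p q} → length xs ≡ length ys → xs ++ p ≡ ys ++ q → xs ≡ ys × p ≡ q
++-split [] [] _ eq = refl , eq
++-split (x ∷ xs) (y ∷ ys) len eq with LP.∷-injective eq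
... | refl , eq′ with ++-split xs ys (ℕP.suc-injective len) eq′
... | refl , eq″ = refl , eq″

sorted-init₂ : ∀ {ℓ} (b : List (Fin ℓ)) {a a′ c} → Sorted (b ++ a ∷ a′ ∷ c ∷ []) →
  Sorted (b ++ a ∷ []) × a Fin.≤ a′ × a′ Fin.≤ c
sorted-init₂ [] (p ∷ q ∷ [-]) = [-] , p , q
sorted-init₂ (x ∷ []) (r ∷ s) = let _ , p , q = sorted-init₂ [] s in r ∷ [-] , p , q
sorted-init₂ (x ∷ y ∷ b) (r ∷ s) = let t , p , q = sorted-init₂ (y ∷ b) s in r ∷ t , p , q

sorted-snoc₂ : ∀ {ℓ} (b : List (Fin ℓ)) {a a′ c} → Sorted (b ++ a ∷ []) → a Fin.≤ a′ → a′ Fin.≤ c →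
  Sorted (b ++ a ∷ a′ ∷ c ∷ [])
sorted-snoc₂ [] _ p q = p ∷ q ∷ [-]
sorted-snoc₂ (x ∷ []) (r ∷ s) p q = r ∷ sorted-snoc₂ [] s p q
sorted-snoc₂ (x ∷ y ∷ b) (r ∷ s) p q = r ∷ sorted-snoc₂ (y ∷ b) s p q

cw-oddAcc-e : ∀ {ℓ} (b : List (Fin ℓ)) a X →
  cw (oddAcc (content b) (e a ∷ X)) ≡ cwCol (content (b ++ a ∷ [])) ++ cw (oddV X)
cw-oddAcc-e b a X = trans (cong cw (oddAcc-e (content b) a X))
  (cong (λ z → cwCol z ++ cw (oddV X)) (content-snoc b a))

oddAcc-content-e+e : ∀ {ℓ} (b : List (Fin ℓ)) a a′ X →
  oddAcc (content b) ((e a +c e a′) ∷ X) ≡ oddAcc (content (b ++ a ∷ a′ ∷ [])) X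
oddAcc-content-e+e b a a′ X =
  trans (oddAcc-e+e (content b) a a′ X) (cong (λ z → oddAcc z X) (content-snoc₂ b a a′))

tiling-sorted₀ : ∀ {ℓ R i X S} {u : List (Fin ℓ)} → Tiling R i X u S → cw (oddV X) ≡ u → Tiling Fin._≤_ i X u S

-- `b` holds the letters of the block still open, whose content is the accumulator of `oddAcc`. A
-- pair only extends `b`; the single letter closing the block reveals that the block is a colouring
-- word, hence sorted. The comparisons needed by earlier pairs are read off on the way back.
tiling-sorted : ∀ {ℓ R i X S} {a : Fin ℓ} {u} → Tiling R i X (a ∷ u) S → ∀ b →
  cw (oddAcc (content b) X) ≡ b ++ a ∷ u → Sorted (b ++ a ∷ []) × Tiling Fin._≤_ i X (a ∷ u) S
tiling-sorted {u = u} (one {X = X} a t) b eq =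
  subst Sorted (proj₁ split) (cwCol-sorted (content (b ++ a ∷ []))) , one a (tiling-sorted₀ t (proj₂ split))
  where
  -- `cwCol` lists as many letters as the column weighs, so both words split at the end of the
  -- block.
  split : cwCol (content (b ++ a ∷ [])) ≡ b ++ a ∷ [] × cw (oddV X) ≡ u
  split = ++-split (cwCol (content (b ++ a ∷ []))) (b ++ a ∷ [])
    (trans (length-cwCol (content (b ++ a ∷ []))) (wt-content (b ++ a ∷ [])))
    (trans (sym (cw-oddAcc-e b a X)) (trans eq (sym (LP.++-assoc b (a ∷ []) u))))
tiling-sorted (two {X = X} {u = u} a a′ c _ _ t) b eq =
  let s , t′ = tiling-sorted t (b ++ a ∷ a′ ∷ [])
                 (trans (cong cw (sym (oddAcc-content-e+e b a a′ X)))
                   (trans eq (sym (LP.++-assoc b (a ∷ a′ ∷ []) (c ∷ u)))))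
      s′ , p , q = sorted-init₂ b (subst Sorted (LP.++-assoc b (a ∷ a′ ∷ []) (c ∷ [])) s)
  in s′ , two a a′ c p q t′

tiling-sorted₀ [] _ = []
tiling-sorted₀ t@(one _ _) eq = proj₂ (tiling-sorted t [] eq)
tiling-sorted₀ t@(two _ _ _ _ _ _) eq = proj₂ (tiling-sorted t [] eq)

tiling-cw₀ : ∀ {ℓ i X S} {u : List (Fin ℓ)} → Tiling Fin._≤_ i X u S → cw (oddV X) ≡ u

-- The local comparisons keep the open block `b` sorted through its next letter, so when it closes
-- `cwCol-content` returns its letters in their original order.
tiling-cw : ∀ {ℓ i X S} {a : Fin ℓ} {u} → Tiling Fin._≤_ i X (a ∷ u) S → ∀ b → Sorted (b ++ a ∷ []) →
  cw (oddAcc (content b) X) ≡ b ++ a ∷ u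
tiling-cw (one {X = X} {u = u} a t) b s = trans (cw-oddAcc-e b a X)
  (trans (cong₂ _++_ (cwCol-content s) (tiling-cw₀ t)) (LP.++-assoc b (a ∷ []) u))
tiling-cw (two {X = X} {u = u} a a′ c p q t) b s = trans (cong cw (oddAcc-content-e+e b a a′ X))
  (trans (tiling-cw t (b ++ a ∷ a′ ∷ [])
           (subst Sorted (sym (LP.++-assoc b (a ∷ a′ ∷ []) (c ∷ []))) (sorted-snoc₂ b s p q)))
    (LP.++-assoc b (a ∷ a′ ∷ []) (c ∷ u)))

tiling-cw₀ [] = refl
tiling-cw₀ t@(one _ _) = tiling-cw t [] [-]
tiling-cw₀ t@(two _ _ _ _ _ _) = tiling-cw t [] [-]

-- Inverting odd by the refinement Ĩ

-- Even length of the first word prevents a pair from straddling the boundary.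
pairUp-++ : ∀ {ℓ} (b c : List (Fin ℓ)) → isOddᵇ (length b) ≡ false → pairUp (b ++ c) ≡ pairUp b ++ pairUp c
pairUp-++ [] c _ = refl
pairUp-++ (x ∷ y ∷ b) c ev = cong ((e x +c e y) ∷_) (pairUp-++ b c ev)

even-snoc₂ : ∀ {A : Set} (b : List A) {x y} → isOddᵇ (length b) ≡ false → isOddᵇ (length (b ++ x ∷ y ∷ [])) ≡ false
even-snoc₂ [] _ = refl
even-snoc₂ (_ ∷ _ ∷ b) ev = even-snoc₂ b ev

tiling-tilde₀ : ∀ {ℓ i X S} {u : List (Fin ℓ)} → Tiling Fin._≤_ i X u S → tilde (oddV X) ≡ X

-- The open block `b` consists of whole pairs, hence has even length, and `pairUp b` restores the
-- columns already absorbed by the accumulator.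
tiling-tilde : ∀ {ℓ i X S} {a : Fin ℓ} {u} → Tiling Fin._≤_ i X (a ∷ u) S → ∀ b →
  isOddᵇ (length b) ≡ false → Sorted (b ++ a ∷ []) → tilde (oddAcc (content b) X) ≡ pairUp b ++ X
tiling-tilde (one {X = X} a t) b ev s = begin
  tilde (oddAcc (content b) (e a ∷ X))
    ≡⟨ cong tilde (oddAcc-e (content b) a X) ⟩
  pairUp (cwCol (content b +c e a)) ++ tilde (oddV X)
    ≡⟨ cong (λ z → pairUp (cwCol z) ++ tilde (oddV X)) (content-snoc b a) ⟩
  pairUp (cwCol (content (b ++ a ∷ []))) ++ tilde (oddV X)
    ≡⟨ cong₂ (λ z w → pairUp z ++ w) (cwCol-content s) (tiling-tilde₀ t) ⟩
  pairUp (b ++ a ∷ []) ++ X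
    ≡⟨ cong (_++ X) (pairUp-++ b (a ∷ []) ev) ⟩
  (pairUp b ++ e a ∷ []) ++ X
    ≡⟨ LP.++-assoc (pairUp b) (e a ∷ []) X ⟩
  pairUp b ++ e a ∷ X ∎
  where
  open ≡-Reasoning
tiling-tilde (two {X = X} {u = u} a a′ c p q t) b ev s = begin
  tilde (oddAcc (content b) ((e a +c e a′) ∷ X))
    ≡⟨ cong tilde (oddAcc-content-e+e b a a′ X) ⟩
  tilde (oddAcc (content (b ++ a ∷ a′ ∷ [])) X)
    ≡⟨ tiling-tilde t (b ++ a ∷ a′ ∷ []) (even-snoc₂ b ev)
         (subst Sorted (sym (LP.++-assoc b (a ∷ a′ ∷ []) (c ∷ []))) (sorted-snoc₂ b s p q)) ⟩
  pairUp (b ++ a ∷ a′ ∷ []) ++ X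
    ≡⟨ cong (_++ X) (pairUp-++ b (a ∷ a′ ∷ []) ev) ⟩
  (pairUp b ++ (e a +c e a′) ∷ []) ++ X
    ≡⟨ LP.++-assoc (pairUp b) ((e a +c e a′) ∷ []) X ⟩
  pairUp b ++ (e a +c e a′) ∷ X ∎
  where open ≡-Reasoning

tiling-tilde₀ [] = refl
tiling-tilde₀ t@(one _ _) = tiling-tilde t [] refl [-]
tiling-tilde₀ t@(two _ _ _ _ _ _) = tiling-tilde t [] refl [-]

AllOdd : ∀ {ℓ} → VC ℓ → Set
AllOdd = All (λ v → wt v % 2 ≡ 1)

isOddᵇ⇒%2≡1 : ∀ n → isOddᵇ n ≡ true → n % 2 ≡ 1
isOddᵇ⇒%2≡1 n eq = ℕP.≡ᵇ⇒≡ (n % 2) 1 (subst T (sym eq) tt)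

allOdd⇒valid : ∀ {ℓ} {I : VC ℓ} → AllOdd I → ValidVC I
allOdd⇒valid = All.map (λ {v} → odd⇒≥1 (wt v))
  where
  odd⇒≥1 : ∀ n → n % 2 ≡ 1 → 1 ≤ n
  odd⇒≥1 (suc n) _ = s≤s z≤n

-- The accumulator collects only even columns and so stays even; the odd column that closes a block
-- makes the sum odd.
oddAcc-allOdd : ∀ {ℓ} (acc : Col ℓ) I → isOddᵇ (wt acc) ≡ false → AllOdd (oddAcc acc I)
oddAcc-allOdd acc [] ev = []
oddAcc-allOdd {ℓ} acc (v ∷ I) ev with isOddᵇ (wt v) in eq
... | true = isOddᵇ⇒%2≡1 (wt (acc +c v)) (trans (cong isOddᵇ (wt-+c acc v))
               (trans (isOddᵇ-+ (wt acc) (wt v)) (cong₂ _xor_ ev eq)))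
             ∷ oddAcc-allOdd zeroCol I (cong isOddᵇ (wt-zeroCol ℓ))
... | false = oddAcc-allOdd (acc +c v) I (trans (cong isOddᵇ (wt-+c acc v))
               (trans (isOddᵇ-+ (wt acc) (wt v)) (cong₂ _xor_ ev eq)))

oddV-allOdd : ∀ {ℓ} (I : VC ℓ) → AllOdd (oddV I)
oddV-allOdd {ℓ} I = oddAcc-allOdd zeroCol I (cong isOddᵇ (wt-zeroCol ℓ))

-- An odd word ends in a single letter, so each of its pairs is followed by a letter of the same
-- sorted word. The rest must be tiled from every start `i`, because peaks are absolute positions
-- and shift with the length of `b`.
pairUp-tiling : ∀ {ℓ} (b : List (Fin ℓ)) → isOddᵇ (length b) ≡ true → Sorted b → ∀ {X u} →
  (∀ i → ∃ (Tiling Fin._≤_ i X u)) → ∀ i → ∃ (Tiling Fin._≤_ i (pairUp b ++ X) (b ++ u))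
pairUp-tiling (a ∷ []) _ _ ts i = _ , one a (proj₂ (ts (suc i)))
pairUp-tiling (a ∷ b ∷ c ∷ w) od (p ∷ q ∷ s) ts i =
  _ , two a b c p q (proj₂ (pairUp-tiling (c ∷ w) od s ts (suc (suc i))))

oddAcc-pairUp : ∀ {ℓ} (b : List (Fin ℓ)) → isOddᵇ (length b) ≡ true → ∀ acc X →
  oddAcc acc (pairUp b ++ X) ≡ (acc +c content b) ∷ oddV X
oddAcc-pairUp (a ∷ []) od acc X =
  trans (oddAcc-e acc a X) (cong (λ z → (acc +c z) ∷ oddV X) (sym (+c-identityʳ (e a))))
oddAcc-pairUp (a ∷ b ∷ w) od acc X = begin
  oddAcc acc ((e a +c e b) ∷ pairUp w ++ X)            ≡⟨ oddAcc-e+e acc a b (pairUp w ++ X) ⟩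
  oddAcc (acc +c (e a +c e b)) (pairUp w ++ X)         ≡⟨ oddAcc-pairUp w od (acc +c (e a +c e b)) X ⟩
  ((acc +c (e a +c e b)) +c content w) ∷ oddV X        ≡⟨ cong (_∷ oddV X) (trans (+c-assoc acc (e a +c e b) (content w)) (cong (acc +c_) (+c-assoc (e a) (e b) (content w)))) ⟩
  (acc +c (e a +c (e b +c content w))) ∷ oddV X        ∎
  where open ≡-Reasoning

odd-length-cwCol : ∀ {ℓ} (v : Col ℓ) → wt v % 2 ≡ 1 → isOddᵇ (length (cwCol v)) ≡ true
odd-length-cwCol v od = trans (cong isOddᵇ (length-cwCol v)) (cong (_≡ᵇ 1) od)

tilde-tiling : ∀ {ℓ} {I : VC ℓ} → AllOdd I → ∀ i → ∃ (Tiling Fin._≤_ i (tilde I) (cw I))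
tilde-tiling [] i = [] , []
tilde-tiling {I = v ∷ I} (od ∷ ods) =
  pairUp-tiling (cwCol v) (odd-length-cwCol v od) (cwCol-sorted v) (tilde-tiling ods)

oddV-tilde : ∀ {ℓ} {I : VC ℓ} → AllOdd I → oddV (tilde I) ≡ I
oddV-tilde [] = refl
oddV-tilde {I = v ∷ I} (od ∷ ods) = trans (oddAcc-pairUp (cwCol v) (odd-length-cwCol v od) zeroCol (tilde I))
  (cong₂ _∷_ (trans (+c-identityˡ _) (content-cwCol v)) (oddV-tilde ods))

tilde-tiling-Pk : ∀ {ℓ} {I : VC ℓ} → AllOdd I → Tiling Fin._≤_ 0 (tilde I) (cw I) (Pk (tilde I))
tilde-tiling-Pk ods = let S , t = tilde-tiling ods 0 in subst (Tiling _ _ _ _) (sym (tiling-Pk t)) t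

tiling⇒admissible : ∀ {ℓ X S} {u : List (Fin ℓ)} → Tiling Fin._≤_ 0 X u S → Admissible S u
tiling⇒admissible t = tiling-isPeakSet t , trans (cong (cw ∘ oddV) (tiling-Ipk₀ t)) (tiling-cw₀ t)

admissible⇒tiling : ∀ {ℓ S} {u : List (Fin ℓ)} → Admissible S u → Tiling Fin._≤_ 0 (Ipk S u) u S
admissible⇒tiling {S = S} {u} ((ln , bs , na) , eq) =
  let X , t = peakSet-tiling u 0 S ln bs na
  in tiling-sorted₀ (subst (λ Y → Tiling Any₂ 0 Y u S) (sym (tiling-Ipk₀ t)) t) eq

-- Peak functions

-- Membership in D ∪ (D + 1), in the form into which `coveredᵇ` unfolds; the guard keeps
-- `pred 0 = 0` from counting as a predecessor.
covers : ℕ → List ℕ → Bool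
covers s Ds = memᵇ s Ds ∨ ((1 ≤ᵇ s) ∧ memᵇ (ℕ.pred s) Ds)

avoids : List ℕ → List ℕ → Bool
avoids [] Ds = true
avoids (s ∷ P) Ds = not (covers s Ds) ∧ avoids P Ds

∑-sublists-∷ : {A : Set} (x : A) (xs : List A) (F : List A → ℚ) →
  ∑ (sublists (x ∷ xs)) F ≡ ∑ (sublists xs) F + ∑ (sublists xs) (λ S → F (x ∷ S))
∑-sublists-∷ x xs F = trans (∑-++ (sublists xs) (map (x ∷_) (sublists xs)) F)
  (cong (∑ (sublists xs) F +_) (∑-map (x ∷_) (sublists xs) F))

-- Inclusion-exclusion: the sum factors as the product over `s` in `P` of one minus the indicator
-- that `s` is covered.
∑-sublists-covered : ∀ P Ds →
  ∑ (sublists P) (λ S → sgn (length S) * 𝟙 (coveredᵇ S Ds)) ≡ 𝟙 (avoids P Ds)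
∑-sublists-covered [] Ds = refl
∑-sublists-covered (s ∷ P) Ds = begin
  ∑ (sublists (s ∷ P)) F
    ≡⟨ ∑-sublists-∷ s P F ⟩
  ∑ (sublists P) F + ∑ (sublists P) (λ S → F (s ∷ S))
    ≡⟨ cong (∑ (sublists P) F +_) (trans (∑-cong (sublists P) step) (∑-*ˡ (- 𝟙 c) (sublists P) F)) ⟩
  ∑ (sublists P) F + - 𝟙 c * ∑ (sublists P) F
    ≡⟨ cong (λ z → z + - 𝟙 c * z) (∑-sublists-covered P Ds) ⟩
  𝟙 (avoids P Ds) + - 𝟙 c * 𝟙 (avoids P Ds)
    ≡⟨ complement c (avoids P Ds) ⟩
  𝟙 (not c ∧ avoids P Ds) ∎
  where
  open ≡-Reasoning
  c = covers s Ds
  F : List ℕ → ℚ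
  F S = sgn (length S) * 𝟙 (coveredᵇ S Ds)
  shuffle : ∀ a b d → - a * (b * d) ≡ - b * (a * d)
  shuffle = solve 3 (λ a b d → (:- a) :* (b :* d) := (:- b) :* (a :* d)) refl
    where open +-*-Solver
  step : ∀ S → F (s ∷ S) ≡ - 𝟙 c * F S
  step S = trans (cong₂ _*_ (sgn-suc (length S)) (𝟙-∧ c (coveredᵇ S Ds)))
    (shuffle (sgn (length S)) (𝟙 c) (𝟙 (coveredᵇ S Ds)))
  complement : ∀ b a → 𝟙 a + - 𝟙 b * 𝟙 a ≡ 𝟙 (not b ∧ a)
  complement true true = refl
  complement true false = refl
  complement false true = refl
  complement false false = refl

-- Peaks and the cuts of a coarsening

-- The covering relation seen from one element `d` of D. It allows D to be built up cut by cut along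
-- the word, whereas `avoids` recurses on the peaks; `avoids-∷` exchanges the two orders.
touches : ℕ → ℕ → Bool
touches s d = (s ≡ᵇ d) ∨ ((1 ≤ᵇ s) ∧ (ℕ.pred s ≡ᵇ d))

hits : List ℕ → ℕ → Bool
hits [] d = false
hits (s ∷ P) d = touches s d ∨ hits P d

avoids-[] : ∀ P → avoids P [] ≡ true
avoids-[] [] = refl
avoids-[] (zero ∷ P) = avoids-[] P
avoids-[] (suc s ∷ P) = avoids-[] P

avoids-∷ : ∀ P d Ds → avoids P (d ∷ Ds) ≡ not (hits P d) ∧ avoids P Ds
avoids-∷ [] d Ds = refl
avoids-∷ (s ∷ P) d Ds = trans (cong (not (covers s (d ∷ Ds)) ∧_) (avoids-∷ P d Ds))
  (regroup (s ≡ᵇ d) (memᵇ s Ds) (1 ≤ᵇ s) (ℕ.pred s ≡ᵇ d) (memᵇ (ℕ.pred s) Ds) (hits P d) (avoids P Ds))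
  where
  regroup : ∀ p m o q n h a → not ((p ∨ m) ∨ (o ∧ (q ∨ n))) ∧ (not h ∧ a)
                            ≡ not ((p ∨ (o ∧ q)) ∨ h) ∧ (not (m ∨ (o ∧ n)) ∧ a)
  regroup true m o q n h a = refl
  regroup false true o q n h a = sym (∧-zeroʳ (not ((o ∧ q) ∨ h)))
  regroup false false true true n h a = refl
  regroup false false true false true h a = sym (∧-zeroʳ (not h))
  regroup false false true false false h a = refl
  regroup false false false q n h a = refl

touches-below : ∀ {s d} → 2 ℕ.+ d ≤ s → touches s d ≡ false
touches-below (s≤s (s≤s {n = n} d≤)) = cong₂ _∨_ (≡ᵇ-> (s≤s (ℕP.≤-trans d≤ (ℕP.n≤1+n n)))) (≡ᵇ-> (s≤s d≤))

hits-below : ∀ {S d} → All (2 ℕ.+ d ≤_) S → hits S d ≡ false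
hits-below [] = refl
hits-below (p ∷ ps) = cong₂ _∨_ (touches-below p) (hits-below ps)

touches-above : ∀ {s d} → s < d → touches s d ≡ false
touches-above {zero} (s≤s _) = refl
touches-above {suc s} p = cong₂ _∨_ (≡ᵇ-< p) (≡ᵇ-< (ℕP.<-trans (ℕP.n<1+n s) p))

touches-pred : ∀ i → touches (suc i) i ≡ true
touches-pred i = trans (cong ((suc i ≡ᵇ i) ∨_) (≡ᵇ-refl i)) (∨-zeroʳ _)

touches-refl : ∀ i → touches i i ≡ true
touches-refl i = cong (_∨ ((1 ≤ᵇ i) ∧ (ℕ.pred i ≡ᵇ i))) (≡ᵇ-refl i)

Dacc-e-∷ : ∀ {ℓ} i (a : Fin ℓ) {K} → NonEmpty K → Dacc i (e a ∷ K) ≡ suc i ∷ Dacc (suc i) K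
Dacc-e-∷ i a (cons v K) rewrite wt-e a | ℕP.+-comm i 1 = refl

Dacc-mergeHead-e : ∀ {ℓ} i (a : Fin ℓ) {K} → NonEmpty K → Dacc i (mergeHead (e a) K) ≡ Dacc (suc i) K
Dacc-mergeHead-e i a (cons v []) = refl
Dacc-mergeHead-e i a (cons v (w ∷ K))
  rewrite wt-+c (e a) v | wt-e a | ℕP.+-suc i (wt v) = refl

E-ne : ∀ {ℓ} {u : List (Fin ℓ)} → NonEmpty u → NonEmpty (E u)
E-ne (cons a u) = cons (e a) (E u)

-- A cut after the letter `a` adds `suc i` to D and is permitted only if no peak forbids that
-- position; without a cut D does not change.
∑-avoiding : ∀ {ℓ} P i (a : Fin ℓ) {u} → NonEmpty u → (H : VC ℓ → ℚ) →
  ∑ (coarsenings (E (a ∷ u))) (λ J → 𝟙 (avoids P (Dacc i J)) * H J) ≡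
  𝟙 (not (hits P (suc i))) * ∑ (coarsenings (E u)) (λ K → 𝟙 (avoids P (Dacc (suc i) K)) * H (e a ∷ K))
  + ∑ (coarsenings (E u)) (λ K → 𝟙 (avoids P (Dacc (suc i) K)) * H (mergeHead (e a) K))
∑-avoiding P i a {u} ne H = begin
  ∑ (coarsenings (E (a ∷ u))) G
    ≡⟨ ∑-coarsenings-∷ (e a) (E-ne ne) G ⟩
  ∑ cs (λ K → G (e a ∷ K)) + ∑ cs (λ K → G (mergeHead (e a) K))
    ≡⟨ cong₂ _+_ (trans (∑-congᴬ cs-ne step₁) (∑-*ˡ h cs (λ K → A K * H (e a ∷ K))))
                 (∑-congᴬ cs-ne step₂) ⟩
  h * ∑ cs (λ K → A K * H (e a ∷ K)) + ∑ cs (λ K → A K * H (mergeHead (e a) K)) ∎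
  where
  open ≡-Reasoning
  cs = coarsenings (E u)
  cs-ne = coarsenings-ne (E-ne ne)
  h = 𝟙 (not (hits P (suc i)))
  G A : VC _ → ℚ
  G J = 𝟙 (avoids P (Dacc i J)) * H J
  A K = 𝟙 (avoids P (Dacc (suc i) K))
  step₁ : ∀ K → NonEmpty K → G (e a ∷ K) ≡ h * (A K * H (e a ∷ K))
  step₁ K neK = trans (cong (_* H (e a ∷ K)) (trans
      (cong 𝟙 (trans (cong (avoids P) (Dacc-e-∷ i a neK)) (avoids-∷ P (suc i) (Dacc (suc i) K))))
      (𝟙-∧ (not (hits P (suc i))) (avoids P (Dacc (suc i) K)))))
    (ℚP.*-assoc h (A K) (H (e a ∷ K)))
  step₂ : ∀ K → NonEmpty K → G (mergeHead (e a) K) ≡ A K * H (mergeHead (e a) K)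
  step₂ K neK = cong (λ z → 𝟙 (avoids P z) * H (mergeHead (e a) K)) (Dacc-mergeHead-e i a neK)

∑-avoiding-hit : ∀ {ℓ} P i (a : Fin ℓ) {u} → NonEmpty u → (H : VC ℓ → ℚ) → hits P (suc i) ≡ true →
  ∑ (coarsenings (E (a ∷ u))) (λ J → 𝟙 (avoids P (Dacc i J)) * H J) ≡
  ∑ (coarsenings (E u)) (λ K → 𝟙 (avoids P (Dacc (suc i) K)) * H (mergeHead (e a) K))
∑-avoiding-hit P i a {u} ne H hit = trans (∑-avoiding P i a ne H)
  (trans (cong (λ b → 𝟙 (not b) * x + y) hit) (0*+ x y))
  where
  x = ∑ (coarsenings (E u)) (λ K → 𝟙 (avoids P (Dacc (suc i) K)) * H (e a ∷ K))
  y = ∑ (coarsenings (E u)) (λ K → 𝟙 (avoids P (Dacc (suc i) K)) * H (mergeHead (e a) K))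

∑-avoiding-miss : ∀ {ℓ} P i (a : Fin ℓ) {u} → NonEmpty u → (H : VC ℓ → ℚ) → hits P (suc i) ≡ false →
  ∑ (coarsenings (E (a ∷ u))) (λ J → 𝟙 (avoids P (Dacc i J)) * H J) ≡
  ∑ (coarsenings (E u)) (λ K → 𝟙 (avoids P (Dacc (suc i) K)) * H (e a ∷ K))
  + ∑ (coarsenings (E u)) (λ K → 𝟙 (avoids P (Dacc (suc i) K)) * H (mergeHead (e a) K))
∑-avoiding-miss P i a {u} ne H miss = trans (∑-avoiding P i a ne H)
  (trans (cong (λ b → 𝟙 (not b) * x + y) miss) (cong (_+ y) (ℚP.*-identityˡ x)))
  where
  x = ∑ (coarsenings (E u)) (λ K → 𝟙 (avoids P (Dacc (suc i) K)) * H (e a ∷ K))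
  y = ∑ (coarsenings (E u)) (λ K → 𝟙 (avoids P (Dacc (suc i) K)) * H (mergeHead (e a) K))

tiling-oddAcc-ne : ∀ {ℓ R i X S} {a : Fin ℓ} {u} → Tiling R i X (a ∷ u) S → ∀ acc → NonEmpty (oddAcc acc X)
tiling-oddAcc-ne (one {X = X} a t) acc = subst NonEmpty (sym (oddAcc-e acc a X)) (cons _ _)
tiling-oddAcc-ne (two {X = X} a b c _ _ t) acc =
  subst NonEmpty (sym (oddAcc-e+e acc a b X)) (tiling-oddAcc-ne t (acc +c (e a +c e b)))

-- J ⊴ odd(X) iff J ⊴ E_u and D(J) contains no peak of X and no predecessor of one.
tiling-coarsenings : ∀ {ℓ R i X S} {a : Fin ℓ} {u} → Tiling R i X (a ∷ u) S → ∀ P acc (F : VC ℓ → ℚ) →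
  (∀ d → i < d → hits P d ≡ hits S d) →
  ∑ (coarsenings (oddAcc acc X)) F ≡
  ∑ (coarsenings (E (a ∷ u))) (λ J → 𝟙 (avoids P (Dacc i J)) * F (mergeHead acc J))
tiling-coarsenings (one {u = []} a []) P acc F agree =
  trans (cong (λ z → ∑ (coarsenings z) F) (oddAcc-e acc a []))
    (cong (_+ 0ℚ) (sym (trans (cong (λ b → 𝟙 b * x) (avoids-[] P)) (ℚP.*-identityˡ x))))
  where x = F ((acc +c e a) ∷ [])
tiling-coarsenings {i = i} (one {X = X} {u = u@(c ∷ w)} a t) P acc F agree = begin
  ∑ (coarsenings (oddAcc acc (e a ∷ X))) F
    ≡⟨ cong (λ z → ∑ (coarsenings z) F) (oddAcc-e acc a X) ⟩
  ∑ (coarsenings ((acc +c e a) ∷ oddV X)) F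
    ≡⟨ ∑-coarsenings-∷ (acc +c e a) (tiling-oddAcc-ne t zeroCol) F ⟩
  ∑ (coarsenings (oddV X)) (λ K → F ((acc +c e a) ∷ K))
  + ∑ (coarsenings (oddV X)) (λ K → F (mergeHead (acc +c e a) K))
    ≡⟨ cong₂ _+_ (tiling-coarsenings t P zeroCol (λ K → F ((acc +c e a) ∷ K)) agree′)
                 (tiling-coarsenings t P zeroCol (λ K → F (mergeHead (acc +c e a) K)) agree′) ⟩
  ∑ cs (λ K → A K * F ((acc +c e a) ∷ mergeHead zeroCol K))
  + ∑ cs (λ K → A K * F (mergeHead (acc +c e a) (mergeHead zeroCol K)))
    ≡⟨ cong₂ _+_
         (∑-congᴬ cs-ne (λ K ne → cong (λ z → A K * F ((acc +c e a) ∷ z)) (mergeHead-zeroCol ne)))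
         (∑-congᴬ cs-ne (λ K ne → cong (λ z → A K * F z)
           (trans (cong (mergeHead (acc +c e a)) (mergeHead-zeroCol ne)) (sym (mergeHead-mergeHead acc (e a) K))))) ⟩
  ∑ cs (λ K → A K * F (mergeHead acc (e a ∷ K)))
  + ∑ cs (λ K → A K * F (mergeHead acc (mergeHead (e a) K)))
    -- Peaks after a single letter are at least `3 + i`, so neither they nor their predecessors
    -- forbid a cut at `suc i`.
    ≡⟨ sym (∑-avoiding-miss P i a (cons c w) (λ J → F (mergeHead acc J))
         (trans (agree (suc i) ℕP.≤-refl) (hits-below (tiling-lower t)))) ⟩
  ∑ (coarsenings (E (a ∷ u))) (λ J → 𝟙 (avoids P (Dacc i J)) * F (mergeHead acc J)) ∎
  where
  open ≡-Reasoning
  cs = coarsenings (E u)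
  cs-ne = coarsenings-ne (E-ne (cons c w))
  A : VC _ → ℚ
  A K = 𝟙 (avoids P (Dacc (suc i) K))
  agree′ = λ d p → agree d (ℕP.<-trans (ℕP.n<1+n i) p)
tiling-coarsenings {i = i} (two {X = X} {u = u} {S = S} a b c _ _ t) P acc F agree = begin
  ∑ (coarsenings (oddAcc acc ((e a +c e b) ∷ X))) F
    ≡⟨ cong (λ z → ∑ (coarsenings z) F) (oddAcc-e+e acc a b X) ⟩
  ∑ (coarsenings (oddAcc (acc +c (e a +c e b)) X)) F
    ≡⟨ tiling-coarsenings t P (acc +c (e a +c e b)) F agree′ ⟩
  ∑ (coarsenings (E (c ∷ u))) (λ K → 𝟙 (avoids P (Dacc (2 ℕ.+ i) K)) * F (mergeHead (acc +c (e a +c e b)) K))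
    ≡⟨ ∑-cong (coarsenings (E (c ∷ u))) (λ K → cong (λ z → 𝟙 (avoids P (Dacc (2 ℕ.+ i) K)) * F z) (sym (merge K))) ⟩
  ∑ (coarsenings (E (c ∷ u)))
    (λ K → 𝟙 (avoids P (Dacc (2 ℕ.+ i) K)) * F (mergeHead acc (mergeHead (e a) (mergeHead (e b) K))))
    -- The peak `2 + i` forbids a cut after `b`, and its predecessor one after `a`: the pair is
    -- glued to the letter that follows.
    ≡⟨ sym (∑-avoiding-hit P (suc i) b (cons c u) (λ J → F (mergeHead acc (mergeHead (e a) J)))
         (trans (agree (2 ℕ.+ i) (ℕP.n≤1+n _)) (cong (_∨ hits S (2 ℕ.+ i)) (touches-refl (2 ℕ.+ i))))) ⟩
  ∑ (coarsenings (E (b ∷ c ∷ u))) (λ J → 𝟙 (avoids P (Dacc (suc i) J)) * F (mergeHead acc (mergeHead (e a) J)))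
    ≡⟨ sym (∑-avoiding-hit P i a (cons b (c ∷ u)) (λ J → F (mergeHead acc J))
         (trans (agree (suc i) ℕP.≤-refl) (cong (_∨ hits S (suc i)) (touches-pred (suc i))))) ⟩
  ∑ (coarsenings (E (a ∷ b ∷ c ∷ u))) (λ J → 𝟙 (avoids P (Dacc i J)) * F (mergeHead acc J)) ∎
  where
  open ≡-Reasoning
  agree′ : ∀ d → 2 ℕ.+ i < d → hits P d ≡ hits S d
  agree′ d p = trans (agree d (ℕP.<-trans (ℕP.n<1+n i) (ℕP.<-trans (ℕP.n<1+n (suc i)) p)))
    (cong (_∨ hits S d) (touches-above p))
  merge : ∀ K → mergeHead acc (mergeHead (e a) (mergeHead (e b) K)) ≡ mergeHead (acc +c (e a +c e b)) K
  merge K = trans (cong (mergeHead acc) (mergeHead-mergeHead (e a) (e b) K)) (mergeHead-mergeHead acc (e a +c e b) K)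

tiling-coarsenings₀ : ∀ {ℓ R X S} {u : List (Fin ℓ)} → Tiling R 0 X u S → ∀ (F : VC ℓ → ℚ) →
  ∑ (coarsenings (oddV X)) F ≡ ∑ (coarsenings (E u)) (λ J → 𝟙 (avoids S (D J)) * F J)
tiling-coarsenings₀ {u = []} [] F = cong (_+ 0ℚ) (sym (ℚP.*-identityˡ (F [])))
tiling-coarsenings₀ {S = S} {u = a ∷ u} t F = trans (tiling-coarsenings t S zeroCol F (λ _ _ → refl))
  (∑-congᴬ (coarsenings-ne (E-ne (cons a u))) (λ J ne → cong (λ z → 𝟙 (avoids S (D J)) * F z) (mergeHead-zeroCol ne)))

-- Expanding η in θ and θ in η

⟪θ⟫ : ∀ {ℓ} S (u : List (Fin ℓ)) f →
  ⟪ θ S u , f ⟫ ≡ ∑ (coarsenings (E u)) (λ J → 𝟙 (coveredᵇ S (D J)) * (pow2 (length J) * f J))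
⟪θ⟫ S u f = trans (∑-map (λ J → pow2 (length J) , J) (filter (λ J → T? (coveredᵇ S (D J))) (coarsenings (E u))) _)
  (∑-filter (λ J → T? (coveredᵇ S (D J))) (coarsenings (E u)) (λ J → pow2 (length J) * f J))

-- After the two sums are exchanged, each J ⊴ E_u carries the alternating sum of
-- `∑-sublists-covered`, which is the indicator that J ⊴ odd(X).
η-θ : ∀ {ℓ R X S} {u : List (Fin ℓ)} → Tiling R 0 X u S → ∀ f →
  ⟪ η (oddV X) , f ⟫ ≡ ∑ (sublists S) (λ T → sgn (length T) * ⟪ θ T u , f ⟫)
η-θ {X = X} {S = P} {u = u} t f = sym (begin
  ∑ (sublists P) (λ T → sgn (length T) * ⟪ θ T u , f ⟫)
    ≡⟨ ∑-cong (sublists P) (λ T → trans (cong (sgn (length T) *_) (⟪θ⟫ T u f))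
         (sym (∑-*ˡ (sgn (length T)) cs (λ J → C T J * F J)))) ⟩
  ∑ (sublists P) (λ T → ∑ cs (λ J → sgn (length T) * (C T J * F J)))
    ≡⟨ ∑-swap (sublists P) cs (λ T J → sgn (length T) * (C T J * F J)) ⟩
  ∑ cs (λ J → ∑ (sublists P) (λ T → sgn (length T) * (C T J * F J)))
    ≡⟨ ∑-cong cs (λ J → trans (∑-cong (sublists P) (λ T → sym (ℚP.*-assoc (sgn (length T)) (C T J) (F J))))
         (trans (∑-*ʳ (sublists P) (λ T → sgn (length T) * C T J) (F J))
           (cong (_* F J) (∑-sublists-covered P (D J))))) ⟩
  ∑ cs (λ J → 𝟙 (avoids P (D J)) * F J)
    ≡⟨ sym (tiling-coarsenings₀ t F) ⟩
  ∑ (coarsenings (oddV X)) F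
    ≡⟨ sym (⟪η⟫ (oddV X) f) ⟩
  ⟪ η (oddV X) , f ⟫ ∎)
  where
  open ≡-Reasoning
  cs = coarsenings (E u)
  F : VC _ → ℚ
  F J = pow2 (length J) * f J
  C : List ℕ → VC _ → ℚ
  C T J = 𝟙 (coveredᵇ T (D J))

η-θ-odd : ∀ {ℓ} {I : VC ℓ} → AllOdd I → ∀ f →
  ⟪ η I , f ⟫ ≡ ∑ (sublists (Pk (tilde I))) (λ T → sgn (length T) * ⟪ θ T (cw I) , f ⟫)
η-θ-odd ods f = trans (cong (λ z → ⟪ η z , f ⟫) (sym (oddV-tilde ods))) (η-θ (tilde-tiling-Pk ods) f)

-- `T` and `x ∷ T` have opposite signs, and the sublists of `x ∷ T` without `x` are those of `T`;
-- only the terms containing `x` survive.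
∑-sublists-möbius : {A : Set} (S : List A) (g : List A → ℚ) →
  ∑ (sublists S) (λ T → sgn (length T) * ∑ (sublists T) g) ≡ sgn (length S) * g S
∑-sublists-möbius [] g = trans (ℚP.+-identityʳ (1ℚ * (g [] + 0ℚ))) (cong (1ℚ *_) (ℚP.+-identityʳ (g [])))
∑-sublists-möbius (x ∷ S) g = begin
  ∑ (sublists (x ∷ S)) G
    ≡⟨ ∑-sublists-∷ x S G ⟩
  ∑ (sublists S) G + ∑ (sublists S) (λ T → G (x ∷ T))
    ≡⟨ sym (∑-+ (sublists S) G (λ T → G (x ∷ T))) ⟩
  ∑ (sublists S) (λ T → G T + G (x ∷ T))
    ≡⟨ ∑-cong (sublists S) step ⟩
  ∑ (sublists S) (λ T → - (sgn (length T) * ∑ (sublists T) gx))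
    ≡⟨ ∑-neg (sublists S) (λ T → sgn (length T) * ∑ (sublists T) gx) ⟩
  - ∑ (sublists S) (λ T → sgn (length T) * ∑ (sublists T) gx)
    ≡⟨ cong -_ (∑-sublists-möbius S gx) ⟩
  - (sgn (length S) * g (x ∷ S))
    ≡⟨ ℚP.neg-distribˡ-* (sgn (length S)) (g (x ∷ S)) ⟩
  - sgn (length S) * g (x ∷ S)
    ≡⟨ cong (_* g (x ∷ S)) (sym (sgn-suc (length S))) ⟩
  sgn (suc (length S)) * g (x ∷ S) ∎
  where
  open ≡-Reasoning
  gx G : List _ → ℚ
  gx T = g (x ∷ T)
  G T = sgn (length T) * ∑ (sublists T) g
  cancel : ∀ s a b → s * a + - s * (a + b) ≡ - (s * b)
  cancel = solve 3 (λ s a b → s :* a :+ (:- s) :* (a :+ b) := :- (s :* b)) refl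
    where open +-*-Solver
  step : ∀ T → G T + G (x ∷ T) ≡ - (sgn (length T) * ∑ (sublists T) gx)
  step T = trans (cong (G T +_) (cong₂ _*_ (sgn-suc (length T)) (∑-sublists-∷ x T g)))
    (cancel (sgn (length T)) (∑ (sublists T) g) (∑ (sublists T) gx))

sublists-tilings : ∀ {ℓ S} {u : List (Fin ℓ)} → Admissible S u →
  All (λ T → Tiling Fin._≤_ 0 (Ipk T u) u T) (sublists S)
sublists-tilings {u = u} adm = All.tabulate (λ {T} T∈ →
  let X , t = tiling-sublists (admissible⇒tiling adm) T∈
  in subst (λ Y → Tiling Fin._≤_ 0 Y u T) (sym (tiling-Ipk₀ t)) t)

θ-η : ∀ {ℓ} S (u : List (Fin ℓ)) → Admissible S u → ∀ f →
  ⟪ θ S u , f ⟫ ≡ ∑ (sublists S) (λ T → sgn (length T) * ⟪ η (oddV (Ipk T u)) , f ⟫)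
θ-η S u adm f = sym (begin
  ∑ (sublists S) (λ T → sgn (length T) * ⟪ η (oddV (Ipk T u)) , f ⟫)
    ≡⟨ ∑-congᴬ (sublists-tilings adm) (λ T t → cong (sgn (length T) *_) (η-θ t f)) ⟩
  ∑ (sublists S) (λ T → sgn (length T) * ∑ (sublists T) (λ R → sgn (length R) * ⟪ θ R u , f ⟫))
    ≡⟨ ∑-sublists-möbius S (λ R → sgn (length R) * ⟪ θ R u , f ⟫) ⟩
  sgn (length S) * (sgn (length S) * x)
    ≡⟨ sym (ℚP.*-assoc (sgn (length S)) (sgn (length S)) x) ⟩
  sgn (length S) * sgn (length S) * x
    ≡⟨ cong (_* x) (sgn² (length S)) ⟩
  1ℚ * x
    ≡⟨ ℚP.*-identityˡ x ⟩
  x ∎)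
  where
  open ≡-Reasoning
  x = ⟪ θ S u , f ⟫

-- Linear independence

isOddᵇ-wt-ΣI : ∀ {ℓ} {I : VC ℓ} → AllOdd I → isOddᵇ (wt (ΣI I)) ≡ isOddᵇ (length I)
isOddᵇ-wt-ΣI {ℓ} [] = cong isOddᵇ (wt-zeroCol ℓ)
isOddᵇ-wt-ΣI {I = v ∷ I} (od ∷ ods) = begin
  isOddᵇ (wt (v +c ΣI I))             ≡⟨ cong isOddᵇ (wt-+c v (ΣI I)) ⟩
  isOddᵇ (wt v ℕ.+ wt (ΣI I))         ≡⟨ isOddᵇ-+ (wt v) (wt (ΣI I)) ⟩
  isOddᵇ (wt v) xor isOddᵇ (wt (ΣI I)) ≡⟨ cong₂ _xor_ (cong (_≡ᵇ 1) od) (isOddᵇ-wt-ΣI ods) ⟩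
  not (isOddᵇ (length I))             ≡⟨ sym (isOddᵇ-suc (length I)) ⟩
  isOddᵇ (suc (length I))             ∎
  where open ≡-Reasoning

length-cw : ∀ {ℓ} (I : VC ℓ) → length (cw I) ≡ wt (ΣI I)
length-cw {ℓ} [] = sym (wt-zeroCol ℓ)
length-cw (v ∷ I) = trans (LP.length-++ (cwCol v))
  (trans (cong₂ ℕ._+_ (length-cwCol v) (length-cw I)) (sym (wt-+c v (ΣI I))))

sgn-cong : ∀ m n → isOddᵇ m ≡ isOddᵇ n → sgn m ≡ sgn n
sgn-cong m n eq = cong (λ b → if b then - 1ℚ else 1ℚ) eq

module δW {ℓ} = Kronecker (LP.≡-dec (Fin._≟_ {ℓ}))
module δS = Kronecker (LP.≡-dec ℕ._≟_)

-- Through `dual`, η_I is sent to a sign times the indicator of cw(I) = u times the number of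
-- sublists of Pk(Ĩ) equal to `S`. A sum over sublists is chosen as the last factor because
-- expanding θ in η then triggers a second Möbius inversion, which leaves a Kronecker delta.
peakDual : ∀ {ℓ} → List ℕ → List (Fin ℓ) → VC ℓ → ℚ
peakDual S u = dual (λ I → δW.δ (cw I) u * ∑ (sublists (Pk (tilde I))) (λ R → δS.δ R S))

⟪θ,peakDual⟫ : ∀ {ℓ} S′ (u′ : List (Fin ℓ)) S u → Admissible S′ u′ →
  ⟪ θ S′ u′ , peakDual S u ⟫ ≡ sgn (length u′) * sgn (length S′) * (δW.δ u′ u * δS.δ S′ S)
⟪θ,peakDual⟫ S′ u′ S u adm = begin
  ⟪ θ S′ u′ , peakDual S u ⟫
    ≡⟨ θ-η S′ u′ adm (peakDual S u) ⟩
  ∑ (sublists S′) (λ T → sgn (length T) * ⟪ η (oddV (Ipk T u′)) , peakDual S u ⟫)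
    ≡⟨ ∑-congᴬ (sublists-tilings adm) step ⟩
  ∑ (sublists S′) (λ T → σ * d * (sgn (length T) * N T))
    ≡⟨ ∑-*ˡ (σ * d) (sublists S′) (λ T → sgn (length T) * N T) ⟩
  σ * d * ∑ (sublists S′) (λ T → sgn (length T) * N T)
    ≡⟨ cong (σ * d *_) (∑-sublists-möbius S′ (λ R → δS.δ R S)) ⟩
  σ * d * (sgn (length S′) * δS.δ S′ S)
    ≡⟨ regroup σ d (sgn (length S′)) (δS.δ S′ S) ⟩
  σ * sgn (length S′) * (d * δS.δ S′ S) ∎
  where
  open ≡-Reasoning
  σ = sgn (length u′)
  d = δW.δ u′ u
  N : List ℕ → ℚ
  N T = ∑ (sublists T) (λ R → δS.δ R S)
  regroup : ∀ a b c x → a * b * (c * x) ≡ a * c * (b * x)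
  regroup = solve 4 (λ a b c x → a :* b :* (c :* x) := a :* c :* (b :* x)) refl
    where open +-*-Solver
  regroup′ : ∀ a b c x → c * (a * (b * x)) ≡ a * b * (c * x)
  regroup′ = solve 4 (λ a b c x → c :* (a :* (b :* x)) := a :* b :* (c :* x)) refl
    where open +-*-Solver
  step : ∀ T → Tiling Fin._≤_ 0 (Ipk T u′) u′ T →
    sgn (length T) * ⟪ η (oddV (Ipk T u′)) , peakDual S u ⟫ ≡ σ * d * (sgn (length T) * N T)
  step T t = trans (cong (sgn (length T) *_) (trans (⟪η,dual⟫ I _)
      (cong₂ _*_ (sgn-cong (length I) (length u′) parity) (cong₂ (λ w P → δW.δ w u * ∑ (sublists P) (λ R → δS.δ R S)) (tiling-cw₀ t)
        (trans (cong Pk (tiling-tilde₀ t)) (tiling-Pk t))))))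
    (regroup′ σ d (sgn (length T)) (N T))
    where
    I = oddV (Ipk T u′)
    -- With odd columns, the number of columns and the number of letters have equal parity, so the
    -- sign from `dual` is the same for every `T`.
    parity : isOddᵇ (length I) ≡ isOddᵇ (length u′)
    parity = trans (sym (isOddᵇ-wt-ΣI (oddV-allOdd (Ipk T u′))))
      (cong isOddᵇ (trans (sym (length-cw I)) (cong length (tiling-cw₀ t))))

∑-single : {A K : Set} (key : A → K) (f : A → ℚ) {xs : List A} {x : A} → Unique (map key xs) → x ∈ xs →
  (∀ y → key y ≢ key x → f y ≡ 0ℚ) → ∑ xs f ≡ f x
∑-single key f {x ∷ xs} (ne ∷ un) (here refl) vanish =
  trans (cong (f x +_) (trans (∑-congᴬ (AllP.map⁻ ne) (λ y ne′ → vanish y (ne′ ∘ sym))) (∑-zero xs)))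
    (ℚP.+-identityʳ (f x))
∑-single key f {z ∷ xs} {x} (ne ∷ un) (there x∈) vanish =
  trans (cong₂ _+_ (vanish z (All.lookup (AllP.map⁻ ne) x∈)) (∑-single key f un x∈ vanish))
    (ℚP.+-identityˡ (f x))

θ-independent : ∀ {ℓ} (cs : List (ℚ × (List ℕ × List (Fin ℓ)))) →
  All (λ c → Admissible (proj₁ (proj₂ c)) (proj₂ (proj₂ c))) cs → Unique (map proj₂ cs) →
  lin (map (λ c → proj₁ c , θ (proj₁ (proj₂ c)) (proj₂ (proj₂ c))) cs) ≈ zeroQ →
  All (λ c → proj₁ c ≡ 0ℚ) cs
θ-independent {ℓ} cs adm un lin≈0 = All.tabulate (λ {c} c∈ → vanish c c∈)
  where
  open ≡-Reasoning
  vanish : ∀ c → c ∈ cs → proj₁ c ≡ 0ℚ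
  vanish c@(q , S , u) c∈ = begin
    q                       ≡⟨ sym (ℚP.*-identityʳ q) ⟩
    q * 1ℚ                  ≡⟨ cong (q *_) (sym (cong₂ _*_ (sgn² (length u)) (sgn² (length S)))) ⟩
    q * (a * a * (b * b))   ≡⟨ regroup q a b ⟩
    q * (a * b * (1ℚ * 1ℚ)) * (a * b)
      ≡⟨ cong (λ z → q * (a * b * z) * (a * b)) (sym (cong₂ _*_ (δW.δ-≡ {x = u} refl) (δS.δ-≡ {x = S} refl))) ⟩
    f c * (a * b)           ≡⟨ cong (_* (a * b)) f≡0 ⟩
    0ℚ * (a * b)            ≡⟨ ℚP.*-zeroˡ (a * b) ⟩
    0ℚ ∎
    where
    a = sgn (length u)
    b = sgn (length S)
    regroup : ∀ q a b → q * (a * a * (b * b)) ≡ q * (a * b * (1ℚ * 1ℚ)) * (a * b)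
    regroup = solve 3 (λ q a b → q :* (a :* a :* (b :* b)) := q :* (a :* b :* (con 1ℚ :* con 1ℚ)) :* (a :* b)) refl
      where open +-*-Solver
    f : ℚ × (List ℕ × List (Fin ℓ)) → ℚ
    f (q′ , S′ , u′) = q′ * (sgn (length u′) * sgn (length S′) * (δW.δ u′ u * δS.δ S′ S))
    zero-off : ∀ c′ → proj₂ c′ ≢ (S , u) → f c′ ≡ 0ℚ
    zero-off (q′ , S′ , u′) ne = trans (cong (λ z → q′ * (s * z)) (prod (LP.≡-dec Fin._≟_ u′ u) (LP.≡-dec ℕ._≟_ S′ S)))
      (trans (cong (q′ *_) (ℚP.*-zeroʳ s)) (ℚP.*-zeroʳ q′))
      where
      s = sgn (length u′) * sgn (length S′)
      prod : Dec (u′ ≡ u) → Dec (S′ ≡ S) → δW.δ u′ u * δS.δ S′ S ≡ 0ℚ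
      prod (no u≢) _ = trans (cong (_* δS.δ S′ S) (δW.δ-≢ u≢)) (ℚP.*-zeroˡ (δS.δ S′ S))
      prod (yes _) (no S≢) = trans (cong (δW.δ u′ u *_) (δS.δ-≢ S≢)) (ℚP.*-zeroʳ (δW.δ u′ u))
      prod (yes refl) (yes refl) = ⊥-elim (ne refl)
    f≡0 : f c ≡ 0ℚ
    f≡0 = begin
      f c
        ≡⟨ sym (∑-single proj₂ f un c∈ zero-off) ⟩
      ∑ cs f
        ≡⟨ ∑-congᴬ adm (λ c′ adm′ → cong (proj₁ c′ *_)
             (sym (⟪θ,peakDual⟫ (proj₁ (proj₂ c′)) (proj₂ (proj₂ c′)) S u adm′))) ⟩
      ∑ cs (λ c′ → proj₁ c′ * ⟪ θ (proj₁ (proj₂ c′)) (proj₂ (proj₂ c′)) , peakDual S u ⟫)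
        ≡⟨ sym (⟪⟫-lin-map proj₁ (λ c′ → θ (proj₁ (proj₂ c′)) (proj₂ (proj₂ c′))) cs (peakDual S u)) ⟩
      ⟪ lin (map (λ c′ → proj₁ c′ , θ (proj₁ (proj₂ c′)) (proj₂ (proj₂ c′))) cs) , peakDual S u ⟫
        ≡⟨ ≈⇒⟪⟫ (lin (map (λ c′ → proj₁ c′ , θ (proj₁ (proj₂ c′)) (proj₂ (proj₂ c′))) cs)) zeroQ lin≈0 (peakDual S u) ⟩
      0ℚ ∎

-- The coproduct

-- A list has exactly one split into prescribed parts, and it has one only if it is their
-- concatenation; this is why the coproduct reads coefficients at `I ++ J`.
∑-splits-δ : ∀ {ℓ} (L I J : VC ℓ) → ∑ (splits L) (λ p → δ (proj₁ p) I * δ (proj₂ p) J) ≡ δ L (I ++ J)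
∑-splits-δ [] [] J = trans (ℚP.+-identityʳ (1ℚ * δ [] J)) (ℚP.*-identityˡ (δ [] J))
∑-splits-δ [] (i ∷ I) J = 0*+ (δ [] J) 0ℚ
∑-splits-δ (x ∷ L) [] J = begin
  1ℚ * δ (x ∷ L) J + ∑ (map (map₁ (x ∷_)) (splits L)) (λ p → δ (proj₁ p) [] * δ (proj₂ p) J)
    ≡⟨ cong₂ _+_ (ℚP.*-identityˡ (δ (x ∷ L) J))
         (trans (∑-map (map₁ (x ∷_)) (splits L) _) (trans (∑-cong (splits L) (λ p → ℚP.*-zeroˡ (δ (proj₂ p) J))) (∑-zero (splits L)))) ⟩
  δ (x ∷ L) J + 0ℚ
    ≡⟨ ℚP.+-identityʳ (δ (x ∷ L) J) ⟩
  δ (x ∷ L) J ∎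
  where open ≡-Reasoning
∑-splits-δ (x ∷ L) (i ∷ I) J = begin
  0ℚ * δ (x ∷ L) J + ∑ (map (map₁ (x ∷_)) (splits L)) (λ p → δ (proj₁ p) (i ∷ I) * δ (proj₂ p) J)
    ≡⟨ 0*+ (δ (x ∷ L) J) _ ⟩
  ∑ (map (map₁ (x ∷_)) (splits L)) (λ p → δ (proj₁ p) (i ∷ I) * δ (proj₂ p) J)
    ≡⟨ ∑-map (map₁ (x ∷_)) (splits L) _ ⟩
  ∑ (splits L) (λ p → δ (x ∷ proj₁ p) (i ∷ I) * δ (proj₂ p) J)
    ≡⟨ ∑-cong (splits L) (λ p → trans (cong (_* δ (proj₂ p) J) (𝟙-∧ (does (x ≟C i)) (does (proj₁ p ≟V I))))
         (ℚP.*-assoc d (δ (proj₁ p) I) (δ (proj₂ p) J))) ⟩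
  ∑ (splits L) (λ p → d * (δ (proj₁ p) I * δ (proj₂ p) J))
    ≡⟨ trans (∑-*ˡ d (splits L) _) (cong (d *_) (∑-splits-δ L I J)) ⟩
  d * δ L (I ++ J)
    ≡⟨ sym (𝟙-∧ (does (x ≟C i)) (does (L ≟V (I ++ J)))) ⟩
  δ (x ∷ L) (i ∷ I ++ J) ∎
  where
  open ≡-Reasoning
  d = 𝟙 (does (x ≟C i))

coeff2-Δ : ∀ {ℓ} (h : QS ℓ) I J → coeff2 (Δ h) I J ≡ coeff h (I ++ J)
coeff2-Δ {ℓ} h I J = begin
  coeff2 (Δ h) I J
    ≡⟨ ∑-filter₁ (λ x → (proj₁ (proj₂ x) ≟V I) ×-dec (proj₂ (proj₂ x) ≟V J)) (Δ h) ⟩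
  ∑ (Δ h) (λ x → proj₁ x * 𝟙 (does (proj₁ (proj₂ x) ≟V I) ∧ does (proj₂ (proj₂ x) ≟V J)))
    ≡⟨ ∑-cong (Δ h) (λ x → cong (proj₁ x *_) (𝟙-∧ (does (proj₁ (proj₂ x) ≟V I)) (does (proj₂ (proj₂ x) ≟V J)))) ⟩
  ∑ (Δ h) (λ x → proj₁ x * (δ (proj₁ (proj₂ x)) I * δ (proj₂ (proj₂ x)) J))
    ≡⟨ ∑-concatMap (λ t → map (λ jk → (proj₁ t , proj₁ jk , proj₂ jk)) (splits (proj₂ t))) h _ ⟩
  ∑ h (λ t → ∑ (map (λ jk → (proj₁ t , proj₁ jk , proj₂ jk)) (splits (proj₂ t)))
               (λ x → proj₁ x * (δ (proj₁ (proj₂ x)) I * δ (proj₂ (proj₂ x)) J)))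
    ≡⟨ ∑-cong h (λ t → trans (∑-map (λ jk → (proj₁ t , proj₁ jk , proj₂ jk)) (splits (proj₂ t)) _)
         (trans (∑-*ˡ (proj₁ t) (splits (proj₂ t)) _) (cong (proj₁ t *_) (∑-splits-δ (proj₂ t) I J)))) ⟩
  ⟪ h , (λ L → δ L (I ++ J)) ⟫
    ≡⟨ sym (coeff≡⟪⟫ h (I ++ J)) ⟩
  coeff h (I ++ J) ∎
  where open ≡-Reasoning

∑₂ : ∀ {ℓ} → VC ℓ → VC ℓ → (VC ℓ → VC ℓ → ℚ) → ℚ
∑₂ I J H = ∑ (coarsenings I) (λ K → ∑ (coarsenings J) (H K))

-- Splitting a coarsening of I happens at a boundary between columns of I, so it amounts to
-- splitting I there and coarsening both parts independently.
∑-coarsenings-splits : ∀ {ℓ} (I : VC ℓ) (H : VC ℓ → VC ℓ → ℚ) →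
  ∑ (coarsenings I) (λ L → ∑ (splits L) (λ p → H (proj₁ p) (proj₂ p))) ≡
  ∑ (splits I) (λ p → ∑₂ (proj₁ p) (proj₂ p) H)
∑-coarsenings-splits [] H =
  cong (_+ 0ℚ) (sym (ℚP.+-identityʳ (H [] [] + 0ℚ)))
∑-coarsenings-splits (v ∷ []) H = trans
  (ℚP.+-identityʳ (H [] (v ∷ []) + (H (v ∷ []) [] + 0ℚ)))
  (sym (cong₂ _+_ (dup (H [] (v ∷ []))) (cong (_+ 0ℚ) (dup (H (v ∷ []) [])))))
  where
  dup : ∀ x → (x + 0ℚ) + 0ℚ ≡ x
  dup x = trans (ℚP.+-identityʳ (x + 0ℚ)) (ℚP.+-identityʳ x)
∑-coarsenings-splits {ℓ} (v ∷ I@(w ∷ I′)) H = begin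
  ∑ (coarsenings (v ∷ I)) Sp
    ≡⟨ ∑-coarsenings-∷ v (cons w I′) Sp ⟩
  ∑ cs (λ K → Sp (v ∷ K)) + ∑ cs (λ K → Sp (mergeHead v K))
    ≡⟨ sym (∑-+ cs (λ K → Sp (v ∷ K)) (λ K → Sp (mergeHead v K))) ⟩
  ∑ cs (λ K → Sp (v ∷ K) + Sp (mergeHead v K))
    ≡⟨ ∑-congᴬ (coarsenings-ne (cons w I′)) step ⟩
  ∑ cs (λ K → (H [] (v ∷ K) + H [] (mergeHead v K)) + ∑ (splits K) (λ p → H′ (proj₁ p) (proj₂ p)))
    ≡⟨ ∑-+ cs (λ K → H [] (v ∷ K) + H [] (mergeHead v K)) (λ K → ∑ (splits K) (λ p → H′ (proj₁ p) (proj₂ p))) ⟩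
  ∑ cs (λ K → H [] (v ∷ K) + H [] (mergeHead v K)) + ∑ cs (λ K → ∑ (splits K) (λ p → H′ (proj₁ p) (proj₂ p)))
    ≡⟨ cong₂ _+_ (trans (∑-+ cs (λ K → H [] (v ∷ K)) (λ K → H [] (mergeHead v K)))
                   (sym (∑-coarsenings-∷ v (cons w I′) (H []))))
                 (∑-coarsenings-splits I H′) ⟩
  ∑ (coarsenings (v ∷ I)) (H []) + ∑ (splits I) (λ p → ∑₂ (proj₁ p) (proj₂ p) H′)
    ≡⟨ cong₂ _+_ (sym (ℚP.+-identityʳ (∑ (coarsenings (v ∷ I)) (H []))))
         (trans (∑-cong (splits I) (λ p → sym (extend (proj₁ p) (proj₂ p))))
           (sym (∑-map (map₁ (v ∷_)) (splits I) (λ p → ∑₂ (proj₁ p) (proj₂ p) H)))) ⟩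
  ∑ (splits (v ∷ I)) (λ p → ∑₂ (proj₁ p) (proj₂ p) H) ∎
  where
  open ≡-Reasoning
  cs = coarsenings I
  Sp : VC ℓ → ℚ
  Sp L = ∑ (splits L) (λ p → H (proj₁ p) (proj₂ p))
  -- `H′` puts `v` back into the left part, both as its own column and merged with the next one; if
  -- the left part is empty, only the first is possible. The split with nothing on the left of `v`
  -- is counted apart.
  H′ : VC ℓ → VC ℓ → ℚ
  H′ [] K₂ = H (v ∷ []) K₂
  H′ (k ∷ K₁) K₂ = H (v ∷ k ∷ K₁) K₂ + H ((v +c k) ∷ K₁) K₂
  rearrange : ∀ a b c d e′ → (a + (b + c)) + (d + e′) ≡ (a + d) + (b + (c + e′))
  rearrange = solve 5 (λ a b c d x → (a :+ (b :+ c)) :+ (d :+ x) := (a :+ d) :+ (b :+ (c :+ x))) refl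
    where open +-*-Solver
  step : ∀ K → NonEmpty K → Sp (v ∷ K) + Sp (mergeHead v K) ≡
    (H [] (v ∷ K) + H [] (mergeHead v K)) + ∑ (splits K) (λ p → H′ (proj₁ p) (proj₂ p))
  step .(k ∷ K) (cons k K) = begin
    Sp (v ∷ k ∷ K) + Sp ((v +c k) ∷ K)
      ≡⟨ cong₂ _+_ (cong (λ z → a + (b + z)) (trans (cong (λ z → ∑ z G) (sym (LP.map-∘ (splits K))))
                     (∑-map (λ p → v ∷ k ∷ proj₁ p , proj₂ p) (splits K) G)))
                   (cong (d +_) (∑-map (map₁ ((v +c k) ∷_)) (splits K) G)) ⟩
    (a + (b + ∑ (splits K) (λ p → H (v ∷ k ∷ proj₁ p) (proj₂ p)))) + (d + ∑ (splits K) (λ p → H ((v +c k) ∷ proj₁ p) (proj₂ p)))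
      ≡⟨ rearrange a b (∑ (splits K) (λ p → H (v ∷ k ∷ proj₁ p) (proj₂ p))) d (∑ (splits K) (λ p → H ((v +c k) ∷ proj₁ p) (proj₂ p))) ⟩
    (a + d) + (b + (∑ (splits K) (λ p → H (v ∷ k ∷ proj₁ p) (proj₂ p)) + ∑ (splits K) (λ p → H ((v +c k) ∷ proj₁ p) (proj₂ p))))
      ≡⟨ cong (λ z → (a + d) + (b + z))
           (trans (sym (∑-+ (splits K) (λ p → H (v ∷ k ∷ proj₁ p) (proj₂ p)) (λ p → H ((v +c k) ∷ proj₁ p) (proj₂ p))))
             (sym (∑-map (map₁ (k ∷_)) (splits K) (λ p → H′ (proj₁ p) (proj₂ p))))) ⟩
    (a + d) + ∑ (splits (k ∷ K)) (λ p → H′ (proj₁ p) (proj₂ p)) ∎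
    where
    a = H [] (v ∷ k ∷ K)
    b = H (v ∷ []) (k ∷ K)
    d = H [] ((v +c k) ∷ K)
    G : VC ℓ × VC ℓ → ℚ
    G p = H (proj₁ p) (proj₂ p)
  extend : ∀ I₁ I₂ → ∑₂ (v ∷ I₁) I₂ H ≡ ∑₂ I₁ I₂ H′
  extend [] I₂ = refl
  extend (x ∷ I₁) I₂ = trans (∑-coarsenings-∷ v (cons x I₁) (λ K → ∑ (coarsenings I₂) (H K)))
    (trans (sym (∑-+ (coarsenings (x ∷ I₁)) (λ K → ∑ (coarsenings I₂) (H (v ∷ K))) (λ K → ∑ (coarsenings I₂) (H (mergeHead v K)))))
      (∑-congᴬ (coarsenings-ne (cons x I₁)) (λ { .(k ∷ K) (cons k K) →
        sym (∑-+ (coarsenings I₂) (H (v ∷ k ∷ K)) (H ((v +c k) ∷ K))) })))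

splits-++ : {A : Set} (L : List A) → All (λ p → proj₁ p ++ proj₂ p ≡ L) (splits L)
splits-++ [] = refl ∷ []
splits-++ (x ∷ L) = refl ∷ AllP.map⁺ (All.map (cong (x ∷_)) (splits-++ L))

∑-*-∑ : {A B : Set} (xs : List A) (ys : List B) (f : A → ℚ) (g : B → ℚ) →
  ∑ xs (λ x → ∑ ys (λ y → f x * g y)) ≡ ∑ xs f * ∑ ys g
∑-*-∑ xs ys f g = trans (∑-cong xs (λ x → ∑-*ˡ (f x) ys g)) (∑-*ʳ xs f (∑ ys g))

coeff-η : ∀ {ℓ} (I J : VC ℓ) → coeff (η I) J ≡ ∑ (coarsenings I) (λ L → pow2 (length L) * δ L J)
coeff-η I J = trans (coeff≡⟪⟫ (η I) J) (⟪η⟫ I (λ L → δ L J))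

-- The coefficient form of Δ η_I = Σ η_{I₁} ⊗ η_{I₂}, over all I = I₁ I₂: lengths add under
-- concatenation, so the powers of two factor.
coeff-η-++ : ∀ {ℓ} (I J K : VC ℓ) →
  coeff (η I) (J ++ K) ≡ ∑ (splits I) (λ p → coeff (η (proj₁ p)) J * coeff (η (proj₂ p)) K)
coeff-η-++ {ℓ} I J K = begin
  coeff (η I) (J ++ K)
    ≡⟨ coeff-η I (J ++ K) ⟩
  ∑ (coarsenings I) (λ L → pow2 (length L) * δ L (J ++ K))
    ≡⟨ ∑-cong (coarsenings I) (λ L → trans (cong (pow2 (length L) *_) (sym (∑-splits-δ L J K)))
         (trans (sym (∑-*ˡ (pow2 (length L)) (splits L) (λ p → δ (proj₁ p) J * δ (proj₂ p) K)))
           (∑-congᴬ (splits-++ L) (step L)))) ⟩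
  ∑ (coarsenings I) (λ L → ∑ (splits L) (λ p → H (proj₁ p) (proj₂ p)))
    ≡⟨ ∑-coarsenings-splits I H ⟩
  ∑ (splits I) (λ p → ∑₂ (proj₁ p) (proj₂ p) H)
    ≡⟨ ∑-cong (splits I) (λ p → trans
         (∑-*-∑ (coarsenings (proj₁ p)) (coarsenings (proj₂ p)) (λ L → pow2 (length L) * δ L J) (λ L → pow2 (length L) * δ L K))
         (sym (cong₂ _*_ (coeff-η (proj₁ p) J) (coeff-η (proj₂ p) K)))) ⟩
  ∑ (splits I) (λ p → coeff (η (proj₁ p)) J * coeff (η (proj₂ p)) K) ∎
  where
  open ≡-Reasoning
  H : VC ℓ → VC ℓ → ℚ
  H L₁ L₂ = (pow2 (length L₁) * δ L₁ J) * (pow2 (length L₂) * δ L₂ K)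
  regroup : ∀ a b c d → a * b * (c * d) ≡ (a * c) * (b * d)
  regroup = solve 4 (λ a b c d → a :* b :* (c :* d) := (a :* c) :* (b :* d)) refl
    where open +-*-Solver
  step : ∀ L p → proj₁ p ++ proj₂ p ≡ L →
    pow2 (length L) * (δ (proj₁ p) J * δ (proj₂ p) K) ≡ H (proj₁ p) (proj₂ p)
  step L (L₁ , L₂) eq = trans (cong (_* (δ L₁ J * δ L₂ K))
      (trans (cong pow2 (trans (cong length (sym eq)) (LP.length-++ L₁))) (pow2-+ (length L₁) (length L₂))))
    (regroup (pow2 (length L₁)) (pow2 (length L₂)) (δ L₁ J) (δ L₂ K))

-- The span of the η_I with I odd

ηlin : ∀ {ℓ} → List (ℚ × VC ℓ) → QS ℓ
ηlin cs = lin (map (λ c → proj₁ c , η (proj₂ c)) cs)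

⟪ηlin⟫ : ∀ {ℓ} (cs : List (ℚ × VC ℓ)) f → ⟪ ηlin cs , f ⟫ ≡ ∑ cs (λ c → proj₁ c * ⟪ η (proj₂ c) , f ⟫)
⟪ηlin⟫ cs f = ⟪⟫-lin-map proj₁ (λ c → η (proj₂ c)) cs f

-- Equality is required against all functionals, which by `≈⇒⟪⟫` and `⟪⟫⇒≈` is the same as equality
-- of coefficients and is directly usable in sums.
OddSpan : ∀ {ℓ} → QS ℓ → Set
OddSpan {ℓ} h = Σ[ cs ∈ List (ℚ × VC ℓ) ] All (λ c → AllOdd (proj₂ c)) cs × (∀ f → ⟪ h , f ⟫ ≡ ⟪ ηlin cs , f ⟫)

oddSpan-·η : ∀ {ℓ} q {I : VC ℓ} → AllOdd I → OddSpan (q · η I)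
oddSpan-·η q {I} ods = (q , I) ∷ [] , ods ∷ [] , λ f →
  trans (⟪⟫-· q (η I) f) (trans (sym (ℚP.+-identityʳ (q * ⟪ η I , f ⟫))) (sym (⟪ηlin⟫ ((q , I) ∷ []) f)))

oddSpan-respects : ∀ {ℓ} (h g : QS ℓ) → h ≈ g → OddSpan h → OddSpan g
oddSpan-respects h g h≈g (cs , ods , eq) = cs , ods , λ f → trans (sym (≈⇒⟪⟫ h g h≈g f)) (eq f)

oddSpan-⊕ : ∀ {ℓ} (h g : QS ℓ) → OddSpan h → OddSpan g → OddSpan (h ⊕ g)
oddSpan-⊕ h g (cs , ods , eq) (cs′ , ods′ , eq′) = cs ++ cs′ , AllP.++⁺ ods ods′ , λ f → begin
  ⟪ h ⊕ g , f ⟫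
    ≡⟨ ⟪⟫-⊕ h g f ⟩
  ⟪ h , f ⟫ + ⟪ g , f ⟫
    ≡⟨ cong₂ _+_ (trans (eq f) (⟪ηlin⟫ cs f)) (trans (eq′ f) (⟪ηlin⟫ cs′ f)) ⟩
  ∑ cs (λ c → proj₁ c * ⟪ η (proj₂ c) , f ⟫) + ∑ cs′ (λ c → proj₁ c * ⟪ η (proj₂ c) , f ⟫)
    ≡⟨ sym (∑-++ cs cs′ (λ c → proj₁ c * ⟪ η (proj₂ c) , f ⟫)) ⟩
  ∑ (cs ++ cs′) (λ c → proj₁ c * ⟪ η (proj₂ c) , f ⟫)
    ≡⟨ sym (⟪ηlin⟫ (cs ++ cs′) f) ⟩
  ⟪ ηlin (cs ++ cs′) , f ⟫ ∎
  where open ≡-Reasoning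

oddSpan-· : ∀ {ℓ} q (h : QS ℓ) → OddSpan h → OddSpan (q · h)
oddSpan-· q h (cs , ods , eq) = cs′ , AllP.map⁺ ods , λ f → begin
  ⟪ q · h , f ⟫
    ≡⟨ ⟪⟫-· q h f ⟩
  q * ⟪ h , f ⟫
    ≡⟨ cong (q *_) (trans (eq f) (⟪ηlin⟫ cs f)) ⟩
  q * ∑ cs (λ c → proj₁ c * ⟪ η (proj₂ c) , f ⟫)
    ≡⟨ sym (∑-*ˡ q cs (λ c → proj₁ c * ⟪ η (proj₂ c) , f ⟫)) ⟩
  ∑ cs (λ c → q * (proj₁ c * ⟪ η (proj₂ c) , f ⟫))
    ≡⟨ ∑-cong cs (λ c → sym (ℚP.*-assoc q (proj₁ c) ⟪ η (proj₂ c) , f ⟫)) ⟩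
  ∑ cs (λ c → q * proj₁ c * ⟪ η (proj₂ c) , f ⟫)
    ≡⟨ sym (∑-map (λ c → q * proj₁ c , proj₂ c) cs (λ c → proj₁ c * ⟪ η (proj₂ c) , f ⟫)) ⟩
  ∑ cs′ (λ c → proj₁ c * ⟪ η (proj₂ c) , f ⟫)
    ≡⟨ sym (⟪ηlin⟫ cs′ f) ⟩
  ⟪ ηlin cs′ , f ⟫ ∎
  where
  open ≡-Reasoning
  cs′ = map (λ c → q * proj₁ c , proj₂ c) cs

oddSpan-inQSym : ∀ {ℓ} (h : QS ℓ) → OddSpan h → InQSym h
oddSpan-inQSym h (cs , ods , eq) I ¬valid = begin
  coeff h I
    ≡⟨ trans (coeff≡⟪⟫ h I) (trans (eq _) (⟪ηlin⟫ cs _)) ⟩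
  ∑ cs (λ c → proj₁ c * ⟪ η (proj₂ c) , (λ J → δ J I) ⟫)
    ≡⟨ ∑-congᴬ ods (λ c od → trans (cong (proj₁ c *_) (vanish (proj₂ c) od)) (ℚP.*-zeroʳ (proj₁ c))) ⟩
  ∑ cs (λ _ → 0ℚ)
    ≡⟨ ∑-zero cs ⟩
  0ℚ ∎
  where
  open ≡-Reasoning
  vanish : ∀ K → AllOdd K → ⟪ η K , (λ J → δ J I) ⟫ ≡ 0ℚ
  vanish K od = trans (⟪η⟫ K (λ J → δ J I)) (trans
    (∑-congᴬ (coarsenings-valid (allOdd⇒valid od)) (λ J vJ →
      trans (cong (pow2 (length J) *_) (δ-≢ {x = J} {y = I} (λ { refl → ¬valid vJ }))) (ℚP.*-zeroʳ (pow2 (length J)))))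
    (∑-zero (coarsenings K)))

⟪component⟫ : ∀ {ℓ} n (h : QS ℓ) f → ⟪ component n h , f ⟫ ≡ ⟪ h , (λ J → 𝟙 (does (ΣI J ≟C n)) * f J) ⟫
⟪component⟫ n h f = trans (∑-filter (λ t → ΣI (proj₂ t) ≟C n) h (λ t → proj₁ t * f (proj₂ t)))
  (∑-cong h (λ t → *-swap (𝟙 (does (ΣI (proj₂ t) ≟C n))) (proj₁ t) (f (proj₂ t))))

-- Coarsening preserves the total, so η_I is homogeneous of degree ΣI and taking a component just
-- selects summands.
⟪η,graded⟫ : ∀ {ℓ} n (I : VC ℓ) f →
  ⟪ η I , (λ J → 𝟙 (does (ΣI J ≟C n)) * f J) ⟫ ≡ 𝟙 (does (ΣI I ≟C n)) * ⟪ η I , f ⟫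
⟪η,graded⟫ n I f = begin
  ⟪ η I , (λ J → 𝟙 (does (ΣI J ≟C n)) * f J) ⟫
    ≡⟨ ⟪η⟫ I _ ⟩
  ∑ (coarsenings I) (λ J → pow2 (length J) * (𝟙 (does (ΣI J ≟C n)) * f J))
    ≡⟨ ∑-congᴬ (coarsenings-ΣI I) (λ J eq → trans (cong (λ z → pow2 (length J) * (𝟙 (does (z ≟C n)) * f J)) eq)
         (*-swap (pow2 (length J)) c (f J))) ⟩
  ∑ (coarsenings I) (λ J → c * (pow2 (length J) * f J))
    ≡⟨ ∑-*ˡ c (coarsenings I) (λ J → pow2 (length J) * f J) ⟩
  c * ∑ (coarsenings I) (λ J → pow2 (length J) * f J)
    ≡⟨ cong (c *_) (sym (⟪η⟫ I f)) ⟩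
  c * ⟪ η I , f ⟫ ∎
  where
  open ≡-Reasoning
  c = 𝟙 (does (ΣI I ≟C n))

oddSpan-graded : ∀ {ℓ} (h : QS ℓ) → OddSpan h → ∀ n → OddSpan (component n h)
oddSpan-graded h (cs , ods , eq) n = filter P? cs , AllP.filter⁺ P? ods , λ f → begin
  ⟪ component n h , f ⟫
    ≡⟨ trans (⟪component⟫ n h f) (trans (eq _) (⟪ηlin⟫ cs _)) ⟩
  ∑ cs (λ c → proj₁ c * ⟪ η (proj₂ c) , (λ J → 𝟙 (does (ΣI J ≟C n)) * f J) ⟫)
    ≡⟨ ∑-cong cs (λ c → trans (cong (proj₁ c *_) (⟪η,graded⟫ n (proj₂ c) f))
         (*-swap (proj₁ c) (𝟙 (does (P? c))) ⟪ η (proj₂ c) , f ⟫)) ⟩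
  ∑ cs (λ c → 𝟙 (does (P? c)) * (proj₁ c * ⟪ η (proj₂ c) , f ⟫))
    ≡⟨ sym (∑-filter P? cs (λ c → proj₁ c * ⟪ η (proj₂ c) , f ⟫)) ⟩
  ∑ (filter P? cs) (λ c → proj₁ c * ⟪ η (proj₂ c) , f ⟫)
    ≡⟨ sym (⟪ηlin⟫ (filter P? cs) f) ⟩
  ⟪ ηlin (filter P? cs) , f ⟫ ∎
  where
  open ≡-Reasoning
  P? = λ (c : ℚ × VC _) → ΣI (proj₂ c) ≟C n

oddSpan-coalgebra : ∀ {ℓ} (h : QS ℓ) → OddSpan h → InTensor OddSpan (Δ h)
oddSpan-coalgebra {ℓ} h (cs , ods , eq) = concatMap ps cs , AllP.concat⁺ (AllP.map⁺ (All.map (λ {c} → ps-odd {c}) ods)) , sums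
  where
  open ≡-Reasoning
  ps : ℚ × VC ℓ → List (QS ℓ × QS ℓ)
  -- The scalar goes to the left factor; the factor `1ℚ` gives the right one the same shape, so
  -- `oddSpan-·η` serves both.
  ps c = map (λ p → proj₁ c · η (proj₁ p) , 1ℚ · η (proj₂ p)) (splits (proj₂ c))
  ps-odd : ∀ {c} → AllOdd (proj₂ c) → All (λ p → OddSpan (proj₁ p) × OddSpan (proj₂ p)) (ps c)
  ps-odd {q , I} od = AllP.map⁺ (All.map (λ {p} eq →
    let od₁ , od₂ = AllP.++⁻ (proj₁ p) (subst AllOdd (sym eq) od)
    in oddSpan-·η q od₁ , oddSpan-·η 1ℚ od₂) (splits-++ I))
  sums : ∀ I J → coeff2 (Δ h) I J ≡ ∑ (concatMap ps cs) (λ p → coeff (proj₁ p) I * coeff (proj₂ p) J)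
  sums I J = begin
    coeff2 (Δ h) I J
      ≡⟨ coeff2-Δ h I J ⟩
    coeff h (I ++ J)
      ≡⟨ trans (coeff≡⟪⟫ h (I ++ J)) (trans (eq _) (sym (coeff≡⟪⟫ (ηlin cs) (I ++ J)))) ⟩
    coeff (ηlin cs) (I ++ J)
      ≡⟨ coeff-lin-map proj₁ (λ c → η (proj₂ c)) cs (I ++ J) ⟩
    ∑ cs (λ c → proj₁ c * coeff (η (proj₂ c)) (I ++ J))
      ≡⟨ ∑-cong cs (λ c → trans (cong (proj₁ c *_) (coeff-η-++ (proj₂ c) I J))
           (sym (∑-*ˡ (proj₁ c) (splits (proj₂ c)) (λ p → coeff (η (proj₁ p)) I * coeff (η (proj₂ p)) J)))) ⟩
    ∑ cs (λ c → ∑ (splits (proj₂ c)) (λ p → proj₁ c * (coeff (η (proj₁ p)) I * coeff (η (proj₂ p)) J)))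
      ≡⟨ ∑-cong cs (λ c → trans (∑-cong (splits (proj₂ c)) (step (proj₁ c)))
           (sym (∑-map (λ p → proj₁ c · η (proj₁ p) , 1ℚ · η (proj₂ p)) (splits (proj₂ c)) F))) ⟩
    ∑ cs (λ c → ∑ (ps c) F)
      ≡⟨ sym (∑-concatMap ps cs F) ⟩
    ∑ (concatMap ps cs) F ∎
    where
    F : QS ℓ × QS ℓ → ℚ
    F p = coeff (proj₁ p) I * coeff (proj₂ p) J
    regroup : ∀ q a b → q * (a * b) ≡ (q * a) * (1ℚ * b)
    regroup = solve 3 (λ q a b → q :* (a :* b) := (q :* a) :* (con 1ℚ :* b)) refl
      where open +-*-Solver
    step : ∀ q p → q * (coeff (η (proj₁ p)) I * coeff (η (proj₂ p)) J) ≡ F (q · η (proj₁ p) , 1ℚ · η (proj₂ p))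
    step q (I₁ , I₂) = trans (regroup q (coeff (η I₁) I) (coeff (η I₂) J))
      (sym (cong₂ _*_ (coeff-· q (η I₁) I) (coeff-· 1ℚ (η I₂) J)))

oddSpan-isGradedSubcoalgebra : ∀ {ℓ} → IsGradedSubcoalgebra (OddSpan {ℓ})
oddSpan-isGradedSubcoalgebra = record
  { respects = oddSpan-respects
  ; inQSym = oddSpan-inQSym
  ; has-zero = [] , [] , λ f → refl
  ; closed-⊕ = oddSpan-⊕
  ; closed-· = oddSpan-·
  ; graded = oddSpan-graded
  ; coalgebra = oddSpan-coalgebra
  }

-- The values of ζ̄ and ζ⁻¹ on η_I

-- ζ vanishes on prefixes of two or more columns. The recursion for ζ⁻¹ thus keeps only the
-- one-column prefix, and each column contributes a factor -1.
splitSum-long : ∀ {ℓ} (x y : Col ℓ) J K → splitSum (x ∷ y ∷ J) K ≡ 0ℚ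
splitSum-long x y J [] = refl
splitSum-long x y J (z ∷ K) = trans (0*+ (ζinvM (z ∷ K)) (splitSum (x ∷ y ∷ J ++ z ∷ []) K)) (splitSum-long x y (J ++ z ∷ []) K)

ζinvM≡sgn : ∀ {ℓ} (I : VC ℓ) → ζinvM I ≡ sgn (length I)
ζinvM≡sgn [] = refl
ζinvM≡sgn (x ∷ []) = refl
ζinvM≡sgn (x ∷ I@(y ∷ I′)) = begin
  - (1ℚ * ζinvM I + splitSum (x ∷ y ∷ []) I′)
    ≡⟨ cong -_ (cong₂ _+_ (trans (ℚP.*-identityˡ (ζinvM I)) (ζinvM≡sgn I)) (splitSum-long x y [] I′)) ⟩
  - (sgn (length I) + 0ℚ)
    ≡⟨ cong -_ (ℚP.+-identityʳ (sgn (length I))) ⟩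
  - sgn (length I)
    ≡⟨ sym (sgn-suc (length I)) ⟩
  sgn (suc (length I)) ∎
  where open ≡-Reasoning

ζbarM : ∀ {ℓ} → VC ℓ → ℚ
ζbarM I = sgn (wt (ΣI I)) * ζM I

-- Only the coarsest composition, a single column, escapes the vanishing condition.
∑-coarsenings-short : ∀ {ℓ} v (I : VC ℓ) (F : VC ℓ → ℚ) → (∀ x y K → F (x ∷ y ∷ K) ≡ 0ℚ) →
  ∑ (coarsenings (v ∷ I)) F ≡ F (ΣI (v ∷ I) ∷ [])
∑-coarsenings-short v [] F vanish =
  trans (ℚP.+-identityʳ (F (v ∷ []))) (cong (λ z → F (z ∷ [])) (sym (+c-identityʳ v)))
∑-coarsenings-short v (w ∷ I) F vanish = begin
  ∑ (coarsenings (v ∷ w ∷ I)) F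
    ≡⟨ ∑-coarsenings-∷ v (cons w I) F ⟩
  ∑ cs (λ K → F (v ∷ K)) + ∑ cs (λ K → F (mergeHead v K))
    ≡⟨ cong₂ _+_ (trans (∑-congᴬ (coarsenings-ne (cons w I)) (λ { _ (cons k K) → vanish v k K })) (∑-zero cs))
         (∑-coarsenings-short w I (λ K → F (mergeHead v K)) (λ x y K → vanish (v +c x) y K)) ⟩
  0ℚ + F (ΣI (v ∷ w ∷ I) ∷ [])
    ≡⟨ ℚP.+-identityˡ (F (ΣI (v ∷ w ∷ I) ∷ [])) ⟩
  F (ΣI (v ∷ w ∷ I) ∷ []) ∎
  where
  open ≡-Reasoning
  cs = coarsenings (w ∷ I)

-- Each gap between columns contributes 1 if merged and -2 if kept, in total -1; the initial column
-- contributes -2.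
∑-coarsenings-sgn : ∀ {ℓ} v (I : VC ℓ) →
  ∑ (coarsenings (v ∷ I)) (λ J → pow2 (length J) * sgn (length J)) ≡ pow2 1 * sgn (length (v ∷ I))
∑-coarsenings-sgn v [] = refl
∑-coarsenings-sgn v I@(w ∷ I′) = begin
  ∑ (coarsenings (v ∷ I)) F
    ≡⟨ ∑-coarsenings-∷ v (cons w I′) F ⟩
  ∑ cs (λ K → F (v ∷ K)) + ∑ cs (λ K → F (mergeHead v K))
    ≡⟨ cong₂ _+_ (trans (∑-cong cs step₁) (∑-*ˡ (- 2ℚ) cs F)) (∑-congᴬ (coarsenings-ne (cons w I′)) step₂) ⟩
  - 2ℚ * ∑ cs F + ∑ cs F
    ≡⟨ cong (λ z → - 2ℚ * z + z) (∑-coarsenings-sgn w I′) ⟩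
  - 2ℚ * (2ℚ * sgn (length I)) + 2ℚ * sgn (length I)
    ≡⟨ arith (sgn (length I)) ⟩
  2ℚ * - sgn (length I)
    ≡⟨ cong (2ℚ *_) (sym (sgn-suc (length I))) ⟩
  2ℚ * sgn (length (v ∷ I)) ∎
  where
  open ≡-Reasoning
  cs = coarsenings I
  F : VC _ → ℚ
  F J = pow2 (length J) * sgn (length J)
  arith : ∀ s → - 2ℚ * (2ℚ * s) + 2ℚ * s ≡ 2ℚ * - s
  arith = solve 1 (λ s → con (- 2ℚ) :* (con 2ℚ :* s) :+ con 2ℚ :* s := con 2ℚ :* (:- s)) refl
    where open +-*-Solver
  arith′ : ∀ p s → 2ℚ * p * - s ≡ - 2ℚ * (p * s)
  arith′ = solve 2 (λ p s → con 2ℚ :* p :* (:- s) := con (- 2ℚ) :* (p :* s)) refl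
    where open +-*-Solver
  step₁ : ∀ K → F (v ∷ K) ≡ - 2ℚ * F K
  step₁ K = trans (cong₂ _*_ (pow2-suc (length K)) (sgn-suc (length K))) (arith′ (pow2 (length K)) (sgn (length K)))
  step₂ : ∀ K → NonEmpty K → F (mergeHead v K) ≡ F K
  step₂ K ne = cong (λ k → pow2 k * sgn k) (length-mergeHead v ne)

-- For nonempty I both values are 2 up to sign: ζ̄ gives the parity of the weight of I, ζ⁻¹ that of
-- its number of columns, and odd columns make the two agree.
⟪η,ζbar⟫≡⟪η,ζinv⟫ : ∀ {ℓ} {I : VC ℓ} → AllOdd I → ⟪ η I , ζbarM ⟫ ≡ ⟪ η I , ζinvM ⟫
⟪η,ζbar⟫≡⟪η,ζinv⟫ {ℓ} [] = cong (λ s → 1ℚ * (s * 1ℚ) + 0ℚ) (cong sgn (wt-zeroCol ℓ))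
⟪η,ζbar⟫≡⟪η,ζinv⟫ {I = v ∷ I} ods = begin
  ⟪ η (v ∷ I) , ζbarM ⟫
    ≡⟨ ⟪η⟫ (v ∷ I) ζbarM ⟩
  ∑ (coarsenings (v ∷ I)) (λ J → pow2 (length J) * ζbarM J)
    ≡⟨ ∑-coarsenings-short v I (λ J → pow2 (length J) * ζbarM J) (λ x y K →
         trans (cong (pow2 (length (x ∷ y ∷ K)) *_) (ℚP.*-zeroʳ (sgn (wt (ΣI (x ∷ y ∷ K))))))
           (ℚP.*-zeroʳ (pow2 (length (x ∷ y ∷ K))))) ⟩
  pow2 1 * (sgn (wt (ΣI (v ∷ I) +c zeroCol)) * 1ℚ)
    ≡⟨ cong (pow2 1 *_) (trans (ℚP.*-identityʳ (sgn (wt (ΣI (v ∷ I) +c zeroCol))))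
         (trans (cong (λ z → sgn (wt z)) (+c-identityʳ (ΣI (v ∷ I))))
           (sgn-cong (wt (ΣI (v ∷ I))) (length (v ∷ I)) (isOddᵇ-wt-ΣI ods)))) ⟩
  pow2 1 * sgn (length (v ∷ I))
    ≡⟨ sym (∑-coarsenings-sgn v I) ⟩
  ∑ (coarsenings (v ∷ I)) (λ J → pow2 (length J) * sgn (length J))
    ≡⟨ ∑-cong (coarsenings (v ∷ I)) (λ J → cong (pow2 (length J) *_) (sym (ζinvM≡sgn J))) ⟩
  ∑ (coarsenings (v ∷ I)) (λ J → pow2 (length J) * ζinvM J)
    ≡⟨ sym (⟪η⟫ (v ∷ I) ζinvM) ⟩
  ⟪ η (v ∷ I) , ζinvM ⟫ ∎
  where open ≡-Reasoning

oddSpan-odd : ∀ {ℓ} (h : QS ℓ) → OddSpan h → ζbarQ h ≡ ζinvQ h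
oddSpan-odd h (cs , ods , eq) = trans (trans (eq ζbarM) (⟪ηlin⟫ cs ζbarM))
  (trans (∑-congᴬ ods (λ c od → cong (proj₁ c *_) (⟪η,ζbar⟫≡⟪η,ζinv⟫ od)))
    (sym (trans (eq ζinvM) (⟪ηlin⟫ cs ζinvM))))

oddSpan⇒InO : ∀ {ℓ} (h : QS ℓ) → OddSpan h → InO h
oddSpan⇒InO h s = OddSpan , oddSpan-isGradedSubcoalgebra , oddSpan-odd , s

θ-oddSpan : ∀ {ℓ} S (u : List (Fin ℓ)) → Admissible S u → OddSpan (θ S u)
θ-oddSpan S u adm = map (λ T → sgn (length T) , oddV (Ipk T u)) (sublists S) ,
  AllP.map⁺ (All.universal (λ T → oddV-allOdd (Ipk T u)) (sublists S)) ,
  λ f → trans (θ-η S u adm f) (sym (trans (⟪ηlin⟫ (map (λ T → sgn (length T) , oddV (Ipk T u)) (sublists S)) f)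
    (∑-map (λ T → sgn (length T) , oddV (Ipk T u)) (sublists S) (λ c → proj₁ c * ⟪ η (proj₂ c) , f ⟫))))

-- Elements of O^∞ are determined by their coefficients at odd vector compositions

module Slices {ℓ} {C : QS ℓ → Set} (isC : IsGradedSubcoalgebra C) where
  open IsGradedSubcoalgebra isC

  combination : {A : Set} (q : A → ℚ) (b : A → QS ℓ) {xs : List A} → All (λ x → C (b x)) xs →
    C (lin (map (λ x → q x , b x) xs))
  combination q b {[]} [] = has-zero
  combination q b {x ∷ xs} (p ∷ ps) =
    closed-⊕ (q x · b x) (lin (map (λ x → q x , b x) xs)) (closed-· (q x) (b x) p) (combination q b ps)

  -- Taking the coefficient at `I` in the left tensor factor of Δ h leaves an explicit combination
  -- of the right factors, all of which lie in C.
  leftSlice : ∀ h → C h → ∀ I → Σ[ g ∈ QS ℓ ] C g × (∀ J → coeff g J ≡ coeff h (I ++ J))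
  leftSlice h Ch I with coalgebra h Ch
  ... | ps , all , eq = lin (map (λ p → coeff (proj₁ p) I , proj₂ p) ps) ,
    combination (λ p → coeff (proj₁ p) I) proj₂ (All.map proj₂ all) ,
    λ J → trans (coeff-lin-map (λ p → coeff (proj₁ p) I) proj₂ ps J) (trans (sym (eq I J)) (coeff2-Δ h I J))

  rightSlice : ∀ h → C h → ∀ K → Σ[ g ∈ QS ℓ ] C g × (∀ J → coeff g J ≡ coeff h (J ++ K))
  rightSlice h Ch K with coalgebra h Ch
  ... | ps , all , eq = lin (map (λ p → coeff (proj₂ p) K , proj₁ p) ps) ,
    combination (λ p → coeff (proj₂ p) K) proj₁ (All.map proj₁ all) ,
    λ J → trans (coeff-lin-map (λ p → coeff (proj₂ p) K) proj₁ ps J)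
      (trans (∑-cong ps (λ p → ℚP.*-comm (coeff (proj₂ p) K) (coeff (proj₁ p) J)))
        (trans (sym (eq J K)) (coeff2-Δ h J K)))

  -- Projection to degree `n` leaves, when `n` is nonzero, only `n ∷ []` and compositions with at
  -- least two columns, so a single coefficient remains once the longer ones are known.
  homogeneousSlice : ∀ h → C h → ∀ I n K →
    Σ[ g ∈ QS ℓ ] C g × (∀ J → coeff g J ≡ 𝟙 (does (ΣI J ≟C n)) * coeff h (I ++ J ++ K))
  homogeneousSlice h Ch I n K =
    let g₁ , C₁ , eq₁ = leftSlice h Ch I
        g₂ , C₂ , eq₂ = rightSlice g₁ C₁ K
    in component n g₂ , graded g₂ C₂ n , λ J → trans (coeff-component g₂ J)
         (cong (𝟙 (does (ΣI J ≟C n)) *_) (trans (eq₂ J) (eq₁ (J ++ K))))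
    where
    open ≡-Reasoning
    coeff-component : ∀ g J → coeff (component n g) J ≡ 𝟙 (does (ΣI J ≟C n)) * coeff g J
    coeff-component g J = begin
      coeff (component n g) J
        ≡⟨ trans (coeff≡⟪⟫ (component n g) J) (⟪component⟫ n g _) ⟩
      ∑ g (λ t → proj₁ t * (𝟙 (does (ΣI (proj₂ t) ≟C n)) * δ (proj₂ t) J))
        ≡⟨ ∑-cong g (λ t → trans (cong (proj₁ t *_) (trans
               (ℚP.*-comm (𝟙 (does (ΣI (proj₂ t) ≟C n))) (δ (proj₂ t) J))
               (δ-subst (λ L → 𝟙 (does (ΣI L ≟C n))) (proj₂ t) J)))
             (rotate (proj₁ t) (δ (proj₂ t) J) c)) ⟩
      ∑ g (λ t → c * (proj₁ t * δ (proj₂ t) J))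
        ≡⟨ ∑-*ˡ c g (λ t → proj₁ t * δ (proj₂ t) J) ⟩
      c * ⟪ g , (λ L → δ L J) ⟫
        ≡⟨ cong (c *_) (sym (coeff≡⟪⟫ g J)) ⟩
      c * coeff g J ∎
      where
      c = 𝟙 (does (ΣI J ≟C n))
      rotate : ∀ a b c → a * (b * c) ≡ c * (a * b)
      rotate = solve 3 (λ a b c → a :* (b :* c) := c :* (a :* b)) refl
        where open +-*-Solver

evenColumn : ∀ {ℓ} (J : VC ℓ) → ¬ AllOdd J →
  Σ[ I ∈ VC ℓ ] Σ[ n ∈ Col ℓ ] Σ[ K ∈ VC ℓ ] J ≡ I ++ n ∷ K × isOddᵇ (wt n) ≡ false
evenColumn [] ¬odd = ⊥-elim (¬odd [])
evenColumn (v ∷ J) ¬odd with isOddᵇ (wt v) in eq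
... | false = [] , v , J , refl , eq
... | true with evenColumn J (λ odd → ¬odd (isOddᵇ⇒%2≡1 (wt v) eq ∷ odd))
... | I , n , K , refl , ev = v ∷ I , n , K , refl , ev

valid-length : ∀ {ℓ} {I : VC ℓ} → ValidVC I → length I ≤ wt (ΣI I)
valid-length [] = z≤n
valid-length {I = v ∷ I} (pv ∷ pI) =
  subst (suc (length I) ≤_) (sym (wt-+c v (ΣI I))) (ℕP.+-mono-≤ pv (valid-length pI))

ΣI-replace : ∀ {ℓ} (I J K : VC ℓ) n → ΣI J ≡ n → ΣI (I ++ J ++ K) ≡ ΣI (I ++ n ∷ K)
ΣI-replace I J K n eq = begin
  ΣI (I ++ J ++ K)         ≡⟨ ΣI-++ I (J ++ K) ⟩
  ΣI I +c ΣI (J ++ K)      ≡⟨ cong (ΣI I +c_) (trans (ΣI-++ J K) (cong (_+c ΣI K) eq)) ⟩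
  ΣI I +c ΣI (n ∷ K)       ≡⟨ sym (ΣI-++ I (n ∷ K)) ⟩
  ΣI (I ++ n ∷ K)          ∎
  where open ≡-Reasoning

length-replace : ∀ {ℓ} (I K : VC ℓ) n x y J → length (I ++ n ∷ K) < length (I ++ (x ∷ y ∷ J) ++ K)
length-replace [] K n x y J = s≤s (s≤s (subst (length K ≤_) (sym (LP.length-++ J)) (ℕP.m≤n+m (length K) (length J))))
length-replace (_ ∷ I) K n x y J = s≤s (length-replace I K n x y J)

-c≡c⇒c≡0 : ∀ c → c ≡ - c → c ≡ 0ℚ
-c≡c⇒c≡0 c eq = trans (half c) (trans (cong (λ z → ½ * (c + z)) eq) (trans (cong (½ *_) (ℚP.+-inverseʳ c)) refl))
  where
  open +-*-Solver
  half : ∀ c → c ≡ ½ * (c + c)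
  half = solve 1 (λ c → c := con ½ :* (c :+ c)) refl

coeff-single : ∀ {ℓ} q (I J : VC ℓ) → coeff ((q , I) ∷ []) J ≡ q * δ I J
coeff-single q I J = trans (coeff≡⟪⟫ ((q , I) ∷ []) J) (ℚP.+-identityʳ (q * δ I J))

-- On c M_n with |n| even, ζ̄ and ζ⁻¹ take the values c and -c.
even-multiple-zero : ∀ {ℓ} (d : QS ℓ) n → isOddᵇ (wt n) ≡ false → ζbarQ d ≡ ζinvQ d →
  (∀ J → J ≢ n ∷ [] → coeff d J ≡ 0ℚ) → coeff d (n ∷ []) ≡ 0ℚ
even-multiple-zero d n ev odd vanish = -c≡c⇒c≡0 c (begin
  c                               ≡⟨ sym (ℚP.*-identityʳ c) ⟩
  c * 1ℚ                          ≡⟨ sym (trans (ℚP.+-identityʳ (c * ζbarM (n ∷ []))) (cong (c *_) ζbar-n)) ⟩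
  ⟪ (c , n ∷ []) ∷ [] , ζbarM ⟫   ≡⟨ sym (≈⇒⟪⟫ d ((c , n ∷ []) ∷ []) d≈ ζbarM) ⟩
  ζbarQ d                         ≡⟨ odd ⟩
  ζinvQ d                         ≡⟨ ≈⇒⟪⟫ d ((c , n ∷ []) ∷ []) d≈ ζinvM ⟩
  c * - 1ℚ + 0ℚ                   ≡⟨ neg c ⟩
  - c                             ∎)
  where
  open ≡-Reasoning
  c = coeff d (n ∷ [])
  neg : ∀ c → c * - 1ℚ + 0ℚ ≡ - c
  neg = solve 1 (λ c → c :* con (- 1ℚ) :+ con 0ℚ := :- c) refl
    where open +-*-Solver
  ζbar-n : ζbarM (n ∷ []) ≡ 1ℚ
  ζbar-n = trans (ℚP.*-identityʳ (sgn (wt (n +c zeroCol))))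
    (trans (cong (λ z → sgn (wt z)) (+c-identityʳ n)) (sgn-cong (wt n) 0 ev))
  d≈ : d ≈ ((c , n ∷ []) ∷ [])
  d≈ J with J ≟V (n ∷ [])
  ... | yes refl = sym (trans (coeff-single c (n ∷ []) (n ∷ [])) (trans (cong (c *_) (δ-≡ {x = n ∷ []} refl)) (ℚP.*-identityʳ c)))
  ... | no J≢ = trans (vanish J J≢) (sym (trans (coeff-single c (n ∷ []) J)
          (trans (cong (c *_) (δ-≢ {x = n ∷ []} {y = J} (J≢ ∘ sym))) (ℚP.*-zeroʳ c))))

-- a and b are the coefficients of two elements of O^∞ at I J K, as functions of J, for fixed I and K.
even-step : ∀ {ℓ} (g g′ : QS ℓ) n (a b : VC ℓ → ℚ) → ζbarQ g ≡ ζinvQ g → ζbarQ g′ ≡ ζinvQ g′ →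
  (∀ J → coeff g J ≡ 𝟙 (does (ΣI J ≟C n)) * a J) → (∀ J → coeff g′ J ≡ 𝟙 (does (ΣI J ≟C n)) * b J) →
  isOddᵇ (wt n) ≡ false → 1 ≤ wt n → (∀ x y J → ΣI (x ∷ y ∷ J) ≡ n → a (x ∷ y ∷ J) ≡ b (x ∷ y ∷ J)) →
  a (n ∷ []) ≡ b (n ∷ [])
even-step {ℓ} g g′ n a b odd-g odd-g′ eq eq′ ev n≥1 finer = begin
  x                     ≡⟨ shift x y ⟩
  (x + - 1ℚ * y) + y    ≡⟨ cong (_+ y) (trans (sym (coeff-in (n ∷ []) (+c-identityʳ n))) (even-multiple-zero d n ev odd-d vanish)) ⟩
  0ℚ + y                ≡⟨ ℚP.+-identityˡ y ⟩
  y                     ∎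
  where
  open ≡-Reasoning
  x = a (n ∷ [])
  y = b (n ∷ [])
  d : QS ℓ
  -- `g` and `g′` may come from different subcoalgebras; `d` need not lie in either, but ζ̄ and ζ⁻¹
  -- agree on it by linearity.
  d = g ⊕ ((- 1ℚ) · g′)
  shift : ∀ x y → x ≡ (x + - 1ℚ * y) + y
  shift = solve 2 (λ x y → x := (x :+ con (- 1ℚ) :* y) :+ y) refl
    where open +-*-Solver
  self : ∀ x → x + - 1ℚ * x ≡ 0ℚ
  self = solve 1 (λ x → x :+ con (- 1ℚ) :* x := con 0ℚ) refl
    where open +-*-Solver
  coeff-d : ∀ J → coeff d J ≡ 𝟙 (does (ΣI J ≟C n)) * a J + - 1ℚ * (𝟙 (does (ΣI J ≟C n)) * b J)
  coeff-d J = trans (coeff-⊕ g ((- 1ℚ) · g′) J)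
    (cong₂ _+_ (eq J) (trans (coeff-· (- 1ℚ) g′ J) (cong (- 1ℚ *_) (eq′ J))))
  coeff-in : ∀ J → ΣI J ≡ n → coeff d J ≡ a J + - 1ℚ * b J
  coeff-in J eqn = trans (coeff-d J) (trans
    (cong (λ z → 𝟙 z * a J + - 1ℚ * (𝟙 z * b J)) (dec-true (ΣI J ≟C n) eqn))
    (cong₂ (λ p q → p + - 1ℚ * q) (ℚP.*-identityˡ (a J)) (ℚP.*-identityˡ (b J))))
  coeff-out : ∀ J → ΣI J ≢ n → coeff d J ≡ 0ℚ
  coeff-out J neq = trans (coeff-d J) (trans
    (cong (λ z → 𝟙 z * a J + - 1ℚ * (𝟙 z * b J)) (dec-false (ΣI J ≟C n) neq))
    (cong₂ (λ p q → p + - 1ℚ * q) (ℚP.*-zeroˡ (a J)) (ℚP.*-zeroˡ (b J))))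
  ⟪d⟫ : ∀ f → ⟪ d , f ⟫ ≡ ⟪ g , f ⟫ + - 1ℚ * ⟪ g′ , f ⟫
  ⟪d⟫ f = trans (⟪⟫-⊕ g ((- 1ℚ) · g′) f) (cong (⟪ g , f ⟫ +_) (⟪⟫-· (- 1ℚ) g′ f))
  odd-d : ζbarQ d ≡ ζinvQ d
  odd-d = trans (⟪d⟫ ζbarM) (trans (cong₂ (λ p q → p + - 1ℚ * q) odd-g odd-g′) (sym (⟪d⟫ ζinvM)))
  vanish-in : ∀ J → J ≢ n ∷ [] → ΣI J ≡ n → coeff d J ≡ 0ℚ
  vanish-in [] J≢ eqn = ⊥-elim (ℕP.<⇒≱ n≥1 (ℕP.≤-reflexive (trans (cong wt (sym eqn)) (wt-zeroCol ℓ))))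
  vanish-in (v ∷ []) J≢ eqn = ⊥-elim (J≢ (cong (_∷ []) (trans (sym (+c-identityʳ v)) eqn)))
  vanish-in (v ∷ w ∷ J) J≢ eqn = trans (coeff-in (v ∷ w ∷ J) eqn)
    (trans (cong (_+ - 1ℚ * b (v ∷ w ∷ J)) (finer v w J eqn)) (self (b (v ∷ w ∷ J))))
  vanish : ∀ J → J ≢ n ∷ [] → coeff d J ≡ 0ℚ
  vanish J J≢ = [ vanish-in J J≢ , coeff-out J ]′ (toSum (ΣI J ≟C n))

-- Two subcoalgebras are allowed because this is applied with the span of the η_I on one side and,
-- on the other, the one supplied by a proof of `InO`.
module _ {ℓ} {C C′ : QS ℓ → Set} (isC : IsGradedSubcoalgebra C) (isC′ : IsGradedSubcoalgebra C′)
  (oddC : ∀ g → C g → ζbarQ g ≡ ζinvQ g) (oddC′ : ∀ g → C′ g → ζbarQ g ≡ ζinvQ g)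
  (h h′ : QS ℓ) (Ch : C h) (C′h′ : C′ h′) (agree : ∀ J → AllOdd J → coeff h J ≡ coeff h′ J) where

  determined-even : ∀ I n K → isOddᵇ (wt n) ≡ false → 1 ≤ wt n →
    (∀ x y J → ΣI (x ∷ y ∷ J) ≡ n → coeff h (I ++ (x ∷ y ∷ J) ++ K) ≡ coeff h′ (I ++ (x ∷ y ∷ J) ++ K)) →
    coeff h (I ++ n ∷ K) ≡ coeff h′ (I ++ n ∷ K)
  determined-even I n K =
    let g , Cg , eq = Slices.homogeneousSlice isC h Ch I n K
        g′ , C′g′ , eq′ = Slices.homogeneousSlice isC′ h′ C′h′ I n K
    in even-step g g′ n (λ J → coeff h (I ++ J ++ K)) (λ J → coeff h′ (I ++ J ++ K)) (oddC g Cg) (oddC′ g′ C′g′) eq eq′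

  -- Induction on k, which bounds weight minus length: refining a column keeps the weight and raises the length.
  determined-bounded : ∀ k J → wt (ΣI J) < k ℕ.+ length J → coeff h J ≡ coeff h′ J
  -- Refining a column may produce columns of weight zero; there both coefficients vanish. Otherwise
  -- length is at most weight, which refutes the bound at `k = 0`.
  determined-bounded k J bound with All.all? (λ v → 1 ℕ.≤? wt v) J
  ... | no ¬valid = trans (IsGradedSubcoalgebra.inQSym isC h Ch J ¬valid)
          (sym (IsGradedSubcoalgebra.inQSym isC′ h′ C′h′ J ¬valid))
  determined-bounded zero J bound | yes valid = ⊥-elim (ℕP.<⇒≱ bound (valid-length valid))
  determined-bounded (suc k) J bound | yes valid with All.all? (λ v → wt v % 2 ℕ.≟ 1) J
  ... | yes odd = agree J odd
  ... | no ¬odd with evenColumn J ¬odd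
  ... | I , n , K , refl , ev =
    determined-even I n K ev (All.head (AllP.++⁻ʳ I valid)) (λ x y J eqn →
      determined-bounded k (I ++ (x ∷ y ∷ J) ++ K)
        (subst (λ z → wt z < k ℕ.+ length (I ++ (x ∷ y ∷ J) ++ K)) (sym (ΣI-replace I (x ∷ y ∷ J) K n eqn))
          (ℕP.≤-trans bound (subst (_≤ k ℕ.+ length (I ++ (x ∷ y ∷ J) ++ K)) (ℕP.+-suc k (length (I ++ n ∷ K)))
            (ℕP.+-monoʳ-≤ k (length-replace I K n x y J))))))

  determined : h ≈ h′
  determined J = determined-bounded (suc (wt (ΣI J))) J (s≤s (ℕP.m≤m+n (wt (ΣI J)) (length J)))

-- Matching the coefficients at odd vector compositions

OddApprox : ∀ {ℓ} → QS ℓ → Set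
OddApprox {ℓ} h = Σ[ g ∈ QS ℓ ] OddSpan g × (∀ J → AllOdd J → coeff h J ≡ coeff g J)

oddApprox-⊕ : ∀ {ℓ} (h h′ : QS ℓ) → OddApprox h → OddApprox h′ → OddApprox (h ⊕ h′)
oddApprox-⊕ h h′ (g , s , eq) (g′ , s′ , eq′) = g ⊕ g′ , oddSpan-⊕ g g′ s s′ , λ J od →
  trans (coeff-⊕ h h′ J) (trans (cong₂ _+_ (eq J od) (eq′ J od)) (sym (coeff-⊕ g g′ J)))

oddApprox-all : ∀ {ℓ} (h : QS ℓ) → All (λ t → OddApprox (t ∷ [])) h → OddApprox h
oddApprox-all [] [] = [] , ([] , [] , λ f → refl) , λ J od → refl
oddApprox-all (t ∷ h) (p ∷ ps) = oddApprox-⊕ (t ∷ []) h p (oddApprox-all h ps)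

-- If J is not odd, zero already has the right coefficients. If J is odd, M_J is a multiple of η_J
-- corrected by terms M_K with K shorter, to which the recursion on the length bound applies.
oddApprox-M : ∀ {ℓ} k q (J : VC ℓ) → length J < k → OddApprox ((q , J) ∷ [])
oddApprox-M (suc k) q J (s≤s len) with All.all? (λ v → wt v % 2 ℕ.≟ 1) J
... | no ¬odd = [] , ([] , [] , λ f → refl) , λ J′ od →
  trans (coeff-single q J J′) (trans (cong (q *_) (δ-≢ {x = J} {y = J′} (λ { refl → ¬odd od }))) (ℚP.*-zeroʳ q))
... | yes odd with coarsenings-head J
... | rest , eq , lt = subst-approx (oddApprox-⊕ (r · η J) lower approx-η approx-lower)
  where
  open ≡-Reasoning
  -- M_J has coefficient `pow2 (length J)` in η_J, so this multiple of η_J has `q` there.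
  r = q * ½^ (length J)
  lower : QS _
  lower = map (λ K → - (r * pow2 (length K)) , K) rest
  approx-η : OddApprox (r · η J)
  approx-η = r · η J , oddSpan-·η r odd , λ _ _ → refl
  approx-lower : OddApprox lower
  approx-lower = oddApprox-all lower (AllP.map⁺ (All.map (λ {K} K< →
    oddApprox-M k (- (r * pow2 (length K))) K (ℕP.<-≤-trans K< len)) lt))
  same : ∀ f → ⟪ (r · η J) ⊕ lower , f ⟫ ≡ ⟪ (q , J) ∷ [] , f ⟫
  same f = begin
    ⟪ (r · η J) ⊕ lower , f ⟫
      ≡⟨ trans (⟪⟫-⊕ (r · η J) lower f) (cong (_+ ⟪ lower , f ⟫) (trans (⟪⟫-· r (η J) f) (cong (r *_)
           (trans (⟪η⟫ J f) (cong (λ z → ∑ z F) eq))))) ⟩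
    r * (F J + ∑ rest F) + ⟪ lower , f ⟫
      ≡⟨ cong (r * (F J + ∑ rest F) +_) (trans (∑-map (λ K → - (r * pow2 (length K)) , K) rest _)
           (trans (∑-cong rest (λ K → regroup r (pow2 (length K)) (f K))) (∑-*ˡ (- r) rest F))) ⟩
    r * (F J + ∑ rest F) + - r * ∑ rest F
      ≡⟨ cancel q (½^ (length J)) (pow2 (length J)) (f J) (∑ rest F) ⟩
    q * (pow2 (length J) * ½^ (length J)) * f J + 0ℚ
      ≡⟨ cong (λ z → z * f J + 0ℚ) (trans (cong (q *_) (pow2-½^ (length J))) (ℚP.*-identityʳ q)) ⟩
    q * f J + 0ℚ ∎
    where
    F : VC _ → ℚ
    F K = pow2 (length K) * f K
    regroup : ∀ r p x → - (r * p) * x ≡ - r * (p * x)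
    regroup = solve 3 (λ r p x → (:- (r :* p)) :* x := (:- r) :* (p :* x)) refl
      where open +-*-Solver
    cancel : ∀ q h p x s → q * h * (p * x + s) + - (q * h) * s ≡ q * (p * h) * x + 0ℚ
    cancel = solve 5 (λ q h p x s → q :* h :* (p :* x :+ s) :+ (:- (q :* h)) :* s := q :* (p :* h) :* x :+ con 0ℚ) refl
      where open +-*-Solver
  subst-approx : OddApprox ((r · η J) ⊕ lower) → OddApprox ((q , J) ∷ [])
  subst-approx (g , s , eq′) = g , s , λ J′ od →
    trans (sym (⟪⟫⇒≈ ((r · η J) ⊕ lower) ((q , J) ∷ []) same J′)) (eq′ J′ od)

oddApprox : ∀ {ℓ} (h : QS ℓ) → OddApprox h
oddApprox h = oddApprox-all h (All.universal (λ t → oddApprox-M (suc (length (proj₂ t))) (proj₁ t) (proj₂ t) ℕP.≤-refl) h)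

InO⇒oddSpan : ∀ {ℓ} (h : QS ℓ) → InO h → OddSpan h
InO⇒oddSpan h (C , isC , oddC , Ch) =
  let g , s , agree = oddApprox h
      g≈h = determined oddSpan-isGradedSubcoalgebra isC oddSpan-odd oddC g h s Ch (λ J od → sym (agree J od))
  in oddSpan-respects g h g≈h s

-- Spanning by peak functions and conclusion

θlin : ∀ {ℓ} → List (ℚ × (List ℕ × List (Fin ℓ))) → QS ℓ
θlin cs = lin (map (λ c → proj₁ c , θ (proj₁ (proj₂ c)) (proj₂ (proj₂ c))) cs)

oddSpan⇒θ : ∀ {ℓ} (h : QS ℓ) → OddSpan h →
  Σ[ cs ∈ List (ℚ × (List ℕ × List (Fin ℓ))) ]
    All (λ c → Admissible (proj₁ (proj₂ c)) (proj₂ (proj₂ c))) cs × h ≈ θlin cs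
oddSpan⇒θ {ℓ} h (cs , ods , eq) =
  concatMap expand cs , AllP.concat⁺ (AllP.map⁺ (All.map (λ {c} → expand-admissible c) ods)) ,
  ⟪⟫⇒≈ h (θlin (concatMap expand cs)) (λ f → begin
    ⟪ h , f ⟫
      ≡⟨ trans (eq f) (⟪ηlin⟫ cs f) ⟩
    ∑ cs (λ c → proj₁ c * ⟪ η (proj₂ c) , f ⟫)
      ≡⟨ ∑-congᴬ ods (λ c od → sym (expand-sum f c od)) ⟩
    ∑ cs (λ c → ∑ (expand c) (λ d → proj₁ d * ⟪ θ (proj₁ (proj₂ d)) (proj₂ (proj₂ d)) , f ⟫))
      ≡⟨ sym (∑-concatMap expand cs _) ⟩
    ∑ (concatMap expand cs) (λ d → proj₁ d * ⟪ θ (proj₁ (proj₂ d)) (proj₂ (proj₂ d)) , f ⟫)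
      ≡⟨ sym (⟪⟫-lin-map proj₁ (λ d → θ (proj₁ (proj₂ d)) (proj₂ (proj₂ d))) (concatMap expand cs) f) ⟩
    ⟪ θlin (concatMap expand cs) , f ⟫ ∎)
  where
  open ≡-Reasoning
  expand : ℚ × VC ℓ → List (ℚ × (List ℕ × List (Fin ℓ)))
  expand (q , I) = map (λ T → q * sgn (length T) , T , cw I) (sublists (Pk (tilde I)))
  expand-admissible : ∀ c → AllOdd (proj₂ c) → All (λ d → Admissible (proj₁ (proj₂ d)) (proj₂ (proj₂ d))) (expand c)
  expand-admissible (q , I) od =
    -- Pk(Ĩ) comes with a sorted tiling of cw(I), and removing peaks keeps it sorted, so every index
    -- produced is admissible.
    AllP.map⁺ (All.tabulate (λ T∈ → tiling⇒admissible (proj₂ (tiling-sublists (tilde-tiling-Pk od) T∈))))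
  expand-sum : ∀ f c → AllOdd (proj₂ c) →
    ∑ (expand c) (λ d → proj₁ d * ⟪ θ (proj₁ (proj₂ d)) (proj₂ (proj₂ d)) , f ⟫) ≡ proj₁ c * ⟪ η (proj₂ c) , f ⟫
  expand-sum f (q , I) od = begin
    ∑ (expand (q , I)) (λ d → proj₁ d * ⟪ θ (proj₁ (proj₂ d)) (proj₂ (proj₂ d)) , f ⟫)
      ≡⟨ ∑-map (λ T → q * sgn (length T) , T , cw I) Ts _ ⟩
    ∑ Ts (λ T → q * sgn (length T) * ⟪ θ T (cw I) , f ⟫)
      ≡⟨ ∑-cong Ts (λ T → ℚP.*-assoc q (sgn (length T)) ⟪ θ T (cw I) , f ⟫) ⟩
    ∑ Ts (λ T → q * (sgn (length T) * ⟪ θ T (cw I) , f ⟫))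
      ≡⟨ ∑-*ˡ q Ts (λ T → sgn (length T) * ⟪ θ T (cw I) , f ⟫) ⟩
    q * ∑ Ts (λ T → sgn (length T) * ⟪ θ T (cw I) , f ⟫)
      ≡⟨ cong (q *_) (sym (η-θ-odd od f)) ⟩
    q * ⟪ η I , f ⟫ ∎
    where Ts = sublists (Pk (tilde I))

η≈∑θ : ∀ {ℓ} (I : VC ℓ) → AllOdd I →
  η I ≈ lin (map (λ S → sgn (length S) , θ S (cw I)) (sublists (Pk (tilde I))))
η≈∑θ I od = ⟪⟫⇒≈ (η I) (lin (map (λ S → sgn (length S) , θ S (cw I)) Ts)) (λ f → trans (η-θ-odd od f)
  (sym (⟪⟫-lin-map (λ S → sgn (length S)) (λ S → θ S (cw I)) Ts f)))
  where Ts = sublists (Pk (tilde I))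

θ≈∑η : ∀ {ℓ} S (u : List (Fin ℓ)) → Admissible S u →
  θ S u ≈ lin (map (λ T → sgn (length T) , η (oddV (Ipk T u))) (sublists S))
θ≈∑η S u adm = ⟪⟫⇒≈ (θ S u) (lin (map (λ T → sgn (length T) , η (oddV (Ipk T u))) (sublists S))) (λ f →
  trans (θ-η S u adm f) (sym (⟪⟫-lin-map (λ T → sgn (length T)) (λ T → η (oddV (Ipk T u))) (sublists S) f)))

theorem6p7 : (ℓ : ℕ) → 1 ≤ ℓ →
  -- (1a) each θ_{S,u}, (S,u) admissible, lies in O^∞
  ((S : List ℕ) (u : List (Fin ℓ)) → Admissible S u → InO (θ S u))
  -- (1b) linear independence of the θ_{S,u} over distinct admissible pairs
  × ((cs : List (ℚ × (List ℕ × List (Fin ℓ))))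
      → All (λ c → Admissible (proj₁ (proj₂ c)) (proj₂ (proj₂ c))) cs
      → Unique (map proj₂ cs)
      → lin (map (λ c → proj₁ c , θ (proj₁ (proj₂ c)) (proj₂ (proj₂ c))) cs) ≈ zeroQ
      → All (λ c → proj₁ c ≡ 0ℚ) cs)
  -- (1c) the θ_{S,u}, (S,u) admissible, span O^∞
  × ((h : QS ℓ) → InO h
      → Σ[ cs ∈ List (ℚ × (List ℕ × List (Fin ℓ))) ]
          All (λ c → Admissible (proj₁ (proj₂ c)) (proj₂ (proj₂ c))) cs
          × h ≈ lin (map (λ c → proj₁ c , θ (proj₁ (proj₂ c)) (proj₂ (proj₂ c))) cs))
  -- (2) η_I = Σ_{S ⊆ Pk(Ĩ)} (-1)^{|S|} θ_{S,u} for I with all columns odd, u = cw(I)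
  × ((I : VC ℓ) → ValidVC I → All (λ v → wt v % 2 ≡ 1) I
      → η I ≈ lin (map (λ S → sgn (length S) , θ S (cw I)) (sublists (Pk (tilde I)))))
  -- (3) θ_{S,u} = Σ_{T ⊆ S} (-1)^{|T|} η_{odd(I_{T,u})} for (S,u) admissible
  × ((S : List ℕ) (u : List (Fin ℓ)) → Admissible S u
      → θ S u ≈ lin (map (λ T → sgn (length T) , η (oddV (Ipk T u))) (sublists S)))
theorem6p7 ℓ _ =
  (λ S u adm → oddSpan⇒InO (θ S u) (θ-oddSpan S u adm)) ,
  θ-independent ,
  (λ h inO → oddSpan⇒θ h (InO⇒oddSpan h inO)) ,
  (λ I _ → η≈∑θ I) ,
  θ≈∑η
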